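{- Let $q\in\mathbb{C}$ with $0<|q|<1$, let $h\in\mathbb{Z}^{+}$, let $\xi\in\mathbb{C}$ be a root of unity, and let $a,f$ be integers with $0<a<f$. Let $n\in\mathbb{Z}^{+}$. Then $$H_{\xi,q}^{(h)}(1-n,a:f)=-\frac{q^{ha}\xi^{a}f^{n-1}B_{n,\xi^{f}}^{(h)}\left(\frac{a}{f},q^{f}\right)}{n}.$$
   Context: Fix a value of $\log q$, and put $\log q^{h}=h\log q$, $\log q^{f}=f\log q$, $\log (q^f)^h=hf\log q$. The twisted $(h,q)$-partial zeta function is defined, for complex $s\neq 1$ and integers $0<a<f$, by $$H_{\xi,q}^{(h)}(s,a:f)=\sum_{\substack{n\equiv a\,(\mathrm{mod}\, f)\\ n>0}}\frac{q^{nh}\xi^{n}}{n^{s}}-\frac{\log q^{h}}{s-1}\sum_{\substack{n\equiv a\,(\mathrm{mod}\, f)\\ n>0}}\frac{q^{nh}\xi^{n}}{n^{s-1}}.$$ The twisted $(h,q)$-Bernoulli polynomials $B_{n,\xi}^{(h)}(z,q)$ are defined by $$\frac{(t+\log q^{h})e^{tz}}{\xi q^{h}e^{t}-1}=\sum_{n=0}^{\infty}B_{n,\xi}^{(h)}(z,q)\frac{t^{n}}{n!},$$ and $B_{n,\xi^f}^{(h)}(z,q^f)$ is obtained by replacing $(\xi,q)$ by $(\xi^f,q^f)$. -}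

module Defs where

open import Algebra.Bundles using (CommutativeMonoid; RawRing)
open import Data.Bool.Base using (if_then_else_)
open import Data.Fin.Base using (toℕ)
open import Data.Integer.Base using (+_)
open import Data.Nat.Base as ℕ using (ℕ; zero; suc; _∸_; _!; NonZero)
import Data.Nat.Properties as ℕ
open import Data.Nat.Divisibility using (_∣?_)
open import Data.Product.Base using (_×_; _,_; ∃-syntax; Σ-syntax)
open import Data.Rational.Base as ℚ using (ℚ; 0ℚ; 1ℚ)
import Data.Rational.Properties as ℚ
open import Level using (0ℓ)
open import Relation.Binary.PropositionalEquality
  using (_≡_; sym; trans; cong; cong₂; subst; module ≡-Reasoning)
open import Relation.Nullary using (¬_)
open import Relation.Nullary.Decidable.Core using (does)

------------------------------------------------------------------------
-- Real numbers: Cauchy sequences of rationals, with equality _≈ᴿ_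

IsCauchy : (ℕ → ℚ) → Set
IsCauchy x = ∀ ε → 0ℚ ℚ.< ε →
  ∃[ N ] (∀ m n → N ℕ.≤ m → N ℕ.≤ n → ℚ.∣ x m ℚ.- x n ∣ ℚ.< ε)

record ℝ : Set where
  constructor mkℝ
  field
    seq    : ℕ → ℚ
    cauchy : IsCauchy seq

open ℝ public

infix 4 _≈ᴿ_ _<ᴿ_ _≤ᴿ_

_≈ᴿ_ : ℝ → ℝ → Set
x ≈ᴿ y = ∀ ε → 0ℚ ℚ.< ε →
  ∃[ N ] (∀ n → N ℕ.≤ n → ℚ.∣ seq x n ℚ.- seq y n ∣ ℚ.< ε)

_<ᴿ_ : ℝ → ℝ → Set
x <ᴿ y = ∃[ ε ] (0ℚ ℚ.< ε × ∃[ N ] (∀ n → N ℕ.≤ n → seq x n ℚ.+ ε ℚ.≤ seq y n))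

_≤ᴿ_ : ℝ → ℝ → Set
x ≤ᴿ y = ¬ (y <ᴿ x)

private
  open import Algebra.Properties.CommutativeSemigroup
    (CommutativeMonoid.commutativeSemigroup ℚ.+-0-commutativeMonoid)
    using (interchange)

  split-neg : ∀ a b → (ℚ.- a) ℚ.- (ℚ.- b) ≡ ℚ.- (a ℚ.- b)
  split-neg a b = sym (ℚ.neg-distrib-+ a (ℚ.- b))

  split-+ : ∀ a b c d → (a ℚ.+ b) ℚ.- (c ℚ.+ d) ≡ (a ℚ.- c) ℚ.+ (b ℚ.- d)
  split-+ a b c d = trans (cong ((a ℚ.+ b) ℚ.+_) (ℚ.neg-distrib-+ c d))
                          (interchange a b (ℚ.- c) (ℚ.- d))

  recentre : ∀ a b → a ≡ (a ℚ.- b) ℚ.+ b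
  recentre a b = begin
    a                      ≡⟨ ℚ.+-identityʳ a ⟨
    a ℚ.+ 0ℚ               ≡⟨ cong (a ℚ.+_) (ℚ.+-inverseˡ b) ⟨
    a ℚ.+ (ℚ.- b ℚ.+ b)    ≡⟨ ℚ.+-assoc a (ℚ.- b) b ⟨
    (a ℚ.- b) ℚ.+ b        ∎
    where open ≡-Reasoning

  telescope : ∀ a b c → (a ℚ.- b) ℚ.+ (b ℚ.- c) ≡ a ℚ.- c
  telescope a b c = trans (sym (ℚ.+-assoc (a ℚ.- b) b (ℚ.- c)))
                          (cong (ℚ._- c) (sym (recentre a b)))

  *-distribˡ-- : ∀ a b c → a ℚ.* (b ℚ.- c) ≡ a ℚ.* b ℚ.- a ℚ.* c
  *-distribˡ-- a b c = trans (ℚ.*-distribˡ-+ a b (ℚ.- c))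
                             (cong (a ℚ.* b ℚ.+_) (sym (ℚ.neg-distribʳ-* a c)))

  split-* : ∀ a b c d → a ℚ.* b ℚ.- c ℚ.* d ≡ (b ℚ.- d) ℚ.* a ℚ.+ (a ℚ.- c) ℚ.* d
  split-* a b c d = sym (begin
    (b ℚ.- d) ℚ.* a ℚ.+ (a ℚ.- c) ℚ.* d
      ≡⟨ cong₂ ℚ._+_ (ℚ.*-comm (b ℚ.- d) a) (ℚ.*-comm (a ℚ.- c) d) ⟩
    a ℚ.* (b ℚ.- d) ℚ.+ d ℚ.* (a ℚ.- c)
      ≡⟨ cong₂ ℚ._+_ (*-distribˡ-- a b d) (*-distribˡ-- d a c) ⟩
    (a ℚ.* b ℚ.- a ℚ.* d) ℚ.+ (d ℚ.* a ℚ.- d ℚ.* c)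
      ≡⟨ cong ((a ℚ.* b ℚ.- a ℚ.* d) ℚ.+_) (cong₂ ℚ._-_ (ℚ.*-comm d a) (ℚ.*-comm d c)) ⟩
    (a ℚ.* b ℚ.- a ℚ.* d) ℚ.+ (a ℚ.* d ℚ.- c ℚ.* d)
      ≡⟨ telescope (a ℚ.* b) (a ℚ.* d) (c ℚ.* d) ⟩
    a ℚ.* b ℚ.- c ℚ.* d ∎)
    where open ≡-Reasoning

  halve : ∀ ε → 0ℚ ℚ.< ε → ∃[ δ ] (0ℚ ℚ.< δ × δ ℚ.+ δ ≡ ε)
  halve ε 0<ε = ℚ.½ ℚ.* ε
    , subst (ℚ._< ℚ.½ ℚ.* ε) (ℚ.*-zeroʳ ℚ.½) (ℚ.*-monoʳ-<-pos ℚ.½ 0<ε)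
    , trans (sym (ℚ.*-distribʳ-+ ε ℚ.½ ℚ.½)) (ℚ.*-identityˡ ε)

  -- a Cauchy sequence is eventually bounded by a positive rational
  bound : ∀ x → IsCauchy x →
          ∃[ K ] (ℚ.Positive K × ∃[ N ] (∀ n → N ℕ.≤ n → ℚ.∣ x n ∣ ℚ.≤ K))
  bound x cx with cx 1ℚ (ℚ.positive⁻¹ 1ℚ)
  ... | N , near = 1ℚ ℚ.+ ℚ.∣ x N ∣ , pos , N , bounded
    where
    pos : ℚ.Positive (1ℚ ℚ.+ ℚ.∣ x N ∣)
    pos = ℚ.positive (ℚ.+-mono-<-≤ (ℚ.positive⁻¹ 1ℚ) (ℚ.0≤∣p∣ (x N)))
    bounded : ∀ n → N ℕ.≤ n → ℚ.∣ x n ∣ ℚ.≤ 1ℚ ℚ.+ ℚ.∣ x N ∣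
    bounded n N≤n = begin
      ℚ.∣ x n ∣                          ≡⟨ cong ℚ.∣_∣ (recentre (x n) (x N)) ⟩
      ℚ.∣ (x n ℚ.- x N) ℚ.+ x N ∣        ≤⟨ ℚ.∣p+q∣≤∣p∣+∣q∣ (x n ℚ.- x N) (x N) ⟩
      ℚ.∣ x n ℚ.- x N ∣ ℚ.+ ℚ.∣ x N ∣    ≤⟨ ℚ.+-monoˡ-≤ ℚ.∣ x N ∣ (ℚ.<⇒≤ (near n N N≤n ℕ.≤-refl)) ⟩
      1ℚ ℚ.+ ℚ.∣ x N ∣                   ∎
      where open ℚ.≤-Reasoning

  +-cauchy : ∀ x y → IsCauchy x → IsCauchy y → IsCauchy (λ n → x n ℚ.+ y n)
  +-cauchy x y cx cy ε 0<ε with halve ε 0<ε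
  ... | δ , 0<δ , δ+δ≡ε with cx δ 0<δ | cy δ 0<δ
  ... | M , nx | N , ny = M ℕ.⊔ N , λ m n M⊔N≤m M⊔N≤n → begin-strict
      ℚ.∣ (x m ℚ.+ y m) ℚ.- (x n ℚ.+ y n) ∣           ≡⟨ cong ℚ.∣_∣ (split-+ (x m) (y m) (x n) (y n)) ⟩
      ℚ.∣ (x m ℚ.- x n) ℚ.+ (y m ℚ.- y n) ∣           ≤⟨ ℚ.∣p+q∣≤∣p∣+∣q∣ (x m ℚ.- x n) (y m ℚ.- y n) ⟩
      ℚ.∣ x m ℚ.- x n ∣ ℚ.+ ℚ.∣ y m ℚ.- y n ∣         <⟨ ℚ.+-mono-<
          (nx m n (ℕ.≤-trans (ℕ.m≤m⊔n M N) M⊔N≤m) (ℕ.≤-trans (ℕ.m≤m⊔n M N) M⊔N≤n))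
          (ny m n (ℕ.≤-trans (ℕ.m≤n⊔m M N) M⊔N≤m) (ℕ.≤-trans (ℕ.m≤n⊔m M N) M⊔N≤n)) ⟩
      δ ℚ.+ δ                                         ≡⟨ δ+δ≡ε ⟩
      ε                                               ∎
    where open ℚ.≤-Reasoning

  neg-cauchy : ∀ x → IsCauchy x → IsCauchy (λ n → ℚ.- x n)
  neg-cauchy x cx ε 0<ε with cx ε 0<ε
  ... | N , nx = N , λ m n N≤m N≤n → subst (ℚ._< ε)
    (sym (trans (cong ℚ.∣_∣ (split-neg (x m) (x n))) (ℚ.∣-p∣≡∣p∣ (x m ℚ.- x n))))
    (nx m n N≤m N≤n)

  -- if ∣p∣ is small relative to the bound K of ∣r∣ then ∣p r∣ is small
  ∣*∣< : ∀ ε K .{{_ : ℚ.Positive K}} p r →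
         ℚ.∣ p ∣ ℚ.< ε ℚ.* (ℚ.1/ K) {{ℚ.pos⇒nonZero K}} → ℚ.∣ r ∣ ℚ.≤ K → ℚ.∣ p ℚ.* r ∣ ℚ.< ε
  ∣*∣< ε K p r p<ε/K r≤K = begin-strict
      ℚ.∣ p ℚ.* r ∣               ≡⟨ ℚ.∣p*q∣≡∣p∣*∣q∣ p r ⟩
      ℚ.∣ p ∣ ℚ.* ℚ.∣ r ∣         ≤⟨ ℚ.*-monoˡ-≤-nonNeg ℚ.∣ p ∣ {{ℚ.nonNegative (ℚ.0≤∣p∣ p)}} r≤K ⟩
      ℚ.∣ p ∣ ℚ.* K               <⟨ ℚ.*-monoˡ-<-pos K p<ε/K ⟩
      (ε ℚ.* ℚ.1/ K) ℚ.* K        ≡⟨ ℚ.*-assoc ε (ℚ.1/ K) K ⟩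
      ε ℚ.* (ℚ.1/ K ℚ.* K)        ≡⟨ cong (ε ℚ.*_) (ℚ.*-inverseˡ K) ⟩
      ε ℚ.* 1ℚ                    ≡⟨ ℚ.*-identityʳ ε ⟩
      ε                           ∎
    where
    open ℚ.≤-Reasoning
    instance
      K≢0 : ℚ.NonZero K
      K≢0 = ℚ.pos⇒nonZero K

  0<ε/K : ∀ ε K .{{_ : ℚ.Positive K}} → 0ℚ ℚ.< ε → 0ℚ ℚ.< ε ℚ.* (ℚ.1/ K) {{ℚ.pos⇒nonZero K}}
  0<ε/K ε K 0<ε = subst (ℚ._< ε ℚ.* 1/K) (ℚ.*-zeroˡ 1/K)
    (ℚ.*-monoˡ-<-pos 1/K {{ℚ.1/pos⇒pos K}} 0<ε)
    where
    1/K : ℚ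
    1/K = (ℚ.1/ K) {{ℚ.pos⇒nonZero K}}

  *-cauchy : ∀ x y → IsCauchy x → IsCauchy y → IsCauchy (λ n → x n ℚ.* y n)
  *-cauchy x y cx cy ε 0<ε with halve ε 0<ε | bound x cx | bound y cy
  ... | δ , 0<δ , δ+δ≡ε | A , A>0 , N₁ , x≤A | B , B>0 , N₂ , y≤B
    with cx _ (0<ε/K δ B {{B>0}} 0<δ)
       | cy _ (0<ε/K δ A {{A>0}} 0<δ)
  ... | N₃ , nx | N₄ , ny = N , λ m n N≤m N≤n → begin-strict
      ℚ.∣ x m ℚ.* y m ℚ.- x n ℚ.* y n ∣
        ≡⟨ cong ℚ.∣_∣ (split-* (x m) (y m) (x n) (y n)) ⟩
      ℚ.∣ (y m ℚ.- y n) ℚ.* x m ℚ.+ (x m ℚ.- x n) ℚ.* y n ∣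
        ≤⟨ ℚ.∣p+q∣≤∣p∣+∣q∣ ((y m ℚ.- y n) ℚ.* x m) ((x m ℚ.- x n) ℚ.* y n) ⟩
      ℚ.∣ (y m ℚ.- y n) ℚ.* x m ∣ ℚ.+ ℚ.∣ (x m ℚ.- x n) ℚ.* y n ∣
        <⟨ ℚ.+-mono-<
             (∣*∣< δ A {{A>0}} (y m ℚ.- y n) (x m)
               (ny m n (ℕ.≤-trans N₄≤N N≤m) (ℕ.≤-trans N₄≤N N≤n)) (x≤A m (ℕ.≤-trans N₁≤N N≤m)))
             (∣*∣< δ B {{B>0}} (x m ℚ.- x n) (y n)
               (nx m n (ℕ.≤-trans N₃≤N N≤m) (ℕ.≤-trans N₃≤N N≤n)) (y≤B n (ℕ.≤-trans N₂≤N N≤n))) ⟩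
      δ ℚ.+ δ
        ≡⟨ δ+δ≡ε ⟩
      ε ∎
    where
    open ℚ.≤-Reasoning
    N : ℕ
    N = (N₁ ℕ.⊔ N₂) ℕ.⊔ (N₃ ℕ.⊔ N₄)
    N₁≤N : N₁ ℕ.≤ N
    N₁≤N = ℕ.≤-trans (ℕ.m≤m⊔n N₁ N₂) (ℕ.m≤m⊔n _ _)
    N₂≤N : N₂ ℕ.≤ N
    N₂≤N = ℕ.≤-trans (ℕ.m≤n⊔m N₁ N₂) (ℕ.m≤m⊔n _ _)
    N₃≤N : N₃ ℕ.≤ N
    N₃≤N = ℕ.≤-trans (ℕ.m≤m⊔n N₃ N₄) (ℕ.m≤n⊔m (N₁ ℕ.⊔ N₂) _)
    N₄≤N : N₄ ℕ.≤ N
    N₄≤N = ℕ.≤-trans (ℕ.m≤n⊔m N₃ N₄) (ℕ.m≤n⊔m (N₁ ℕ.⊔ N₂) _)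

infixl 6 _+ᴿ_
infixl 7 _*ᴿ_
infix  8 -ᴿ_

_+ᴿ_ : ℝ → ℝ → ℝ
mkℝ x cx +ᴿ mkℝ y cy = mkℝ (λ n → x n ℚ.+ y n) (+-cauchy x y cx cy)

_*ᴿ_ : ℝ → ℝ → ℝ
mkℝ x cx *ᴿ mkℝ y cy = mkℝ (λ n → x n ℚ.* y n) (*-cauchy x y cx cy)

-ᴿ_ : ℝ → ℝ
-ᴿ mkℝ x cx = mkℝ (λ n → ℚ.- x n) (neg-cauchy x cx)

ℚ→ℝ : ℚ → ℝ
ℚ→ℝ p = mkℝ (λ _ → p) λ ε 0<ε → 0 , λ _ _ _ _ →
  subst (ℚ._< ε) (sym (cong ℚ.∣_∣ (ℚ.+-inverseʳ p))) 0<ε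

0ᴿ 1ᴿ : ℝ
0ᴿ = ℚ→ℝ 0ℚ
1ᴿ = ℚ→ℝ 1ℚ

------------------------------------------------------------------------
-- Complex numbers

record ℂ : Set where
  constructor _+i_
  field
    re im : ℝ

open ℂ public

infix  4 _≈_
infixl 6 _+_ _-_
infixl 7 _*_
infix  8 -_

_≈_ : ℂ → ℂ → Set
z ≈ w = re z ≈ᴿ re w × im z ≈ᴿ im w

_+_ _*_ : ℂ → ℂ → ℂ
z + w = (re z +ᴿ re w) +i (im z +ᴿ im w)
z * w = (re z *ᴿ re w +ᴿ -ᴿ (im z *ᴿ im w)) +i (re z *ᴿ im w +ᴿ im z *ᴿ re w)

-_ : ℂ → ℂ
- z = (-ᴿ re z) +i (-ᴿ im z)

_-_ : ℂ → ℂ → ℂ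
z - w = z + (- w)

ℝ→ℂ : ℝ → ℂ
ℝ→ℂ x = x +i 0ᴿ

ℚ→ℂ : ℚ → ℂ
ℚ→ℂ p = ℝ→ℂ (ℚ→ℝ p)

ℕ→ℂ : ℕ → ℂ
ℕ→ℂ n = ℚ→ℂ ((+ n) ℚ./ 1)

0# 1# : ℂ
0# = ℚ→ℂ 0ℚ
1# = ℚ→ℂ 1ℚ

ℂ-rawRing : RawRing 0ℓ 0ℓ
ℂ-rawRing = record
  { Carrier = ℂ ; _≈_ = _≈_ ; _+_ = _+_ ; _*_ = _*_ ; -_ = -_ ; 0# = 0# ; 1# = 1# }

open import Algebra.Definitions.RawSemiring (RawRing.rawSemiring ℂ-rawRing) public
  using (_^_; sum)

normSq : ℂ → ℝ
normSq z = re z *ᴿ re z +ᴿ im z *ᴿ im z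

IsModulus : ℂ → ℝ → Set
IsModulus z r = 0ᴿ ≤ᴿ r × r *ᴿ r ≈ᴿ normSq z

IsRootOfUnity : ℂ → Set
IsRootOfUnity ξ = ∃[ k ] (NonZero k × ξ ^ k ≈ 1#)

------------------------------------------------------------------------
-- Series, exponential and powers

-- u₀ + u₁ + u₂ + ⋯ converges to S.  The bound ∣ S_n - S ∣ < ε, with ε > 0, is
-- squared so as not to need square roots.
HasSum : (ℕ → ℂ) → ℂ → Set
HasSum u S = ∀ ε → 0ℚ ℚ.< ε → ∃[ N ] (∀ n → N ℕ.≤ n →
  normSq (sum {n} (λ i → u (toℕ i)) - S) <ᴿ ℚ→ℝ (ε ℚ.* ε))

1/_! : ℕ → ℚ
1/ k ! = ((+ 1) ℚ./ (k !)) {{k ℕ.!≢0}}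

expCoeff : ℂ → ℕ → ℂ
expCoeff z k = z ^ k * ℚ→ℂ (1/ k !)

-- w = e^z
IsExp : ℂ → ℂ → Set
IsExp z w = HasSum (expCoeff z) w

-- w = n^s = e^{s log n}, with log n the real logarithm of the positive integer n
IsPower : ℕ → ℂ → ℂ → Set
IsPower n s w = ∃[ l ] (IsExp (ℝ→ℂ l) (ℕ→ℂ n) × IsExp (s * ℝ→ℂ l) w)

------------------------------------------------------------------------
-- The twisted (h,q)-partial zeta function

-- S is the sum of q^{nh} ξ^n / n^s over n > 0 with n ≡ a (mod f); the series
-- is indexed by i = n - 1, and p i is the value of n^{-s}.
IsTwistedSum : (h : ℕ) (ξ q : ℂ) (a f : ℕ) (s S : ℂ) → Set
IsTwistedSum h ξ q a f s S =
  Σ[ p ∈ (ℕ → ℂ) ] ((∀ i → IsPower (suc i) (- s) (p i)) ×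
          HasSum (λ i → if does (f ∣? ℕ.∣ suc i - a ∣)
                        then q ^ (suc i ℕ.* h) * ξ ^ suc i * p i
                        else 0#) S)

-- v = H_{ξ,q}^{(h)}(s, a : f), where ℓ is the chosen value of log q.
-- Here r is 1/(s - 1), so s ≠ 1 is part of the relation.
IsPartialZeta : (h : ℕ) (ξ q ℓ : ℂ) (a f : ℕ) (s v : ℂ) → Set
IsPartialZeta h ξ q ℓ a f s v =
  ∃[ S ] ∃[ T ] ∃[ r ]
    ( IsTwistedSum h ξ q a f s S
    × IsTwistedSum h ξ q a f (s - 1#) T
    × (s - 1#) * r ≈ 1#
    × v ≈ S - (ℕ→ℂ h * ℓ) * r * T )

------------------------------------------------------------------------
-- Formal power series in t over ℂ, and the twisted (h,q)-Bernoulli polynomials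

PowerSeries : Set
PowerSeries = ℕ → ℂ

infix  4 _≋_
infixl 6 _⊕_
infixl 7 _⊛_

_≋_ : PowerSeries → PowerSeries → Set
F ≋ G = ∀ n → F n ≈ G n

_⊕_ _⊛_ : PowerSeries → PowerSeries → PowerSeries
(F ⊕ G) n = F n + G n
(F ⊛ G) n = sum {suc n} (λ k → F (toℕ k) * G (n ∸ toℕ k))

const : ℂ → PowerSeries
const c zero    = c
const c (suc _) = 0#

t : PowerSeries
t 1 = 1#
t _ = 0#

-- e^{tz}
exp[t_] : ℂ → PowerSeries
exp[t z ] = expCoeff z

-- Σ B_n tⁿ/n!
egf : (ℕ → ℂ) → PowerSeries
egf B n = B n * ℚ→ℂ (1/ n !)

-- B n = B_{n,ξ}^{(h)}(z, q), where ℓ is the chosen value of log q.  That a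
-- quotient F / G is the series E is expressed as G E = F; when 0 < ∣ q ∣ < 1 and
-- ξ is a root of unity, the constant term ξ q^h - 1 of G is invertible, so that
-- B exists and is unique.
AreTwistedBernoulli : (h : ℕ) (ξ q ℓ z : ℂ) (B : ℕ → ℂ) → Set
AreTwistedBernoulli h ξ q ℓ z B =
  (const (ξ * q ^ h) ⊛ exp[t 1# ] ⊕ const (- 1#)) ⊛ egf B
    ≋ (t ⊕ const (ℕ→ℂ h * ℓ)) ⊛ exp[t z ]

{-# OPTIONS --safe #-}

-- Put w = ξ^f q^{fh} and z = a/f.  Up to the factor q^{ha} ξ^a f^k, the series over
-- n ≡ a (mod f) of q^{nh} ξ^n n^k is Σ_j w^j (z + j)^k.  The truncations
-- P_N = Σ_{j<N} w^j e^{t(z+j)} satisfy (w e^t - 1) P_N = w^N e^{t(z+N)} - e^{tz}, and the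
-- coefficients of w^N e^{t(z+N)} tend to 0 because ∣w∣ < 1.  As w - 1 is invertible, the
-- coefficients of P_N converge, one after the other, to those of a power series g with
-- (w e^t - 1) g = - e^{tz}.  Hence Σ B_n tⁿ/n! = - (t + h f log q) g, whose coefficient at
-- tⁿ is the asserted identity.
--
-- The powers n^s in the series need real logarithms of positive integers.  These are found
-- by a grid search in the rational partial sums E_n(x) of the exponential series, and
-- e^{k log m} = m^k follows from E_n(x + y) ≤ E_n(x) E_n(y) ≤ E_{2n}(x + y) for x, y ≥ 0.
module Submission where

open import Defs
open import Algebra.Bundles using (CommutativeRing; RawRing)
import Algebra.Properties.CommutativeSemiring.Exp
import Algebra.Solver.Ring
open import Algebra.Solver.Ring.AlmostCommutativeRing using (fromCommutativeRing; _-Raw-AlmostCommutative⟶_)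
open import Algebra.Structures using (IsCommutativeRing)
open import Data.Bool.Base using (if_then_else_)
open import Data.Fin.Base using (toℕ)
import Data.Fin.Properties as Fin
open import Data.Integer.Base as ℤ using (+_)
import Data.Integer.Properties as ℤ
import Data.Maybe.Base as Maybe
open import Data.Nat.Base as ℕ using (ℕ; zero; suc; NonZero; _∸_; _!)
open import Data.Nat.Divisibility using (_∣_; _∣?_; divides; >⇒∤; ∣m+n∣m⇒∣n)
open import Data.Nat.DivMod using (_/_; _%_; m≡m%n+[m/n]*n; m%n<n; /-monoˡ-≤; m*n/n≡m)
import Data.Nat.Properties as ℕ
import Data.Nat.Solver as ℕ-Solver
open import Data.Product.Base using (_×_; _,_; proj₁; proj₂; ∃-syntax)
open import Data.Rational.Base as ℚ using (ℚ; 0ℚ; 1ℚ; mkℚ; toℚᵘ)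
import Data.Rational.Properties as ℚ
open import Data.Rational.Solver using (module +-*-Solver)
open import Data.Rational.Unnormalised.Base as ℚᵘ using (mkℚᵘ; *≡*; *≤*)
import Data.Rational.Unnormalised.Properties as ℚᵘ
open import Data.Sum.Base using (inj₁; inj₂)
open import Function.Base using (_∘_; case_of_)
open import Level using (0ℓ)
open import Relation.Binary.PropositionalEquality
  using (_≡_; refl; sym; trans; cong; cong₂; subst; subst₂; module ≡-Reasoning)
import Relation.Binary.Reasoning.Setoid
open import Relation.Nullary using (¬_; Dec; yes; no; contradiction)
open import Relation.Nullary.Decidable using (does; dec⇒maybe; dec-true; dec-false)
open import Algebra.Properties.Semiring.Exp (CommutativeRing.semiring ℚ.+-*-commutativeRing)
  using () renaming (_^_ to _^ℚ_)

-- Rational numbers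

-- Completeness of the complex numbers is never invoked. Null sequences and convergent sequences are
-- both closed under linear combinations, and division by a power series with invertible constant
-- term is a linear recursion on coefficients. Hence the single lemma `closed-÷` gives the existence
-- of g, from the explicit limit of (w eᵗ - 1) P_N, and also the comparison of g with the Bernoulli
-- series. As z is rational, the exponential coefficients inside P_N are images of rationals, so
-- that the addition formula is needed over ℚ only. At s = 1 - n the two series of the zeta function
-- have k = n - 1 and k = n, and 1/(s - 1) = - 1/n. Multiplication by t + h f log q combines exactly
-- the coefficients of g at these two indices. A complex number is a pair of Cauchy sequences; a
-- limit of complex numbers is therefore read as an iterated limit of rational approximations, and
-- every estimate below is one about rationals.

toℚᵘ-/ : ∀ i n → toℚᵘ (i ℚ./ suc n) ℚᵘ.≃ mkℚᵘ i n
toℚᵘ-/ i n = ℚ.toℚᵘ-fromℚᵘ (mkℚᵘ i n)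

opaque
  -- Opaque, so that arithmetic goes through the homomorphism laws and not through the reduction to
  -- lowest terms inside `ℚ._/_`.
  ι : ℕ → ℚ
  ι n = (+ n) ℚ./ 1

  ι≡/1 : ∀ n → ι n ≡ (+ n) ℚ./ 1
  ι≡/1 n = refl

  ι-0 : ι 0 ≡ 0ℚ
  ι-0 = refl

  ι-1 : ι 1 ≡ 1ℚ
  ι-1 = refl

  toℚᵘ-ι : ∀ n → toℚᵘ (ι n) ℚᵘ.≃ mkℚᵘ (+ n) 0
  toℚᵘ-ι n = toℚᵘ-/ (+ n) 0

  /-*-cancel : ∀ i n .{{_ : NonZero n}} → (i ℚ./ n) ℚ.* ι n ≡ i ℚ./ 1
  /-*-cancel i n@(suc n-1) = ℚ.toℚᵘ-injective (begin
    toℚᵘ ((i ℚ./ n) ℚ.* ι n)         ≈⟨ ℚ.toℚᵘ-homo-* (i ℚ./ n) (ι n) ⟩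
    toℚᵘ (i ℚ./ n) ℚᵘ.* toℚᵘ (ι n)   ≈⟨ ℚᵘ.*-cong (toℚᵘ-/ i n-1) (toℚᵘ-/ (+ n) 0) ⟩
    mkℚᵘ i n-1 ℚᵘ.* mkℚᵘ (+ n) 0     ≈⟨ *≡* (trans (ℤ.*-identityʳ _) (cong (i ℤ.*_) (cong +_ (sym (ℕ.*-identityʳ n))))) ⟩
    mkℚᵘ i 0                         ≈⟨ toℚᵘ-/ i 0 ⟨
    toℚᵘ (i ℚ./ 1)                   ∎)
    where open ℚᵘ.≃-Reasoning

  ι-homo-+ : ∀ m n → ι (m ℕ.+ n) ≡ ι m ℚ.+ ι n
  ι-homo-+ m n = ℚ.toℚᵘ-injective (begin
    toℚᵘ (ι (m ℕ.+ n))                ≈⟨ toℚᵘ-/ _ 0 ⟩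
    mkℚᵘ (+ (m ℕ.+ n)) 0              ≈⟨ *≡* (cong (ℤ._* (+ 1)) (cong₂ ℤ._+_ (sym (ℤ.*-identityʳ (+ m))) (sym (ℤ.*-identityʳ (+ n))))) ⟩
    mkℚᵘ (+ m) 0 ℚᵘ.+ mkℚᵘ (+ n) 0    ≈⟨ ℚᵘ.+-cong (toℚᵘ-/ (+ m) 0) (toℚᵘ-/ (+ n) 0) ⟨
    toℚᵘ (ι m) ℚᵘ.+ toℚᵘ (ι n)        ≈⟨ ℚ.toℚᵘ-homo-+ (ι m) (ι n) ⟨
    toℚᵘ (ι m ℚ.+ ι n)                ∎)
    where open ℚᵘ.≃-Reasoning

  ι-homo-* : ∀ m n → ι (m ℕ.* n) ≡ ι m ℚ.* ι n
  ι-homo-* m n = ℚ.toℚᵘ-injective (begin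
    toℚᵘ (ι (m ℕ.* n))                ≈⟨ toℚᵘ-/ _ 0 ⟩
    mkℚᵘ (+ (m ℕ.* n)) 0              ≈⟨ *≡* (cong (ℤ._* (+ 1)) (ℤ.pos-* m n)) ⟩
    mkℚᵘ (+ m) 0 ℚᵘ.* mkℚᵘ (+ n) 0    ≈⟨ ℚᵘ.*-cong (toℚᵘ-/ (+ m) 0) (toℚᵘ-/ (+ n) 0) ⟨
    toℚᵘ (ι m) ℚᵘ.* toℚᵘ (ι n)        ≈⟨ ℚ.toℚᵘ-homo-* (ι m) (ι n) ⟨
    toℚᵘ (ι m ℚ.* ι n)                ∎)
    where open ℚᵘ.≃-Reasoning

  ι-suc : ∀ n → ι (suc n) ≡ 1ℚ ℚ.+ ι n
  ι-suc = ι-homo-+ 1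

  0≤ι : ∀ n → 0ℚ ℚ.≤ ι n
  0≤ι n = ℚ.nonNegative⁻¹ (ι n) {{ℚ.normalize-nonNeg n 1}}

  0<ι : ∀ n .{{_ : NonZero n}} → 0ℚ ℚ.< ι n
  0<ι n = ℚ.positive⁻¹ (ι n) {{ℚ.normalize-pos n 1}}

0<1 : 0ℚ ℚ.< 1ℚ
0<1 = ℚ.positive⁻¹ 1ℚ

0≤1 : 0ℚ ℚ.≤ 1ℚ
0≤1 = ℚ.<⇒≤ 0<1

≤-offset : ∀ {p q} d → 0ℚ ℚ.≤ d → p ℚ.+ d ≡ q → p ℚ.≤ q
≤-offset {p} {q} d 0≤d p+d≡q = begin
  p          ≡⟨ ℚ.+-identityʳ p ⟨
  p ℚ.+ 0ℚ   ≤⟨ ℚ.+-monoʳ-≤ p 0≤d ⟩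
  p ℚ.+ d    ≡⟨ p+d≡q ⟩
  q          ∎
  where open ℚ.≤-Reasoning

p≤q⇒0≤q-p : ∀ {p q} → p ℚ.≤ q → 0ℚ ℚ.≤ q ℚ.- p
p≤q⇒0≤q-p {p} {q} p≤q = subst (ℚ._≤ q ℚ.- p) (ℚ.+-inverseʳ p) (ℚ.+-monoˡ-≤ (ℚ.- p) p≤q)

0≤+ : ∀ {p q} → 0ℚ ℚ.≤ p → 0ℚ ℚ.≤ q → 0ℚ ℚ.≤ p ℚ.+ q
0≤+ = ℚ.+-mono-≤

*-monoˡ-≤ : ∀ {p q r} → 0ℚ ℚ.≤ r → p ℚ.≤ q → p ℚ.* r ℚ.≤ q ℚ.* r
*-monoˡ-≤ {r = r} 0≤r = ℚ.*-monoʳ-≤-nonNeg r {{ℚ.nonNegative 0≤r}}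

*-monoʳ-≤ : ∀ {p q r} → 0ℚ ℚ.≤ r → p ℚ.≤ q → r ℚ.* p ℚ.≤ r ℚ.* q
*-monoʳ-≤ {r = r} 0≤r = ℚ.*-monoˡ-≤-nonNeg r {{ℚ.nonNegative 0≤r}}

0≤* : ∀ {p q} → 0ℚ ℚ.≤ p → 0ℚ ℚ.≤ q → 0ℚ ℚ.≤ p ℚ.* q
0≤* {p} {q} 0≤p 0≤q = subst (ℚ._≤ p ℚ.* q) (ℚ.*-zeroʳ p) (*-monoʳ-≤ 0≤p 0≤q)

0<* : ∀ {p q} → 0ℚ ℚ.< p → 0ℚ ℚ.< q → 0ℚ ℚ.< p ℚ.* q
0<* {p} {q} 0<p 0<q = subst (ℚ._< p ℚ.* q) (ℚ.*-zeroʳ p) (ℚ.*-monoʳ-<-pos p {{ℚ.positive 0<p}} 0<q)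

*-mono-≤ : ∀ {p q r s} → 0ℚ ℚ.≤ p → p ℚ.≤ q → 0ℚ ℚ.≤ r → r ℚ.≤ s → p ℚ.* r ℚ.≤ q ℚ.* s
*-mono-≤ 0≤p p≤q 0≤r r≤s = ℚ.≤-trans (*-monoˡ-≤ 0≤r p≤q) (*-monoʳ-≤ (ℚ.≤-trans 0≤p p≤q) r≤s)

*-cancelʳ-≤ : ∀ {p q r} → 0ℚ ℚ.< r → p ℚ.* r ℚ.≤ q ℚ.* r → p ℚ.≤ q
*-cancelʳ-≤ {r = r} 0<r = ℚ.*-cancelʳ-≤-pos r {{ℚ.positive 0<r}}

*-cancelʳ-≡ : ∀ {p q r} → 0ℚ ℚ.< r → p ℚ.* r ≡ q ℚ.* r → p ≡ q
*-cancelʳ-≡ 0<r pr≡qr = ℚ.≤-antisym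
  (*-cancelʳ-≤ 0<r (ℚ.≤-reflexive pr≡qr)) (*-cancelʳ-≤ 0<r (ℚ.≤-reflexive (sym pr≡qr)))

0≤p² : ∀ p → 0ℚ ℚ.≤ p ℚ.* p
0≤p² p with ℚ.≤-total 0ℚ p
... | inj₁ 0≤p = 0≤* 0≤p 0≤p
... | inj₂ p≤0 = subst (0ℚ ℚ.≤_) (solve 1 (λ p → (:- p) :* (:- p) := p :* p) refl p) (0≤* 0≤-p 0≤-p)
  where
  open +-*-Solver
  0≤-p : 0ℚ ℚ.≤ ℚ.- p
  0≤-p = ℚ.neg-antimono-≤ p≤0

∣p∣*∣p∣≡p*p : ∀ p → ℚ.∣ p ∣ ℚ.* ℚ.∣ p ∣ ≡ p ℚ.* p
∣p∣*∣p∣≡p*p p = trans (sym (ℚ.∣p*q∣≡∣p∣*∣q∣ p p)) (ℚ.0≤p⇒∣p∣≡p (0≤p² p))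

-- Complex moduli occur squared throughout; this recovers bounds on real and imaginary parts from
-- them.
p²≤q²⇒∣p∣≤q : ∀ {p q} → 0ℚ ℚ.< q → p ℚ.* p ℚ.≤ q ℚ.* q → ℚ.∣ p ∣ ℚ.≤ q
p²≤q²⇒∣p∣≤q {p} {q} 0<q p²≤q² = ℚ.≮⇒≥ λ q<∣p∣ → ℚ.<-irrefl refl (begin-strict
  q ℚ.* q                  <⟨ ℚ.*-monoʳ-<-pos q {{ℚ.positive 0<q}} q<∣p∣ ⟩
  q ℚ.* ℚ.∣ p ∣            ≤⟨ *-monoˡ-≤ (ℚ.0≤∣p∣ p) (ℚ.<⇒≤ q<∣p∣) ⟩
  ℚ.∣ p ∣ ℚ.* ℚ.∣ p ∣      ≡⟨ ∣p∣*∣p∣≡p*p p ⟩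
  p ℚ.* p                  ≤⟨ p²≤q² ⟩
  q ℚ.* q                  ∎)
  where open ℚ.≤-Reasoning

p≤∣p∣ : ∀ p → p ℚ.≤ ℚ.∣ p ∣
p≤∣p∣ p with ℚ.≤-total 0ℚ p
... | inj₁ 0≤p = ℚ.≤-reflexive (sym (ℚ.0≤p⇒∣p∣≡p 0≤p))
... | inj₂ p≤0 = ℚ.≤-trans p≤0 (ℚ.0≤∣p∣ p)

-p≤q∧p≤q⇒∣p∣≤q : ∀ {p q} → ℚ.- p ℚ.≤ q → p ℚ.≤ q → ℚ.∣ p ∣ ℚ.≤ q
-p≤q∧p≤q⇒∣p∣≤q {p} -p≤q p≤q with ℚ.∣p∣≡p∨∣p∣≡-p p
... | inj₁ ∣p∣≡p  = subst (ℚ._≤ _) (sym ∣p∣≡p) p≤q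
... | inj₂ ∣p∣≡-p = subst (ℚ._≤ _) (sym ∣p∣≡-p) -p≤q

∣p-q∣≡∣q-p∣ : ∀ p q → ℚ.∣ p ℚ.- q ∣ ≡ ℚ.∣ q ℚ.- p ∣
∣p-q∣≡∣q-p∣ p q = trans (sym (ℚ.∣-p∣≡∣p∣ (p ℚ.- q)))
  (cong ℚ.∣_∣ (solve 2 (λ p q → :- (p :- q) := q :- p) refl p q))
  where open +-*-Solver

ι-mono-≤ : ∀ {m n} → m ℕ.≤ n → ι m ℚ.≤ ι n
ι-mono-≤ {m} {n} m≤n = ≤-offset (ι (n ∸ m)) (0≤ι (n ∸ m))
  (trans (sym (ι-homo-+ m (n ∸ m))) (cong ι (ℕ.m+[n∸m]≡n m≤n)))

-- The absolute value of the numerator will do, the denominator being at least 1.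
archimedean : ∀ p → ∃[ N ] p ℚ.≤ ι N
archimedean p = ℤ.∣ ℚ.↥ p ∣ , ℚ.toℚᵘ-cancel-≤ (ℚᵘ.≤-respʳ-≃ (ℚᵘ.≃-sym (toℚᵘ-ι ℤ.∣ ℚ.↥ p ∣)) (helper p))
  where
  helper : ∀ p → toℚᵘ p ℚᵘ.≤ mkℚᵘ (+ ℤ.∣ ℚ.↥ p ∣) 0
  helper (mkℚ (+ n) d _) = *≤* (subst₂ ℤ._≤_ (sym (ℤ.*-identityʳ (+ n))) (ℤ.pos-* n (suc d))
    (ℤ.+≤+ (ℕ.m≤m*n n (suc d))))
  helper (mkℚ (ℤ.-[1+ n ]) d _) = *≤* ℤ.-≤+

archimedean-* : ∀ C {ε} → 0ℚ ℚ.< ε → ∃[ N ] (∀ n → N ℕ.≤ n → C ℚ.≤ ε ℚ.* ι n)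
archimedean-* C {ε} 0<ε = proj₁ (archimedean (C ℚ.* ℚ.1/ ε)) , λ n N≤n → begin
  C                              ≡⟨ ℚ.*-identityʳ C ⟨
  C ℚ.* 1ℚ                       ≡⟨ cong (C ℚ.*_) (ℚ.*-inverseˡ ε) ⟨
  C ℚ.* (ℚ.1/ ε ℚ.* ε)           ≡⟨ ℚ.*-assoc C (ℚ.1/ ε) ε ⟨
  C ℚ.* ℚ.1/ ε ℚ.* ε             ≤⟨ *-monoˡ-≤ (ℚ.<⇒≤ 0<ε) (ℚ.≤-trans (proj₂ (archimedean (C ℚ.* ℚ.1/ ε))) (ι-mono-≤ N≤n)) ⟩
  ι n ℚ.* ε                      ≡⟨ ℚ.*-comm (ι n) ε ⟩
  ε ℚ.* ι n                      ∎
  where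
  open ℚ.≤-Reasoning
  instance
    ε≢0 : ℚ.NonZero ε
    ε≢0 = ℚ.pos⇒nonZero ε {{ℚ.positive 0<ε}}

^-nonNeg : ∀ {p} n → 0ℚ ℚ.≤ p → 0ℚ ℚ.≤ p ^ℚ n
^-nonNeg zero    0≤p = 0≤1
^-nonNeg (suc n) 0≤p = 0≤* 0≤p (^-nonNeg n 0≤p)

^-mono-≤ : ∀ {p q} n → 0ℚ ℚ.≤ p → p ℚ.≤ q → p ^ℚ n ℚ.≤ q ^ℚ n
^-mono-≤ zero    0≤p p≤q = ℚ.≤-refl
^-mono-≤ (suc n) 0≤p p≤q = *-mono-≤ 0≤p p≤q (^-nonNeg n 0≤p) (^-mono-≤ n 0≤p p≤q)

^-≤1 : ∀ {p} n → 0ℚ ℚ.≤ p → p ℚ.≤ 1ℚ → p ^ℚ n ℚ.≤ 1ℚ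
^-≤1 zero    0≤p p≤1 = ℚ.≤-refl
^-≤1 (suc n) 0≤p p≤1 = *-mono-≤ 0≤p p≤1 (^-nonNeg n 0≤p) (^-≤1 n 0≤p p≤1)

1≤^ : ∀ {p} n → 1ℚ ℚ.≤ p → 1ℚ ℚ.≤ p ^ℚ n
1≤^ zero    1≤p = ℚ.≤-refl
1≤^ (suc n) 1≤p = *-mono-≤ 0≤1 1≤p 0≤1 (1≤^ n 1≤p)

^suc-≤ : ∀ {p} n → 0ℚ ℚ.≤ p → p ℚ.≤ 1ℚ → p ^ℚ suc n ℚ.≤ p
^suc-≤ {p} n 0≤p p≤1 = subst (p ^ℚ suc n ℚ.≤_) (ℚ.*-identityʳ p) (*-monoʳ-≤ 0≤p (^-≤1 n 0≤p p≤1))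

-- Bernoulli's inequality (M / (M + 1))^K ≥ 1 - K / (M + 1), with denominators cleared.
bernoulli : ∀ {M} K → 0ℚ ℚ.≤ M →
  (1ℚ ℚ.+ M) ^ℚ K ℚ.* ((1ℚ ℚ.+ M) ℚ.- ι K) ℚ.≤ M ^ℚ K ℚ.* (1ℚ ℚ.+ M)
bernoulli {M} zero    0≤M rewrite ι-0 = ℚ.≤-reflexive
  (solve 1 (λ M → con 1ℚ :* ((con 1ℚ :+ M) :- con 0ℚ) := con 1ℚ :* (con 1ℚ :+ M)) refl M)
  where open +-*-Solver
bernoulli {M} (suc K) 0≤M = begin
  (1ℚ ℚ.+ M) ℚ.* X ℚ.* ((1ℚ ℚ.+ M) ℚ.- ι (suc K))
    ≡⟨ cong (λ k → (1ℚ ℚ.+ M) ℚ.* X ℚ.* ((1ℚ ℚ.+ M) ℚ.- k)) (ι-suc K) ⟩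
  (1ℚ ℚ.+ M) ℚ.* X ℚ.* ((1ℚ ℚ.+ M) ℚ.- (1ℚ ℚ.+ ι K))
    ≤⟨ ≤-offset (X ℚ.* ι K) (0≤* (^-nonNeg K (0≤+ 0≤1 0≤M)) (0≤ι K))
         (solve 3 (λ M X k → (con 1ℚ :+ M) :* X :* ((con 1ℚ :+ M) :- (con 1ℚ :+ k)) :+ X :* k
                               := M :* (X :* ((con 1ℚ :+ M) :- k))) refl M X (ι K)) ⟩
  M ℚ.* (X ℚ.* ((1ℚ ℚ.+ M) ℚ.- ι K))
    ≤⟨ *-monoʳ-≤ 0≤M (bernoulli K 0≤M) ⟩
  M ℚ.* (M ^ℚ K ℚ.* (1ℚ ℚ.+ M))
    ≡⟨ ℚ.*-assoc M (M ^ℚ K) (1ℚ ℚ.+ M) ⟨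
  M ℚ.* M ^ℚ K ℚ.* (1ℚ ℚ.+ M)  ∎
  where
  open ℚ.≤-Reasoning
  open +-*-Solver
  X = (1ℚ ℚ.+ M) ^ℚ K

-- ρ^N (N + 1)^K decreases once ρ (M + 1)^K ≤ M^K for M = N + 1, and this holds
-- as soon as (1 - ρ) (M + 1) ≥ K.
geometric-beats-power : ∀ {ρ} → 0ℚ ℚ.≤ ρ → ρ ℚ.< 1ℚ → ∀ K →
  ∃[ C ] ∃[ N ] (∀ n → N ℕ.≤ n → ρ ^ℚ n ℚ.* ι (suc n) ^ℚ K ℚ.≤ C)
geometric-beats-power {ρ} 0≤ρ ρ<1 K =
  a N , N , λ n N≤n → subst (λ n → a n ℚ.≤ a N) (ℕ.m∸n+n≡m N≤n) (decrease (n ∸ N))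
  where
  0<1-ρ : 0ℚ ℚ.< 1ℚ ℚ.- ρ
  0<1-ρ = subst (ℚ._< 1ℚ ℚ.- ρ) (ℚ.+-inverseʳ ρ) (ℚ.+-monoˡ-< (ℚ.- ρ) ρ<1)

  N : ℕ
  N = proj₁ (archimedean-* (ι K) 0<1-ρ)

  large : ∀ n → N ℕ.≤ n → ι K ℚ.≤ (1ℚ ℚ.- ρ) ℚ.* ι n
  large = proj₂ (archimedean-* (ι K) 0<1-ρ)

  a : ℕ → ℚ
  a n = ρ ^ℚ n ℚ.* ι (suc n) ^ℚ K

  ratio : ∀ M → 0ℚ ℚ.≤ M → ι K ℚ.≤ (1ℚ ℚ.- ρ) ℚ.* (1ℚ ℚ.+ M) → ρ ℚ.* (1ℚ ℚ.+ M) ^ℚ K ℚ.≤ M ^ℚ K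
  ratio M 0≤M K≤ = *-cancelʳ-≤ 0<1+M (begin
    ρ ℚ.* X ℚ.* (1ℚ ℚ.+ M)
      ≤⟨ ≤-offset (X ℚ.* ((1ℚ ℚ.- ρ) ℚ.* (1ℚ ℚ.+ M) ℚ.- ι K))
           (0≤* (^-nonNeg K (ℚ.<⇒≤ 0<1+M)) (p≤q⇒0≤q-p K≤))
           (solve 4 (λ ρ X M k → ρ :* X :* (con 1ℚ :+ M) :+ X :* ((con 1ℚ :- ρ) :* (con 1ℚ :+ M) :- k)
                                   := X :* ((con 1ℚ :+ M) :- k)) refl ρ X M (ι K)) ⟩
    X ℚ.* ((1ℚ ℚ.+ M) ℚ.- ι K)
      ≤⟨ bernoulli K 0≤M ⟩
    M ^ℚ K ℚ.* (1ℚ ℚ.+ M)  ∎)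
    where
    open ℚ.≤-Reasoning
    open +-*-Solver
    X = (1ℚ ℚ.+ M) ^ℚ K
    0<1+M : 0ℚ ℚ.< 1ℚ ℚ.+ M
    0<1+M = ℚ.+-mono-<-≤ 0<1 0≤M

  step : ∀ n → N ℕ.≤ n → a (suc n) ℚ.≤ a n
  step n N≤n = begin
    ρ ℚ.* ρ ^ℚ n ℚ.* ι (suc (suc n)) ^ℚ K
      ≡⟨ solve 3 (λ ρ r X → ρ :* r :* X := r :* (ρ :* X)) refl ρ (ρ ^ℚ n) (ι (suc (suc n)) ^ℚ K) ⟩
    ρ ^ℚ n ℚ.* (ρ ℚ.* ι (suc (suc n)) ^ℚ K)
      ≤⟨ *-monoʳ-≤ (^-nonNeg n 0≤ρ) (subst (λ M → ρ ℚ.* M ^ℚ K ℚ.≤ ι (suc n) ^ℚ K) (sym (ι-suc (suc n)))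
           (ratio (ι (suc n)) (0≤ι (suc n))
             (subst (λ M → ι K ℚ.≤ (1ℚ ℚ.- ρ) ℚ.* M) (ι-suc (suc n))
               (large (suc (suc n)) (ℕ.≤-trans N≤n (ℕ.≤-trans (ℕ.n≤1+n n) (ℕ.n≤1+n (suc n)))))))) ⟩
    ρ ^ℚ n ℚ.* ι (suc n) ^ℚ K  ∎
    where
    open ℚ.≤-Reasoning
    open +-*-Solver

  decrease : ∀ j → a (j ℕ.+ N) ℚ.≤ a N
  decrease zero    = ℚ.≤-refl
  decrease (suc j) = ℚ.≤-trans (step (j ℕ.+ N) (ℕ.m≤n+m N j)) (decrease j)
-- Convolution and the exponential series over ℚ

-- Over an arbitrary ring because it is used three times: for ℚ, for ℂ with its given operations,
-- and for the opaque copy of ℂ.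
module Convolution {c ℓ} (R : CommutativeRing c ℓ) where
  private module R = CommutativeRing R
  open import Algebra.Properties.Semiring.Sum R.semiring
    using (∑-distrib-+; *-distribˡ-sum; sum-cong-≋) renaming (sum to sumᴿ)
  open import Algebra.Properties.CommutativeSemigroup
    (CommutativeRing.*-commutativeSemigroup R) using (x∙yz≈y∙xz)
  open import Relation.Binary.Reasoning.Setoid R.setoid

  infixl 7 _⋆_

  ∑ : ℕ → (ℕ → R.Carrier) → R.Carrier
  ∑ n f = sumᴿ {n} (λ i → f (toℕ i))

  _⋆_ : (ℕ → R.Carrier) → (ℕ → R.Carrier) → ℕ → R.Carrier
  (F ⋆ G) n = ∑ (suc n) (λ k → F k R.* G (n ∸ k))

  ∑-last : ∀ n f → ∑ (suc n) f R.≈ ∑ n f R.+ f n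
  ∑-last zero    f = R.+-comm (f 0) R.0#
  ∑-last (suc n) f = begin
    f 0 R.+ ∑ (suc n) (f ∘ suc)                   ≈⟨ R.+-congˡ (∑-last n (f ∘ suc)) ⟩
    f 0 R.+ (∑ n (f ∘ suc) R.+ f (suc n))         ≈⟨ R.+-assoc _ _ _ ⟨
    f 0 R.+ ∑ n (f ∘ suc) R.+ f (suc n)           ∎

  ∑-cong : ∀ n {f g} → (∀ i → f i R.≈ g i) → ∑ n f R.≈ ∑ n g
  ∑-cong n f≈g = sum-cong-≋ {n} (λ i → f≈g (toℕ i))

  ∑-+ : ∀ n f g → ∑ n (λ i → f i R.+ g i) R.≈ ∑ n f R.+ ∑ n g
  ∑-+ n f g = ∑-distrib-+ {n} (λ i → f (toℕ i)) (λ i → g (toℕ i))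

  *-distribˡ-∑ : ∀ n x f → x R.* ∑ n f R.≈ ∑ n (λ i → x R.* f i)
  *-distribˡ-∑ n x f = *-distribˡ-sum {n} x (λ i → f (toℕ i))

  ⋆-cong : ∀ {F F′ G G′} → (∀ k → F k R.≈ F′ k) → (∀ k → G k R.≈ G′ k) → ∀ n → (F ⋆ G) n R.≈ (F′ ⋆ G′) n
  ⋆-cong F≈F′ G≈G′ n = ∑-cong (suc n) (λ k → R.*-cong (F≈F′ k) (G≈G′ (n ∸ k)))

  ⋆-congˡ : ∀ F {G G′} → (∀ k → G k R.≈ G′ k) → ∀ n → (F ⋆ G) n R.≈ (F ⋆ G′) n
  ⋆-congˡ F = ⋆-cong {F} {F} (λ _ → R.refl)

  ⋆-congʳ : ∀ {F F′} G → (∀ k → F k R.≈ F′ k) → ∀ n → (F ⋆ G) n R.≈ (F′ ⋆ G) n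
  ⋆-congʳ G F≈F′ = ⋆-cong {G = G} {G′ = G} F≈F′ (λ _ → R.refl)

  -- A sum unfolds at its front, which shifts the first factor. Splitting off the last term shifts
  -- the second factor instead, as recursions on `G` require.
  ⋆-last : ∀ F G n → (F ⋆ G) (suc n) R.≈ (F ⋆ (G ∘ suc)) n R.+ F (suc n) R.* G 0
  ⋆-last F G zero    = begin
    F 0 R.* G 1 R.+ (F 1 R.* G 0 R.+ R.0#)   ≈⟨ R.+-congˡ (R.+-comm _ _) ⟩
    F 0 R.* G 1 R.+ (R.0# R.+ F 1 R.* G 0)   ≈⟨ R.+-assoc _ _ _ ⟨
    F 0 R.* G 1 R.+ R.0# R.+ F 1 R.* G 0     ∎
  ⋆-last F G (suc n) = begin
    F 0 R.* G (suc (suc n)) R.+ ((F ∘ suc) ⋆ G) (suc n)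
      ≈⟨ R.+-congˡ (⋆-last (F ∘ suc) G n) ⟩
    F 0 R.* G (suc (suc n)) R.+ (((F ∘ suc) ⋆ (G ∘ suc)) n R.+ F (suc (suc n)) R.* G 0)
      ≈⟨ R.+-assoc _ _ _ ⟨
    (F ⋆ (G ∘ suc)) (suc n) R.+ F (suc (suc n)) R.* G 0  ∎

  ⋆-distribʳ-+ : ∀ F F′ G n → ((λ k → F k R.+ F′ k) ⋆ G) n R.≈ (F ⋆ G) n R.+ (F′ ⋆ G) n
  ⋆-distribʳ-+ F F′ G n = R.trans
    (∑-cong (suc n) (λ k → R.distribʳ (G (n ∸ k)) (F k) (F′ k)))
    (∑-+ (suc n) (λ k → F k R.* G (n ∸ k)) (λ k → F′ k R.* G (n ∸ k)))

  ⋆-distribˡ-+ : ∀ F G G′ n → (F ⋆ (λ k → G k R.+ G′ k)) n R.≈ (F ⋆ G) n R.+ (F ⋆ G′) n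
  ⋆-distribˡ-+ F G G′ n = R.trans
    (∑-cong (suc n) (λ k → R.distribˡ (F k) (G (n ∸ k)) (G′ (n ∸ k))))
    (∑-+ (suc n) (λ k → F k R.* G (n ∸ k)) (λ k → F k R.* G′ (n ∸ k)))

  ⋆-*ˡ : ∀ x F G n → ((λ k → x R.* F k) ⋆ G) n R.≈ x R.* (F ⋆ G) n
  ⋆-*ˡ x F G n = R.trans
    (∑-cong (suc n) (λ k → R.*-assoc x (F k) (G (n ∸ k))))
    (R.sym (*-distribˡ-∑ (suc n) x (λ k → F k R.* G (n ∸ k))))

  ⋆-*ʳ : ∀ x F G n → (F ⋆ (λ k → x R.* G k)) n R.≈ x R.* (F ⋆ G) n
  ⋆-*ʳ x F G n = R.trans
    (∑-cong (suc n) (λ k → x∙yz≈y∙xz (F k) x (G (n ∸ k))))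
    (R.sym (*-distribˡ-∑ (suc n) x (λ k → F k R.* G (n ∸ k))))

  ⋆-zeroˡ : ∀ F G → (∀ k → F k R.≈ R.0#) → ∀ n → (F ⋆ G) n R.≈ R.0#
  ⋆-zeroˡ F G F≈0 zero    = R.trans (R.+-identityʳ _) (R.trans (R.*-congʳ (F≈0 0)) (R.zeroˡ _))
  ⋆-zeroˡ F G F≈0 (suc n) = R.trans
    (R.+-cong (R.trans (R.*-congʳ (F≈0 0)) (R.zeroˡ _)) (⋆-zeroˡ (F ∘ suc) G (F≈0 ∘ suc) n))
    (R.+-identityˡ _)

  ⋆-constantˡ : ∀ F G → (∀ k → F (suc k) R.≈ R.0#) → ∀ n → (F ⋆ G) n R.≈ F 0 R.* G n
  ⋆-constantˡ F G F≈0 zero    = R.+-identityʳ _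
  ⋆-constantˡ F G F≈0 (suc n) = R.trans (R.+-congˡ (⋆-zeroˡ (F ∘ suc) G F≈0 n)) (R.+-identityʳ _)

  -- An additive weight acts as a derivation, since D n = D k + D (n - k) in the k-th term. For D n
  -- = n it is t d/dt.
  leibniz : (D : ℕ → R.Carrier) → (∀ m n → D (m ℕ.+ n) R.≈ D m R.+ D n) → ∀ F G n →
    D n R.* (F ⋆ G) n R.≈ ((λ k → D k R.* F k) ⋆ G) n R.+ (F ⋆ (λ k → D k R.* G k)) n
  leibniz D D-homo F G n = R.trans (*-distribˡ-∑ (suc n) (D n) (λ k → F k R.* G (n ∸ k)))
    (R.trans (sum-cong-≋ {suc n} (λ i → term (toℕ i) (Fin.toℕ≤pred[n] i)))
      (∑-+ (suc n) (λ k → D k R.* F k R.* G (n ∸ k)) (λ k → F k R.* (D (n ∸ k) R.* G (n ∸ k)))))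
    where
    term : ∀ k → k ℕ.≤ n →
      D n R.* (F k R.* G (n ∸ k)) R.≈ D k R.* F k R.* G (n ∸ k) R.+ F k R.* (D (n ∸ k) R.* G (n ∸ k))
    term k k≤n = begin
      D n R.* (F k R.* G (n ∸ k))
        ≡⟨ cong (λ m → D m R.* (F k R.* G (n ∸ k))) (ℕ.m+[n∸m]≡n k≤n) ⟨
      D (k ℕ.+ (n ∸ k)) R.* (F k R.* G (n ∸ k))
        ≈⟨ R.*-congʳ (D-homo k (n ∸ k)) ⟩
      (D k R.+ D (n ∸ k)) R.* (F k R.* G (n ∸ k))
        ≈⟨ R.distribʳ _ _ _ ⟩
      D k R.* (F k R.* G (n ∸ k)) R.+ D (n ∸ k) R.* (F k R.* G (n ∸ k))
        ≈⟨ R.+-cong (R.sym (R.*-assoc _ _ _)) (x∙yz≈y∙xz _ _ _) ⟩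
      D k R.* F k R.* G (n ∸ k) R.+ F k R.* (D (n ∸ k) R.* G (n ∸ k))  ∎

module ℚˢ = Convolution ℚ.+-*-commutativeRing
open ℚˢ using () renaming (∑ to ∑ℚ; _⋆_ to _⋆ℚ_)

opaque
  unfolding ι

  1/! : ℕ → ℚ
  1/! k = 1/ k !

  1/!-def : ∀ k → 1/! k ≡ 1/ k !
  1/!-def k = refl

  1/!-0 : 1/! 0 ≡ 1ℚ
  1/!-0 = refl

  1/!*! : ∀ k → 1/! k ℚ.* ι (k !) ≡ 1ℚ
  1/!*! k = /-*-cancel (+ 1) (k !) {{ℕ._!≢0 k}}

0≤1/! : ∀ k → 0ℚ ℚ.≤ 1/! k
0≤1/! k = *-cancelʳ-≤ (0<ι (k !) {{ℕ._!≢0 k}}) (begin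
  0ℚ ℚ.* ι (k !)      ≡⟨ ℚ.*-zeroˡ (ι (k !)) ⟩
  0ℚ                  ≤⟨ 0≤1 ⟩
  1ℚ                  ≡⟨ 1/!*! k ⟨
  1/! k ℚ.* ι (k !)   ∎)
  where open ℚ.≤-Reasoning

1/!-suc : ∀ k → ι (suc k) ℚ.* 1/! (suc k) ≡ 1/! k
1/!-suc k = *-cancelʳ-≡ (0<ι (k !) {{ℕ._!≢0 k}}) (begin
  ι (suc k) ℚ.* 1/! (suc k) ℚ.* ι (k !)
    ≡⟨ solve 3 (λ a b c → a :* b :* c := b :* (a :* c)) refl (ι (suc k)) (1/! (suc k)) (ι (k !)) ⟩
  1/! (suc k) ℚ.* (ι (suc k) ℚ.* ι (k !))
    ≡⟨ cong (1/! (suc k) ℚ.*_) (ι-homo-* (suc k) (k !)) ⟨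
  1/! (suc k) ℚ.* ι (suc k !)
    ≡⟨ 1/!*! (suc k) ⟩
  1ℚ
    ≡⟨ 1/!*! k ⟨
  1/! k ℚ.* ι (k !)  ∎)
  where
  open ≡-Reasoning
  open +-*-Solver

e : ℚ → ℕ → ℚ
e x k = x ^ℚ k ℚ.* 1/! k

e-0 : ∀ x → e x 0 ≡ 1ℚ
e-0 x = trans (ℚ.*-identityˡ (1/! 0)) 1/!-0

e-suc : ∀ x k → ι (suc k) ℚ.* e x (suc k) ≡ x ℚ.* e x k
e-suc x k = begin
  ι (suc k) ℚ.* (x ℚ.* x ^ℚ k ℚ.* 1/! (suc k))
    ≡⟨ solve 4 (λ a x y b → a :* (x :* y :* b) := x :* (y :* (a :* b))) refl (ι (suc k)) x (x ^ℚ k) (1/! (suc k)) ⟩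
  x ℚ.* (x ^ℚ k ℚ.* (ι (suc k) ℚ.* 1/! (suc k)))
    ≡⟨ cong (λ r → x ℚ.* (x ^ℚ k ℚ.* r)) (1/!-suc k) ⟩
  x ℚ.* e x k  ∎
  where
  open ≡-Reasoning
  open +-*-Solver

-- Both sides obey the recursion (k + 1) c (k + 1) = (x + y) c k of the differential equation for
-- e^{t(x + y)}: the left by `e-suc`, the right by the Leibniz rule. Binomial coefficients are thus
-- avoided.
e-+ : ∀ x y k → e (x ℚ.+ y) k ≡ (e x ⋆ℚ e y) k
e-+ x y zero    = trans (e-0 (x ℚ.+ y))
  (sym (trans (ℚ.+-identityʳ _) (cong₂ ℚ._*_ (e-0 x) (e-0 y))))
e-+ x y (suc k) = *-cancelʳ-≡ (0<ι (suc k)) (begin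
  e (x ℚ.+ y) (suc k) ℚ.* ι (suc k)
    ≡⟨ ℚ.*-comm (e (x ℚ.+ y) (suc k)) (ι (suc k)) ⟩
  ι (suc k) ℚ.* e (x ℚ.+ y) (suc k)
    ≡⟨ e-suc (x ℚ.+ y) k ⟩
  (x ℚ.+ y) ℚ.* e (x ℚ.+ y) k
    ≡⟨ cong ((x ℚ.+ y) ℚ.*_) (e-+ x y k) ⟩
  (x ℚ.+ y) ℚ.* S
    ≡⟨ ℚ.*-distribʳ-+ S x y ⟩
  x ℚ.* S ℚ.+ y ℚ.* S
    ≡⟨ cong₂ ℚ._+_ (sym left) (sym right) ⟩
  (ϑ (e x) ⋆ℚ e y) (suc k) ℚ.+ (e x ⋆ℚ ϑ (e y)) (suc k)
    ≡⟨ ℚˢ.leibniz ι ι-homo-+ (e x) (e y) (suc k) ⟨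
  ι (suc k) ℚ.* (e x ⋆ℚ e y) (suc k)
    ≡⟨ ℚ.*-comm (ι (suc k)) ((e x ⋆ℚ e y) (suc k)) ⟩
  (e x ⋆ℚ e y) (suc k) ℚ.* ι (suc k)  ∎)
  where
  open ≡-Reasoning
  S = (e x ⋆ℚ e y) k
  ϑ : (ℕ → ℚ) → ℕ → ℚ
  ϑ F j = ι j ℚ.* F j
  ϑ-0 : ∀ F → ϑ F 0 ≡ 0ℚ
  ϑ-0 F = trans (cong (ℚ._* F 0) ι-0) (ℚ.*-zeroˡ (F 0))

  left : (ϑ (e x) ⋆ℚ e y) (suc k) ≡ x ℚ.* S
  left = begin
    ϑ (e x) 0 ℚ.* e y (suc k) ℚ.+ ((ϑ (e x) ∘ suc) ⋆ℚ e y) k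
      ≡⟨ cong₂ ℚ._+_ (trans (cong (ℚ._* e y (suc k)) (ϑ-0 (e x))) (ℚ.*-zeroˡ (e y (suc k))))
           (ℚˢ.⋆-congʳ (e y) (e-suc x) k) ⟩
    0ℚ ℚ.+ ((λ j → x ℚ.* e x j) ⋆ℚ e y) k
      ≡⟨ trans (ℚ.+-identityˡ _) (ℚˢ.⋆-*ˡ x (e x) (e y) k) ⟩
    x ℚ.* S  ∎

  right : (e x ⋆ℚ ϑ (e y)) (suc k) ≡ y ℚ.* S
  right = begin
    (e x ⋆ℚ ϑ (e y)) (suc k)
      ≡⟨ ℚˢ.⋆-last (e x) (ϑ (e y)) k ⟩
    (e x ⋆ℚ (ϑ (e y) ∘ suc)) k ℚ.+ e x (suc k) ℚ.* ϑ (e y) 0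
      ≡⟨ cong₂ ℚ._+_ (ℚˢ.⋆-congˡ (e x) (e-suc y) k)
           (trans (cong (e x (suc k) ℚ.*_) (ϑ-0 (e y))) (ℚ.*-zeroʳ (e x (suc k)))) ⟩
    (e x ⋆ℚ (λ j → y ℚ.* e y j)) k ℚ.+ 0ℚ
      ≡⟨ trans (ℚ.+-identityʳ _) (ℚˢ.⋆-*ʳ y (e x) (e y) k) ⟩
    y ℚ.* S  ∎

E : ℚ → ℕ → ℚ
E x n = ∑ℚ n (e x)

E-suc : ∀ x n → E x (suc n) ≡ E x n ℚ.+ e x n
E-suc x n = ℚˢ.∑-last n (e x)

-- The generating series of `E x` is t e^{tx} / (1 - t), so only one factor of the product has to
-- carry the summation.
E-+ : ∀ x y n → E (x ℚ.+ y) n ≡ (e x ⋆ℚ E y) n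
E-+ x y zero    = sym (trans (ℚ.+-identityʳ _) (ℚ.*-zeroʳ (e x 0)))
E-+ x y (suc n) = begin
  E (x ℚ.+ y) (suc n)
    ≡⟨ E-suc (x ℚ.+ y) n ⟩
  E (x ℚ.+ y) n ℚ.+ e (x ℚ.+ y) n
    ≡⟨ cong₂ ℚ._+_ (E-+ x y n) (e-+ x y n) ⟩
  (e x ⋆ℚ E y) n ℚ.+ (e x ⋆ℚ e y) n
    ≡⟨ ℚˢ.⋆-distribˡ-+ (e x) (E y) (e y) n ⟨
  (e x ⋆ℚ (λ k → E y k ℚ.+ e y k)) n
    ≡⟨ ℚˢ.⋆-congˡ (e x) (λ k → sym (E-suc y k)) n ⟩
  (e x ⋆ℚ (E y ∘ suc)) n
    ≡⟨ trans (cong ((e x ⋆ℚ (E y ∘ suc)) n ℚ.+_) (ℚ.*-zeroʳ (e x (suc n)))) (ℚ.+-identityʳ _) ⟨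
  (e x ⋆ℚ (E y ∘ suc)) n ℚ.+ e x (suc n) ℚ.* 0ℚ
    ≡⟨ ℚˢ.⋆-last (e x) (E y) n ⟨
  (e x ⋆ℚ E y) (suc n)  ∎
  where open ≡-Reasoning

∑-nonNeg : ∀ n {F} → (∀ k → 0ℚ ℚ.≤ F k) → 0ℚ ℚ.≤ ∑ℚ n F
∑-nonNeg zero    0≤F = ℚ.≤-refl
∑-nonNeg (suc n) 0≤F = 0≤+ (0≤F 0) (∑-nonNeg n (0≤F ∘ suc))

∑-mono-n : ∀ {m n F} → (∀ k → 0ℚ ℚ.≤ F k) → m ℕ.≤ n → ∑ℚ m F ℚ.≤ ∑ℚ n F
∑-mono-n {n = n} 0≤F ℕ.z≤n       = ∑-nonNeg n 0≤F
∑-mono-n {F = F} 0≤F (ℕ.s≤s m≤n) = ℚ.+-monoʳ-≤ (F 0) (∑-mono-n {F = F ∘ suc} (0≤F ∘ suc) m≤n)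

⋆-nonNeg : ∀ {F G} → (∀ k → 0ℚ ℚ.≤ F k) → (∀ k → 0ℚ ℚ.≤ G k) → ∀ n → 0ℚ ℚ.≤ (F ⋆ℚ G) n
⋆-nonNeg 0≤F 0≤G n = ∑-nonNeg (suc n) (λ k → 0≤* (0≤F k) (0≤G (n ∸ k)))

∑-zero : ∀ n {F} → (∀ k → F k ≡ 0ℚ) → ∑ℚ n F ≡ 0ℚ
∑-zero zero    F≡0 = refl
∑-zero (suc n) F≡0 = trans (cong₂ ℚ._+_ (F≡0 0) (∑-zero n (F≡0 ∘ suc))) (ℚ.+-identityʳ 0ℚ)

e-nonNeg : ∀ {x} → 0ℚ ℚ.≤ x → ∀ k → 0ℚ ℚ.≤ e x k
e-nonNeg 0≤x k = 0≤* (^-nonNeg k 0≤x) (0≤1/! k)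

e-mono-≤ : ∀ {x y} → 0ℚ ℚ.≤ x → x ℚ.≤ y → ∀ k → e x k ℚ.≤ e y k
e-mono-≤ 0≤x x≤y k = *-monoˡ-≤ (0≤1/! k) (^-mono-≤ k 0≤x x≤y)

E-nonNeg : ∀ {x} → 0ℚ ℚ.≤ x → ∀ n → 0ℚ ℚ.≤ E x n
E-nonNeg 0≤x n = ∑-nonNeg n (e-nonNeg 0≤x)

E-mono-n : ∀ {x m n} → 0ℚ ℚ.≤ x → m ℕ.≤ n → E x m ℚ.≤ E x n
E-mono-n 0≤x = ∑-mono-n (e-nonNeg 0≤x)

-- The triangle of index pairs i + j < n lies in the square i, j < n.
E-+-≤ : ∀ {x y} → 0ℚ ℚ.≤ x → 0ℚ ℚ.≤ y → ∀ n → E (x ℚ.+ y) n ℚ.≤ E x n ℚ.* E y n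
E-+-≤ {x} {y} 0≤x 0≤y n = subst (ℚ._≤ E x n ℚ.* E y n) (sym (E-+ x y n)) (bound (e-nonNeg 0≤x) n ℕ.≤-refl)
  where
  -- Each step of the induction shifts the first factor, hence the arbitrary nonnegative `F`. The
  -- last term of the convolution vanishes because `E y 0` is an empty sum.
  bound : ∀ {F} → (∀ k → 0ℚ ℚ.≤ F k) → ∀ m → m ℕ.≤ n → (F ⋆ℚ E y) m ℚ.≤ ∑ℚ m F ℚ.* E y n
  bound {F} 0≤F zero    _   = ℚ.≤-reflexive
    (trans (ℚ.+-identityʳ _) (trans (ℚ.*-zeroʳ (F 0)) (sym (ℚ.*-zeroˡ (E y n)))))
  bound {F} 0≤F (suc m) m<n = begin
    F 0 ℚ.* E y (suc m) ℚ.+ ((F ∘ suc) ⋆ℚ E y) m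
      ≤⟨ ℚ.+-mono-≤ (*-monoʳ-≤ (0≤F 0) (E-mono-n 0≤y m<n)) (bound (0≤F ∘ suc) m (ℕ.<⇒≤ m<n)) ⟩
    F 0 ℚ.* E y n ℚ.+ ∑ℚ m (F ∘ suc) ℚ.* E y n
      ≡⟨ ℚ.*-distribʳ-+ (E y n) (F 0) (∑ℚ m (F ∘ suc)) ⟨
    ∑ℚ (suc m) F ℚ.* E y n  ∎
    where open ℚ.≤-Reasoning

-- The rectangle i < p, j < q lies in the triangle i + j < p + q.
E-*-≤ : ∀ {x y} → 0ℚ ℚ.≤ x → 0ℚ ℚ.≤ y → ∀ p q → E x p ℚ.* E y q ℚ.≤ E (x ℚ.+ y) (p ℕ.+ q)
E-*-≤ {x} {y} 0≤x 0≤y p q = subst (E x p ℚ.* E y q ℚ.≤_) (sym (E-+ x y (p ℕ.+ q))) (bound (e-nonNeg 0≤x) p)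
  where
  bound : ∀ {F} → (∀ k → 0ℚ ℚ.≤ F k) → ∀ p → ∑ℚ p F ℚ.* E y q ℚ.≤ (F ⋆ℚ E y) (p ℕ.+ q)
  bound {F} 0≤F zero    = subst (ℚ._≤ (F ⋆ℚ E y) q) (sym (ℚ.*-zeroˡ (E y q))) (⋆-nonNeg 0≤F (E-nonNeg 0≤y) q)
  bound {F} 0≤F (suc p) = begin
    ∑ℚ (suc p) F ℚ.* E y q
      ≡⟨ ℚ.*-distribʳ-+ (E y q) (F 0) (∑ℚ p (F ∘ suc)) ⟩
    F 0 ℚ.* E y q ℚ.+ ∑ℚ p (F ∘ suc) ℚ.* E y q
      ≤⟨ ℚ.+-mono-≤ (*-monoʳ-≤ (0≤F 0) (E-mono-n 0≤y (ℕ.m≤n+m q (suc p)))) (bound (0≤F ∘ suc) p) ⟩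
    (F ⋆ℚ E y) (suc p ℕ.+ q)  ∎
    where open ℚ.≤-Reasoning

module _ {x} (0≤x : 0ℚ ℚ.≤ x) where

  e-halves : ∀ {m} → x ℚ.+ x ℚ.≤ ι (suc m) → e x (suc m) ℚ.+ e x (suc m) ℚ.≤ e x m
  e-halves {m} 2x≤1+m = *-cancelʳ-≤ (0<ι (suc m)) (begin
    (e x (suc m) ℚ.+ e x (suc m)) ℚ.* ι (suc m)
      ≡⟨ solve 2 (λ a b → (a :+ a) :* b := b :* a :+ b :* a) refl (e x (suc m)) (ι (suc m)) ⟩
    ι (suc m) ℚ.* e x (suc m) ℚ.+ ι (suc m) ℚ.* e x (suc m)
      ≡⟨ cong (λ r → r ℚ.+ r) (e-suc x m) ⟩
    x ℚ.* e x m ℚ.+ x ℚ.* e x m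
      ≡⟨ solve 2 (λ x a → x :* a :+ x :* a := a :* (x :+ x)) refl x (e x m) ⟩
    e x m ℚ.* (x ℚ.+ x)
      ≤⟨ *-monoʳ-≤ (e-nonNeg 0≤x m) 2x≤1+m ⟩
    e x m ℚ.* ι (suc m)  ∎)
    where
    open ℚ.≤-Reasoning
    open +-*-Solver

  -- Beyond 2x the terms at least halve, so that E x n + 2 (e x n) decreases.
  E-tail : ∀ n → x ℚ.+ x ℚ.≤ ι (suc n) → ∀ j →
    E x (j ℕ.+ n) ℚ.+ (e x (j ℕ.+ n) ℚ.+ e x (j ℕ.+ n)) ℚ.≤ E x n ℚ.+ (e x n ℚ.+ e x n)
  E-tail n 2x≤ zero    = ℚ.≤-refl
  E-tail n 2x≤ (suc j) = begin
    E x (suc m) ℚ.+ (e x (suc m) ℚ.+ e x (suc m))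
      ≤⟨ ℚ.+-monoʳ-≤ (E x (suc m)) (e-halves (ℚ.≤-trans 2x≤ (ι-mono-≤ (ℕ.s≤s (ℕ.m≤n+m n j))))) ⟩
    E x (suc m) ℚ.+ e x m
      ≡⟨ cong (ℚ._+ e x m) (E-suc x m) ⟩
    E x m ℚ.+ e x m ℚ.+ e x m
      ≡⟨ ℚ.+-assoc (E x m) (e x m) (e x m) ⟩
    E x m ℚ.+ (e x m ℚ.+ e x m)
      ≤⟨ E-tail n 2x≤ j ⟩
    E x n ℚ.+ (e x n ℚ.+ e x n)  ∎
    where
    open ℚ.≤-Reasoning
    m = j ℕ.+ n

  E-≤ : ∀ n → x ℚ.+ x ℚ.≤ ι (suc n) → ∀ j → E x (j ℕ.+ n) ℚ.≤ E x n ℚ.+ (e x n ℚ.+ e x n)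
  E-≤ n 2x≤ j = ℚ.≤-trans
    (≤-offset _ (0≤+ (e-nonNeg 0≤x (j ℕ.+ n)) (e-nonNeg 0≤x (j ℕ.+ n))) refl) (E-tail n 2x≤ j)

  e-decreasing : ∀ n → x ℚ.+ x ℚ.≤ ι (suc n) → ∀ j → e x (j ℕ.+ n) ℚ.≤ e x n
  e-decreasing n 2x≤ zero    = ℚ.≤-refl
  e-decreasing n 2x≤ (suc j) = ℚ.≤-trans
    (ℚ.≤-trans (≤-offset _ (e-nonNeg 0≤x (suc j ℕ.+ n)) refl)
      (e-halves (ℚ.≤-trans 2x≤ (ι-mono-≤ (ℕ.s≤s (ℕ.m≤n+m n j))))))
    (e-decreasing n 2x≤ j)

  -- Beyond 2x the terms stay below a fixed one, and one more step of the recursion divides by the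
  -- index, which can be chosen large. The inequality on 2x in the conclusion is the one that the
  -- tail bound `E-≤` asks for.
  e→0 : ∀ {ε} → 0ℚ ℚ.< ε → ∃[ N ] (x ℚ.+ x ℚ.≤ ι (suc N) × e x N ℚ.≤ ε)
  e→0 {ε} 0<ε = suc n , ℚ.≤-trans 2x≤n (ι-mono-≤ (ℕ.m≤n⇒m≤1+n (ℕ.n≤1+n n)))
    , *-cancelʳ-≤ (0<ι (suc n)) (begin
    e x (suc n) ℚ.* ι (suc n)   ≡⟨ ℚ.*-comm (e x (suc n)) (ι (suc n)) ⟩
    ι (suc n) ℚ.* e x (suc n)   ≡⟨ e-suc x n ⟩
    x ℚ.* e x n                 ≤⟨ *-monoʳ-≤ 0≤x (e-decreasing N₁ (ℚ.≤-trans (proj₂ (archimedean (x ℚ.+ x))) (ι-mono-≤ (ℕ.n≤1+n N₁))) N₂) ⟩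
    x ℚ.* e x N₁                ≤⟨ proj₂ (archimedean-* (x ℚ.* e x N₁) 0<ε) (suc n) (ℕ.m≤n⇒m≤1+n (ℕ.m≤m+n N₂ N₁)) ⟩
    ε ℚ.* ι (suc n)             ∎)
    where
    open ℚ.≤-Reasoning
    N₁ = proj₁ (archimedean (x ℚ.+ x))
    N₂ = proj₁ (archimedean-* (x ℚ.* e x N₁) 0<ε)
    n = N₂ ℕ.+ N₁
    2x≤n : x ℚ.+ x ℚ.≤ ι n
    2x≤n = ℚ.≤-trans (proj₂ (archimedean (x ℚ.+ x))) (ι-mono-≤ (ℕ.m≤n+m N₁ N₂))

-- Monotonicity of the single terms, summed over m ≤ k < n and arranged without subtraction. It lets
-- a tail bound at the right end of [0, K] serve for the whole interval.
E-increment-mono : ∀ {x y} → 0ℚ ℚ.≤ x → x ℚ.≤ y → ∀ {m n} → m ℕ.≤ n →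
  E x n ℚ.+ E y m ℚ.≤ E y n ℚ.+ E x m
E-increment-mono {x} {y} 0≤x x≤y {m} {n} m≤n =
  subst (λ n → E x n ℚ.+ E y m ℚ.≤ E y n ℚ.+ E x m) (ℕ.m∸n+n≡m m≤n) (helper (n ∸ m))
  where
  helper : ∀ j → E x (j ℕ.+ m) ℚ.+ E y m ℚ.≤ E y (j ℕ.+ m) ℚ.+ E x m
  helper zero    = ℚ.≤-reflexive (ℚ.+-comm (E x m) (E y m))
  helper (suc j) = begin
    E x (suc i) ℚ.+ E y m               ≡⟨ cong (ℚ._+ E y m) (E-suc x i) ⟩
    E x i ℚ.+ e x i ℚ.+ E y m           ≡⟨ solve 3 (λ a b c → a :+ b :+ c := a :+ c :+ b) refl (E x i) (e x i) (E y m) ⟩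
    E x i ℚ.+ E y m ℚ.+ e x i           ≤⟨ ℚ.+-mono-≤ (helper j) (e-mono-≤ 0≤x x≤y i) ⟩
    E y i ℚ.+ E x m ℚ.+ e y i           ≡⟨ solve 3 (λ a b c → a :+ b :+ c := a :+ c :+ b) refl (E y i) (E x m) (e y i) ⟩
    E y i ℚ.+ e y i ℚ.+ E x m           ≡⟨ cong (ℚ._+ E x m) (E-suc y i) ⟨
    E y (suc i) ℚ.+ E x m               ∎
    where
    open ℚ.≤-Reasoning
    open +-*-Solver
    i = j ℕ.+ m

E-uniformly-cauchy : ∀ {K} → 0ℚ ℚ.≤ K → ∀ {ε} → 0ℚ ℚ.< ε → ∃[ N ] (∀ {x} → 0ℚ ℚ.≤ x → x ℚ.≤ K →
  ∀ {m n} → N ℕ.≤ m → m ℕ.≤ n → E x n ℚ.≤ E x m ℚ.+ ε)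
E-uniformly-cauchy {K} 0≤K {ε} 0<ε = N , λ {x} 0≤x x≤K {m} {n} N≤m m≤n → begin
  E x n
    ≤⟨ ≤-offset _ (p≤q⇒0≤q-p (E-increment-mono 0≤x x≤K m≤n))
         (solve 4 (λ a b c d → a :+ (c :+ d :- (a :+ b)) := d :+ (c :- b)) refl (E x n) (E K m) (E K n) (E x m)) ⟩
  E x m ℚ.+ (E K n ℚ.- E K m)
    ≤⟨ ℚ.+-monoʳ-≤ (E x m) (tail N≤m (ℕ.≤-trans N≤m m≤n)) ⟩
  E x m ℚ.+ ε  ∎
  where
  open ℚ.≤-Reasoning
  open +-*-Solver
  -- The tail from the index `N` on is at most twice the term `e K N`.
  δ = ℚ.½ ℚ.* ε
  0<δ : 0ℚ ℚ.< δ
  0<δ = 0<* (ℚ.positive⁻¹ ℚ.½) 0<ε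
  N = proj₁ (e→0 0≤K 0<δ)
  tail : ∀ {m n} → N ℕ.≤ m → N ℕ.≤ n → E K n ℚ.- E K m ℚ.≤ ε
  tail {m} {n} N≤m N≤n = begin
    E K n ℚ.- E K m
      ≤⟨ ℚ.+-mono-≤ (subst (λ n → E K n ℚ.≤ E K N ℚ.+ (e K N ℚ.+ e K N)) (ℕ.m∸n+n≡m N≤n)
           (E-≤ 0≤K N (proj₁ (proj₂ (e→0 0≤K 0<δ))) (n ∸ N))) (ℚ.neg-antimono-≤ (E-mono-n 0≤K N≤m)) ⟩
    E K N ℚ.+ (e K N ℚ.+ e K N) ℚ.- E K N
      ≡⟨ solve 2 (λ a b → a :+ b :- a := b) refl (E K N) (e K N ℚ.+ e K N) ⟩
    e K N ℚ.+ e K N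
      ≤⟨ ℚ.+-mono-≤ (proj₂ (proj₂ (e→0 0≤K 0<δ))) (proj₂ (proj₂ (e→0 0≤K 0<δ))) ⟩
    δ ℚ.+ δ
      ≡⟨ solve 1 (λ a → con ℚ.½ :* a :+ con ℚ.½ :* a := a) refl ε ⟩
    ε  ∎

-- Limits and logarithms

½* : ∀ {ε} → 0ℚ ℚ.< ε → 0ℚ ℚ.< ℚ.½ ℚ.* ε
½* = 0<* (ℚ.positive⁻¹ ℚ.½)

½+½ : ∀ ε → ℚ.½ ℚ.* ε ℚ.+ ℚ.½ ℚ.* ε ≡ ε
½+½ ε = trans (sym (ℚ.*-distribʳ-+ ε ℚ.½ ℚ.½)) (ℚ.*-identityˡ ε)

½*-< : ∀ {ε} → 0ℚ ℚ.< ε → ℚ.½ ℚ.* ε ℚ.< ε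
½*-< {ε} 0<ε = subst₂ ℚ._<_ (ℚ.+-identityʳ (ℚ.½ ℚ.* ε)) (½+½ ε) (ℚ.+-monoʳ-< (ℚ.½ ℚ.* ε) (½* 0<ε))

quotient : ∀ {p K} → 0ℚ ℚ.< p → 0ℚ ℚ.< K → ∃[ q ] (0ℚ ℚ.< q × q ℚ.* K ≡ p)
quotient {p} {K} 0<p 0<K = p ℚ.* ℚ.1/ K
  , 0<* 0<p (ℚ.positive⁻¹ (ℚ.1/ K) {{ℚ.1/pos⇒pos K {{ℚ.positive 0<K}}}})
  , trans (ℚ.*-assoc p (ℚ.1/ K) K) (trans (cong (p ℚ.*_) (ℚ.*-inverseˡ K)) (ℚ.*-identityʳ p))
  where
  instance
    K≢0 : ℚ.NonZero K
    K≢0 = ℚ.pos⇒nonZero K {{ℚ.positive 0<K}}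

-- One set of limit laws is to serve for sequences of rationals and for sequences of reals. `map₂`
-- combines closure under intersections with closure under supersets.
record Filter (I : Set) : Set₁ where
  field
    Eventually : (I → Set) → Set
    always     : ∀ {P} → (∀ i → P i) → Eventually P
    map₂       : ∀ {P Q R : I → Set} → (∀ i → P i → Q i → R i) →
                 Eventually P → Eventually Q → Eventually R

  map₁ : ∀ {P Q : I → Set} → (∀ i → P i → Q i) → Eventually P → Eventually Q
  map₁ f p = map₂ (λ i x _ → f i x) p p

  Null Bounded : (I → ℚ) → Set
  Null u = ∀ ε → 0ℚ ℚ.< ε → Eventually (λ i → ℚ.∣ u i ∣ ℚ.≤ ε)
  Bounded u = ∃[ K ] (0ℚ ℚ.< K × Eventually (λ i → ℚ.∣ u i ∣ ℚ.≤ K))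

  _∼_ : (I → ℚ) → (I → ℚ) → Set
  u ∼ v = Null (λ i → u i ℚ.- v i)

  null-dominated : ∀ {u v} → (∀ i → ℚ.∣ u i ∣ ℚ.≤ ℚ.∣ v i ∣) → Null v → Null u
  null-dominated u≤v nv ε 0<ε = map₁ (λ i v≤ε → ℚ.≤-trans (u≤v i) v≤ε) (nv ε 0<ε)

  null-cong : ∀ {u v} → (∀ i → u i ≡ v i) → Null v → Null u
  null-cong u≡v = null-dominated (λ i → ℚ.≤-reflexive (cong ℚ.∣_∣ (u≡v i)))

  null-0 : Null (λ _ → 0ℚ)
  null-0 ε 0<ε = always (λ _ → ℚ.<⇒≤ 0<ε)

  null-+ : ∀ {u v} → Null u → Null v → Null (λ i → u i ℚ.+ v i)
  null-+ {u} {v} nu nv ε 0<ε = map₂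
    (λ i u≤ v≤ → ℚ.≤-trans (ℚ.∣p+q∣≤∣p∣+∣q∣ (u i) (v i)) (subst (ℚ.∣ u i ∣ ℚ.+ ℚ.∣ v i ∣ ℚ.≤_) (½+½ ε) (ℚ.+-mono-≤ u≤ v≤)))
    (nu (ℚ.½ ℚ.* ε) (½* 0<ε)) (nv (ℚ.½ ℚ.* ε) (½* 0<ε))

  null-neg : ∀ {u} → Null u → Null (λ i → ℚ.- u i)
  null-neg {u} = null-dominated (λ i → ℚ.≤-reflexive (ℚ.∣-p∣≡∣p∣ (u i)))

  null-* : ∀ {u v} → Null u → Bounded v → Null (λ i → u i ℚ.* v i)
  null-* {u} {v} nu (K , 0<K , v≤K) ε 0<ε = map₂ (λ i u≤ v≤ → begin
      ℚ.∣ u i ℚ.* v i ∣            ≡⟨ ℚ.∣p*q∣≡∣p∣*∣q∣ (u i) (v i) ⟩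
      ℚ.∣ u i ∣ ℚ.* ℚ.∣ v i ∣      ≤⟨ *-mono-≤ (ℚ.0≤∣p∣ (u i)) u≤ (ℚ.0≤∣p∣ (v i)) v≤ ⟩
      δ ℚ.* K                      ≡⟨ δK≡ε ⟩
      ε                            ∎)
    (nu δ 0<δ) v≤K
    where
    open ℚ.≤-Reasoning
    δ = proj₁ (quotient 0<ε 0<K)
    0<δ = proj₁ (proj₂ (quotient 0<ε 0<K))
    δK≡ε = proj₂ (proj₂ (quotient 0<ε 0<K))

  null⇒bounded : ∀ {u} → Null u → Bounded u
  null⇒bounded nu = 1ℚ , 0<1 , nu 1ℚ 0<1

  bounded-const : ∀ p → Bounded (λ _ → p)
  bounded-const p = 1ℚ ℚ.+ ℚ.∣ p ∣ , ℚ.+-mono-<-≤ 0<1 (ℚ.0≤∣p∣ p)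
    , always (λ _ → ≤-offset 1ℚ 0≤1 (ℚ.+-comm ℚ.∣ p ∣ 1ℚ))

  bounded-+ : ∀ {u v} → Bounded u → Bounded v → Bounded (λ i → u i ℚ.+ v i)
  bounded-+ {u} {v} (K , 0<K , u≤K) (L , 0<L , v≤L) = K ℚ.+ L , ℚ.+-mono-< 0<K 0<L
    , map₂ (λ i u≤ v≤ → ℚ.≤-trans (ℚ.∣p+q∣≤∣p∣+∣q∣ (u i) (v i)) (ℚ.+-mono-≤ u≤ v≤)) u≤K v≤L

  ∼-refl : ∀ {u} → u ∼ u
  ∼-refl {u} = null-cong (λ i → ℚ.+-inverseʳ (u i)) null-0

  ∼-reflexive : ∀ {u v} → (∀ i → u i ≡ v i) → u ∼ v
  ∼-reflexive {u} {v} u≡v = null-cong (λ i → trans (cong (ℚ._- v i) (u≡v i)) (ℚ.+-inverseʳ (v i))) null-0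

  ∼-sym : ∀ {u v} → u ∼ v → v ∼ u
  ∼-sym {u} {v} = null-dominated (λ i → ℚ.≤-reflexive (∣p-q∣≡∣q-p∣ (v i) (u i)))

  ∼-trans : ∀ {u v w} → u ∼ v → v ∼ w → u ∼ w
  ∼-trans {u} {v} {w} u∼v v∼w = null-cong
    (λ i → solve 3 (λ u v w → u :- w := (u :- v) :+ (v :- w)) refl (u i) (v i) (w i)) (null-+ u∼v v∼w)
    where open +-*-Solver

  ∼-+ : ∀ {u u′ v v′} → u ∼ u′ → v ∼ v′ → (λ i → u i ℚ.+ v i) ∼ (λ i → u′ i ℚ.+ v′ i)
  ∼-+ {u} {u′} {v} {v′} u∼u′ v∼v′ = null-cong
    (λ i → solve 4 (λ u u′ v v′ → u :+ v :- (u′ :+ v′) := (u :- u′) :+ (v :- v′)) refl (u i) (u′ i) (v i) (v′ i))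
    (null-+ u∼u′ v∼v′)
    where open +-*-Solver

  ∼-neg : ∀ {u v} → u ∼ v → (λ i → ℚ.- u i) ∼ (λ i → ℚ.- v i)
  ∼-neg {u} {v} u∼v = null-cong (λ i → sym (ℚ.neg-distrib-+ (u i) (ℚ.- v i))) (null-neg u∼v)

  ∼-bounded : ∀ {u v} → u ∼ v → Bounded v → Bounded u
  ∼-bounded {u} {v} u∼v (K , 0<K , bv) = proj₁ B , proj₁ (proj₂ B)
    , map₁ (λ i → subst (λ r → ℚ.∣ r ∣ ℚ.≤ proj₁ B) (solve 2 (λ u v → u :- v :+ v := u) refl (u i) (v i)))
        (proj₂ (proj₂ B))
    where
    open +-*-Solver
    B : Bounded (λ i → u i ℚ.- v i ℚ.+ v i)
    B = bounded-+ (null⇒bounded u∼v) (K , 0<K , bv)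

  ∼-* : ∀ {u u′ v v′} → Bounded u′ → Bounded v → u ∼ u′ → v ∼ v′ →
        (λ i → u i ℚ.* v i) ∼ (λ i → u′ i ℚ.* v′ i)
  ∼-* {u} {u′} {v} {v′} bu′ bv u∼u′ v∼v′ = null-cong
    (λ i → solve 4 (λ u u′ v v′ → u :* v :- u′ :* v′ := (u :- u′) :* v :+ (v :- v′) :* u′) refl (u i) (u′ i) (v i) (v′ i))
    (null-+ (null-* u∼u′ bv) (null-* v∼v′ bu′))
    where open +-*-Solver

atTop : Filter ℕ
atTop = record
  { Eventually = λ P → ∃[ N ] (∀ n → N ℕ.≤ n → P n)
  ; always     = λ p → 0 , λ n _ → p n
  ; map₂       = λ f (M , p) (N , q) → M ℕ.⊔ N , λ n M⊔N≤n →
                   f n (p n (ℕ.m⊔n≤o⇒m≤o M N M⊔N≤n)) (q n (ℕ.m⊔n≤o⇒n≤o M N M⊔N≤n))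
  }

module Lim = Filter atTop

-- The iterated filter: "for all large n, for all large m depending on n".
-- It governs limits of sequences (indexed by n) of Cauchy sequences (indexed by m).
iterated : Filter (ℕ × ℕ)
iterated = record
  { Eventually = λ P → Lim.Eventually (λ n → Lim.Eventually (λ m → P (n , m)))
  ; always     = λ p → Lim.always (λ n → Lim.always (λ m → p (n , m)))
  ; map₂       = λ f → Lim.map₂ (λ n → Lim.map₂ (λ m → f (n , m)))
  }

module Lim² = Filter iterated

bounded-proj₂ : ∀ {u : ℕ → ℚ} → Lim.Bounded u → Lim².Bounded (u ∘ proj₂)
bounded-proj₂ (K , 0<K , u≤K) = K , 0<K , Lim.always (λ _ → u≤K)

cauchy⇒bounded : ∀ {u} → IsCauchy u → Lim.Bounded u
cauchy⇒bounded {u} cu = 1ℚ ℚ.+ ℚ.∣ u N ∣ , ℚ.+-mono-<-≤ 0<1 (ℚ.0≤∣p∣ (u N)) , N , λ n N≤n → begin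
  ℚ.∣ u n ∣                         ≡⟨ cong ℚ.∣_∣ (solve 2 (λ a b → a :- b :+ b := a) refl (u n) (u N)) ⟨
  ℚ.∣ u n ℚ.- u N ℚ.+ u N ∣         ≤⟨ ℚ.∣p+q∣≤∣p∣+∣q∣ (u n ℚ.- u N) (u N) ⟩
  ℚ.∣ u n ℚ.- u N ∣ ℚ.+ ℚ.∣ u N ∣   ≤⟨ ℚ.+-monoˡ-≤ ℚ.∣ u N ∣ (ℚ.<⇒≤ (proj₂ (cu 1ℚ 0<1) n N N≤n ℕ.≤-refl)) ⟩
  1ℚ ℚ.+ ℚ.∣ u N ∣                  ∎
  where
  open ℚ.≤-Reasoning
  open +-*-Solver
  N = proj₁ (cu 1ℚ 0<1)

-- Logarithms of positive integers

e-1 : ∀ x → e x 1 ≡ x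
e-1 x = begin
  e x 1              ≡⟨ ℚ.*-identityˡ (e x 1) ⟨
  1ℚ ℚ.* e x 1       ≡⟨ cong (ℚ._* e x 1) ι-1 ⟨
  ι 1 ℚ.* e x 1      ≡⟨ e-suc x 0 ⟩
  x ℚ.* e x 0        ≡⟨ cong (x ℚ.*_) (e-0 x) ⟩
  x ℚ.* 1ℚ           ≡⟨ ℚ.*-identityʳ x ⟩
  x                  ∎
  where open ≡-Reasoning

E-1 : ∀ x → E x 1 ≡ 1ℚ
E-1 x = trans (ℚ.+-identityʳ (e x 0)) (e-0 x)

E-2 : ∀ x → E x 2 ≡ 1ℚ ℚ.+ x
E-2 x = trans (E-suc x 1) (cong₂ ℚ._+_ (E-1 x) (e-1 x))

E-zero : ∀ n → E 0ℚ (suc n) ≡ 1ℚ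
E-zero n = trans (cong₂ ℚ._+_ (e-0 0ℚ) (∑-zero n e-zero)) (ℚ.+-identityʳ 1ℚ)
  where
  e-zero : ∀ k → e 0ℚ (suc k) ≡ 0ℚ
  e-zero k = trans (cong (ℚ._* 1/! (suc k)) (ℚ.*-zeroˡ (0ℚ ^ℚ k))) (ℚ.*-zeroˡ (1/! (suc k)))

opaque
  unfolding ι

  step : ℕ → ℚ
  step n = (+ 1) ℚ./ suc n

  step*ι : ∀ n → step n ℚ.* ι (suc n) ≡ 1ℚ
  step*ι n = /-*-cancel (+ 1) (suc n)

0≤step : ∀ n → 0ℚ ℚ.≤ step n
0≤step n = *-cancelʳ-≤ (0<ι (suc n)) (subst₂ ℚ._≤_ (sym (ℚ.*-zeroˡ (ι (suc n)))) (sym (step*ι n)) 0≤1)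

step≤1 : ∀ n → step n ℚ.≤ 1ℚ
step≤1 n = *-cancelʳ-≤ (0<ι (suc n)) (begin
  step n ℚ.* ι (suc n)   ≡⟨ step*ι n ⟩
  1ℚ                     ≡⟨ ι-1 ⟨
  ι 1                    ≤⟨ ι-mono-≤ (ℕ.s≤s ℕ.z≤n) ⟩
  ι (suc n)              ≡⟨ ℚ.*-identityˡ (ι (suc n)) ⟨
  1ℚ ℚ.* ι (suc n)       ∎)
  where open ℚ.≤-Reasoning

step→0 : ∀ {ε} → 0ℚ ℚ.< ε → ∃[ N ] (∀ n → N ℕ.≤ n → step n ℚ.≤ ε)
step→0 {ε} 0<ε = proj₁ (archimedean-* 1ℚ 0<ε) , λ n N≤n →
  *-cancelʳ-≤ (0<ι (suc n)) (subst (ℚ._≤ ε ℚ.* ι (suc n)) (sym (step*ι n))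
    (proj₂ (archimedean-* 1ℚ 0<ε) (suc n) (ℕ.m≤n⇒m≤1+n N≤n)))

-- A discrete intermediate value theorem, by downward search from `J`.
crossing : {P : ℕ → Set} → (∀ j → Dec (P j)) → P 0 → ∀ J → ¬ P J → ∃[ j ] (P j × ¬ P (suc j))
crossing P? p₀ zero    ¬pJ = contradiction p₀ ¬pJ
crossing P? p₀ (suc J) ¬pJ = case P? J of λ where
  (yes pJ)  → J , pJ , ¬pJ
  (no ¬pJ′) → crossing P? p₀ J ¬pJ′

-- log m is the limit over n of the largest multiple of 1/(n + 1) at which the
-- (n + 2)-nd partial sum of the exponential series does not exceed m.
module Logarithm (m : ℕ) .{{_ : NonZero m}} where

  private
    μ : ℚ
    μ = ι m

    0≤μ : 0ℚ ℚ.≤ μ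
    0≤μ = 0≤ι m

    1≤μ : 1ℚ ℚ.≤ μ
    1≤μ = subst (ℚ._≤ μ) ι-1 (ι-mono-≤ (ℕ.>-nonZero⁻¹ m))

    -- At least two terms are summed, so that 1 + x bounds the sum from below. This ends the search
    -- and confines `log` to [0, μ].
    grid : ∀ n → ∃[ j ] ((E (ι j ℚ.* step n) (2 ℕ.+ n) ℚ.≤ μ) × ¬ (E (ι (suc j) ℚ.* step n) (2 ℕ.+ n) ℚ.≤ μ))
    grid n = crossing (λ j → E (ι j ℚ.* step n) (2 ℕ.+ n) ℚ.≤? μ)
      (subst (ℚ._≤ μ) (sym (trans (cong (λ x → E x (2 ℕ.+ n)) (trans (cong (ℚ._* step n) ι-0) (ℚ.*-zeroˡ (step n)))) (E-zero (suc n)))) 1≤μ)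
      -- This grid point is μ itself, where the first two terms alone give 1 + μ.
      (m ℕ.* suc n)
      (λ E≤μ → ℚ.<-irrefl refl (begin-strict
        μ                                         ≡⟨ ℚ.+-identityˡ μ ⟨
        0ℚ ℚ.+ μ                                  <⟨ ℚ.+-monoˡ-< μ 0<1 ⟩
        1ℚ ℚ.+ μ                                  ≡⟨ E-2 μ ⟨
        E μ 2                                     ≤⟨ E-mono-n {μ} {2} {2 ℕ.+ n} 0≤μ (ℕ.s≤s (ℕ.s≤s ℕ.z≤n)) ⟩
        E μ (2 ℕ.+ n)                             ≡⟨ cong (λ x → E x (2 ℕ.+ n)) μ≡ ⟨
        E (ι (m ℕ.* suc n) ℚ.* step n) (2 ℕ.+ n)  ≤⟨ E≤μ ⟩
        μ                                         ∎))
      where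
      open ℚ.≤-Reasoning
      open +-*-Solver
      μ≡ : ι (m ℕ.* suc n) ℚ.* step n ≡ μ
      μ≡ = trans (cong (ℚ._* step n) (ι-homo-* m (suc n)))
        (trans (solve 3 (λ a b c → a :* b :* c := a :* (c :* b)) refl μ (ι (suc n)) (step n))
          (trans (cong (μ ℚ.*_) (step*ι n)) (ℚ.*-identityʳ μ)))

  log : ℕ → ℚ
  log n = ι (proj₁ (grid n)) ℚ.* step n

  0≤log : ∀ n → 0ℚ ℚ.≤ log n
  0≤log n = 0≤* (0≤ι _) (0≤step n)

  private
    E-log-≤ : ∀ n → E (log n) (2 ℕ.+ n) ℚ.≤ μ
    E-log-≤ n = proj₁ (proj₂ (grid n))

    <-E-log : ∀ n → μ ℚ.< E (log n ℚ.+ step n) (2 ℕ.+ n)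
    <-E-log n = subst (λ x → μ ℚ.< E x (2 ℕ.+ n)) (begin
      ι (suc j) ℚ.* step n          ≡⟨ cong (ℚ._* step n) (ι-suc j) ⟩
      (1ℚ ℚ.+ ι j) ℚ.* step n       ≡⟨ solve 2 (λ a b → (con 1ℚ :+ a) :* b := a :* b :+ b) refl (ι j) (step n) ⟩
      ι j ℚ.* step n ℚ.+ step n     ∎)
      (ℚ.≰⇒> (proj₂ (proj₂ (grid n))))
      where
      open ≡-Reasoning
      open +-*-Solver
      j = proj₁ (grid n)

  log≤ : ∀ n → log n ℚ.≤ μ
  log≤ n = begin
    log n                  ≤⟨ ≤-offset 1ℚ 0≤1 (ℚ.+-comm (log n) 1ℚ) ⟩
    1ℚ ℚ.+ log n           ≡⟨ E-2 (log n) ⟨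
    E (log n) 2            ≤⟨ E-mono-n {log n} {2} {2 ℕ.+ n} (0≤log n) (ℕ.s≤s (ℕ.s≤s ℕ.z≤n)) ⟩
    E (log n) (2 ℕ.+ n)    ≤⟨ E-log-≤ n ⟩
    μ                      ∎
    where open ℚ.≤-Reasoning

  private
    -- Compare the (b + 2)-nd partial sums at log a and at log b + step b, using that they
    -- grow at least as fast as the second one, which is 1 + x.
    log-≤-log : ∀ {τ} → 0ℚ ℚ.≤ τ → ∀ {a b} → E (log a) (2 ℕ.+ b) ℚ.≤ E (log a) (2 ℕ.+ a) ℚ.+ τ →
      log a ℚ.≤ log b ℚ.+ step b ℚ.+ τ
    log-≤-log {τ} 0≤τ {a} {b} E≤ = case ℚ.≤-total x y of λ where
        (inj₁ x≤y) → ℚ.≤-trans x≤y (≤-offset τ 0≤τ refl)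
        (inj₂ y≤x) → ≤-offset _ (p≤q⇒0≤q-p (gap y≤x))
          (solve 5 (λ x y τ μ one → x :+ (μ :+ τ :+ (one :+ y) :- (μ :+ (one :+ x))) := y :+ τ) refl x y τ μ 1ℚ)
      where
      open +-*-Solver
      x y : ℚ
      x = log a
      y = log b ℚ.+ step b
      gap : y ℚ.≤ x → μ ℚ.+ (1ℚ ℚ.+ x) ℚ.≤ μ ℚ.+ τ ℚ.+ (1ℚ ℚ.+ y)
      gap y≤x = begin
        μ ℚ.+ (1ℚ ℚ.+ x)                      ≡⟨ cong (μ ℚ.+_) (E-2 x) ⟨
        μ ℚ.+ E x 2                           ≤⟨ ℚ.+-monoˡ-≤ (E x 2) (ℚ.<⇒≤ (<-E-log b)) ⟩
        E y (2 ℕ.+ b) ℚ.+ E x 2               ≤⟨ E-increment-mono (0≤+ (0≤log b) (0≤step b)) y≤x {2} {2 ℕ.+ b} (ℕ.s≤s (ℕ.s≤s ℕ.z≤n)) ⟩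
        E x (2 ℕ.+ b) ℚ.+ E y 2               ≤⟨ ℚ.+-mono-≤ E≤ (ℚ.≤-reflexive (E-2 y)) ⟩
        E x (2 ℕ.+ a) ℚ.+ τ ℚ.+ (1ℚ ℚ.+ y)    ≤⟨ ℚ.+-monoˡ-≤ (1ℚ ℚ.+ y) (ℚ.+-monoˡ-≤ τ (E-log-≤ a)) ⟩
        μ ℚ.+ τ ℚ.+ (1ℚ ℚ.+ y)                ∎
        where open ℚ.≤-Reasoning

    -- All approximations `log a` lie in [0, μ], so that one index serves for every `a`.
    E-log-cauchy : ∀ {ε} → 0ℚ ℚ.< ε → ∃[ N ] (∀ a {m n} → N ℕ.≤ m → N ℕ.≤ n → E (log a) n ℚ.≤ E (log a) m ℚ.+ ε)
    E-log-cauchy {ε} 0<ε = N , λ a {m} {n} N≤m N≤n → case ℕ.≤-total m n of λ where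
        (inj₁ m≤n) → near (0≤log a) (log≤ a) N≤m m≤n
        (inj₂ n≤m) → ℚ.≤-trans (E-mono-n (0≤log a) n≤m) (≤-offset ε (ℚ.<⇒≤ 0<ε) refl)
      where
      N = proj₁ (E-uniformly-cauchy 0≤μ 0<ε)
      near = proj₂ (E-uniformly-cauchy 0≤μ 0<ε)

  log-cauchy : IsCauchy log
  log-cauchy ε 0<ε = N₁ ℕ.⊔ N₂ , λ a b N≤a N≤b → ℚ.≤-<-trans
      (-p≤q∧p≤q⇒∣p∣≤q (ℚ.≤-trans (ℚ.≤-reflexive (solve 2 (λ a b → :- (a :- b) := b :- a) refl (log a) (log b)))
        (diff N≤b N≤a)) (diff N≤a N≤b))
      (½*-< 0<ε)
    where
    open +-*-Solver
    -- The grid step and the change in the number of terms cost τ each. Their total ε/2 leaves room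
    -- for the strict inequality.
    τ = ℚ.½ ℚ.* (ℚ.½ ℚ.* ε)
    0<τ : 0ℚ ℚ.< τ
    0<τ = ½* (½* 0<ε)
    N₁ = proj₁ (step→0 0<τ)
    N₂ = proj₁ (E-log-cauchy 0<τ)
    diff : ∀ {a b} → N₁ ℕ.⊔ N₂ ℕ.≤ a → N₁ ℕ.⊔ N₂ ℕ.≤ b → log a ℚ.- log b ℚ.≤ ℚ.½ ℚ.* ε
    diff {a} {b} N≤a N≤b = begin
      log a ℚ.- log b
        ≤⟨ ℚ.+-monoˡ-≤ (ℚ.- log b) (log-≤-log (ℚ.<⇒≤ 0<τ)
             (proj₂ (E-log-cauchy 0<τ) a (far N≤a) (far N≤b))) ⟩
      log b ℚ.+ step b ℚ.+ τ ℚ.- log b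
        ≡⟨ solve 3 (λ a b c → a :+ b :+ c :- a := b :+ c) refl (log b) (step b) τ ⟩
      step b ℚ.+ τ
        ≤⟨ ℚ.+-monoˡ-≤ τ (proj₂ (step→0 0<τ) b (ℕ.m⊔n≤o⇒m≤o N₁ N₂ N≤b)) ⟩
      τ ℚ.+ τ
        ≡⟨ ½+½ (ℚ.½ ℚ.* ε) ⟩
      ℚ.½ ℚ.* ε  ∎
      where
      open ℚ.≤-Reasoning
      far : ∀ {n} → N₁ ℕ.⊔ N₂ ℕ.≤ n → N₂ ℕ.≤ 2 ℕ.+ n
      far N≤n = ℕ.m≤n⇒m≤1+n (ℕ.m≤n⇒m≤1+n (ℕ.m⊔n≤o⇒n≤o N₁ N₂ N≤n))

  -- From above: for k ≥ n the sum is at most the one with k + 2 terms, which the choice of grid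
  -- point keeps below or at μ. From below: the next grid point overshoots μ, and by `E-+-≤` one
  -- grid step multiplies the sum by at most 1 + 2/(k + 1).
  exp-log : (λ (n , k) → E (log k) n) Lim².∼ (λ _ → μ)
  exp-log ε 0<ε = N , λ n N≤n → n ℕ.⊔ M , λ k n⊔M≤k →
    let n≤2+k = ℕ.m≤n⇒m≤1+n (ℕ.m≤n⇒m≤1+n (ℕ.m⊔n≤o⇒m≤o n M n⊔M≤k))
        2step≤ = proj₂ (step→0 0<η) k (ℕ.m⊔n≤o⇒n≤o n M n⊔M≤k)
    in -p≤q∧p≤q⇒∣p∣≤q
      (≤-offset _ (p≤q⇒0≤q-p (below n k (ℕ.≤-trans N≤n n≤2+k) N≤n 2step≤))
        (solve 3 (λ x μ ε → :- (x :- μ) :+ (x :+ ε :- μ) := ε) refl (E (log k) n) μ ε))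
      (begin
        E (log k) n ℚ.- μ             ≤⟨ ℚ.+-monoˡ-≤ (ℚ.- μ) (E-mono-n (0≤log k) n≤2+k) ⟩
        E (log k) (2 ℕ.+ k) ℚ.- μ     ≤⟨ ℚ.+-monoˡ-≤ (ℚ.- μ) (E-log-≤ k) ⟩
        μ ℚ.- μ                       ≡⟨ ℚ.+-inverseʳ μ ⟩
        0ℚ                            ≤⟨ ℚ.<⇒≤ 0<ε ⟩
        ε                             ∎)
    where
    open ℚ.≤-Reasoning
    open +-*-Solver
    τ = ℚ.½ ℚ.* ε
    0<τ : 0ℚ ℚ.< τ
    0<τ = ½* 0<ε
    N = proj₁ (E-log-cauchy 0<τ)
    -- As η μ = ε/4, the grid step contributes at most 2 η μ = τ. The other τ pays for passing from
    -- k + 2 terms to n.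
    η : ℚ
    η = proj₁ (quotient (½* 0<τ) (0<ι m))
    0<η : 0ℚ ℚ.< η
    0<η = proj₁ (proj₂ (quotient (½* 0<τ) (0<ι m)))
    η*μ : η ℚ.* μ ≡ ℚ.½ ℚ.* τ
    η*μ = proj₂ (proj₂ (quotient (½* 0<τ) (0<ι m)))
    M = proj₁ (step→0 0<η)

    E-step : ∀ k → E (step k) (2 ℕ.+ k) ℚ.≤ 1ℚ ℚ.+ (step k ℚ.+ step k)
    E-step k = begin
      E (step k) (2 ℕ.+ k)
        ≡⟨ cong (E (step k)) (ℕ.+-comm 1 (suc k)) ⟩
      E (step k) (suc k ℕ.+ 1)
        ≤⟨ E-≤ (0≤step k) 1 (ℚ.≤-trans (ℚ.+-mono-≤ (step≤1 k) (step≤1 k)) (ℚ.≤-reflexive 1+1≡ι2)) (suc k) ⟩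
      E (step k) 1 ℚ.+ (e (step k) 1 ℚ.+ e (step k) 1)
        ≡⟨ cong₂ (λ p q → p ℚ.+ (q ℚ.+ q)) (E-1 (step k)) (e-1 (step k)) ⟩
      1ℚ ℚ.+ (step k ℚ.+ step k)  ∎
      where
      1+1≡ι2 : 1ℚ ℚ.+ 1ℚ ≡ ι 2
      1+1≡ι2 = sym (trans (ι-suc 1) (cong (1ℚ ℚ.+_) ι-1))

    below : ∀ n k → N ℕ.≤ 2 ℕ.+ k → N ℕ.≤ n → step k ℚ.≤ η → μ ℚ.≤ E (log k) n ℚ.+ ε
    below n k N≤2+k N≤n step≤η = begin
      μ
        ≤⟨ ℚ.<⇒≤ (<-E-log k) ⟩
      E (log k ℚ.+ step k) (2 ℕ.+ k)
        ≤⟨ E-+-≤ (0≤log k) (0≤step k) (2 ℕ.+ k) ⟩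
      X ℚ.* E (step k) (2 ℕ.+ k)
        ≤⟨ *-monoʳ-≤ (E-nonNeg (0≤log k) (2 ℕ.+ k)) (E-step k) ⟩
      X ℚ.* (1ℚ ℚ.+ (step k ℚ.+ step k))
        ≡⟨ solve 2 (λ x s → x :* (con 1ℚ :+ (s :+ s)) := x :+ (s :+ s) :* x) refl X (step k) ⟩
      X ℚ.+ (step k ℚ.+ step k) ℚ.* X
        ≤⟨ ℚ.+-mono-≤ (proj₂ (E-log-cauchy 0<τ) k N≤n N≤2+k)
             (*-mono-≤ (0≤+ (0≤step k) (0≤step k)) (ℚ.+-mono-≤ step≤η step≤η) (E-nonNeg (0≤log k) (2 ℕ.+ k)) (E-log-≤ k)) ⟩
      E (log k) n ℚ.+ τ ℚ.+ (η ℚ.+ η) ℚ.* μ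
        ≡⟨ cong (E (log k) n ℚ.+ τ ℚ.+_) (trans (ℚ.*-distribʳ-+ μ η η) (trans (cong₂ ℚ._+_ η*μ η*μ) (½+½ τ))) ⟩
      E (log k) n ℚ.+ τ ℚ.+ τ
        ≡⟨ trans (ℚ.+-assoc (E (log k) n) τ τ) (cong (E (log k) n ℚ.+_) (½+½ ε)) ⟩
      E (log k) n ℚ.+ ε  ∎
      where X = E (log k) (2 ℕ.+ k)

  exp-*-log : ∀ j → (λ (n , k) → E (ι j ℚ.* log k) n) Lim².∼ (λ _ → μ ^ℚ j)
  -- The limit 1 is attained from n = 1 on; the sum with no terms is 0.
  exp-*-log zero ε 0<ε = 1 , λ n 1≤n → 0 , λ k _ → subst (ℚ._≤ ε) (sym (zero≡ n 1≤n k)) (ℚ.<⇒≤ 0<ε)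
    where
    zero≡ : ∀ n → 1 ℕ.≤ n → ∀ k → ℚ.∣ E (ι 0 ℚ.* log k) n ℚ.- 1ℚ ∣ ≡ 0ℚ
    zero≡ (suc n) _ k = cong (λ r → ℚ.∣ r ℚ.- 1ℚ ∣)
      (trans (cong (λ x → E x (suc n)) (trans (cong (ℚ._* log k) ι-0) (ℚ.*-zeroˡ (log k)))) (E-zero n))
  exp-*-log (suc j) = Lim².∼-trans {u = λ (n , k) → E (ι (suc j) ℚ.* log k) n} {v = λ (n , k) → E (log k) n ℚ.* E (x k) n}
    {w = λ _ → μ ^ℚ suc j} product
    (Lim².∼-* {u = λ (n , k) → E (log k) n} {u′ = λ _ → μ} {v = λ (n , k) → E (x k) n} {v′ = λ _ → μ ^ℚ j}
      (Lim².bounded-const μ) (Lim².∼-bounded {v = λ _ → μ ^ℚ j} (exp-*-log j) (Lim².bounded-const (μ ^ℚ j))) exp-log (exp-*-log j))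
    where
    K = ι (suc j) ℚ.* μ
    x : ℕ → ℚ
    x k = ι j ℚ.* log k
    0≤x : ∀ k → 0ℚ ℚ.≤ x k
    0≤x k = 0≤* (0≤ι j) (0≤log k)
    split : ∀ k → ι (suc j) ℚ.* log k ≡ log k ℚ.+ x k
    split k = trans (cong (ℚ._* log k) (ι-suc j))
      (solve 2 (λ j l → (con 1ℚ :+ j) :* l := l :+ j :* l) refl (ι j) (log k))
      where open +-*-Solver
    0≤s : ∀ k → 0ℚ ℚ.≤ log k ℚ.+ x k
    0≤s k = 0≤+ (0≤log k) (0≤x k)
    s≤K : ∀ k → log k ℚ.+ x k ℚ.≤ K
    s≤K k = subst (ℚ._≤ K) (split k) (*-monoʳ-≤ (0≤ι (suc j)) (log≤ k))

    -- The product is squeezed between the sums with n and with 2n terms. These agree up to ε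
    -- uniformly in k, since all arguments lie in [0, K].
    product : (λ (n , k) → E (ι (suc j) ℚ.* log k) n) Lim².∼ (λ (n , k) → E (log k) n ℚ.* E (x k) n)
    product ε 0<ε = N , λ n N≤n → 0 , λ k _ →
      subst (λ y → ℚ.∣ E y n ℚ.- E (log k) n ℚ.* E (x k) n ∣ ℚ.≤ ε) (sym (split k))
        (-p≤q∧p≤q⇒∣p∣≤q
          (≤-offset _ (p≤q⇒0≤q-p (ℚ.≤-trans (E-*-≤ (0≤log k) (0≤x k) n n)
              (near (0≤s k) (s≤K k) N≤n (ℕ.m≤m+n n n))))
            (solve 3 (λ a b ε → :- (a :- b) :+ (a :+ ε :- b) := ε) refl
              (E (log k ℚ.+ x k) n) (E (log k) n ℚ.* E (x k) n) ε))
          (≤-offset _ (0≤+ (p≤q⇒0≤q-p (E-+-≤ (0≤log k) (0≤x k) n)) (ℚ.<⇒≤ 0<ε))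
            (solve 3 (λ a b ε → a :- b :+ (b :- a :+ ε) := ε) refl
              (E (log k ℚ.+ x k) n) (E (log k) n ℚ.* E (x k) n) ε)))
      where
      open +-*-Solver
      cauchy-K : ∃[ N ] (∀ {x} → 0ℚ ℚ.≤ x → x ℚ.≤ K → ∀ {m n} → N ℕ.≤ m → m ℕ.≤ n → E x n ℚ.≤ E x m ℚ.+ ε)
      cauchy-K = E-uniformly-cauchy (0≤* (0≤ι (suc j)) 0≤μ) 0<ε
      N = proj₁ cauchy-K
      near = proj₂ cauchy-K

-- The ring of complex numbers

≈ᴿ⇒∼ : ∀ {x y} → x ≈ᴿ y → seq x Lim.∼ seq y
≈ᴿ⇒∼ x≈y ε 0<ε = proj₁ (x≈y ε 0<ε) , λ n N≤n → ℚ.<⇒≤ (proj₂ (x≈y ε 0<ε) n N≤n)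

∼⇒≈ᴿ : ∀ {x y} → seq x Lim.∼ seq y → x ≈ᴿ y
∼⇒≈ᴿ x∼y ε 0<ε = proj₁ (x∼y (ℚ.½ ℚ.* ε) (½* 0<ε))
  , λ n N≤n → ℚ.≤-<-trans (proj₂ (x∼y (ℚ.½ ℚ.* ε) (½* 0<ε)) n N≤n) (½*-< 0<ε)

seq-bounded : ∀ x → Lim.Bounded (seq x)
seq-bounded x = cauchy⇒bounded (cauchy x)

-- The ring laws hold term by term on the representing sequences, where they are polynomial
-- identities over ℚ; an ε is needed only for the equivalence and congruence laws.
_≐_ : ℝ → ℝ → Set
x ≐ y = ∀ n → seq x n ≡ seq y n

≐⇒≈ᴿ : ∀ {x y} → x ≐ y → x ≈ᴿ y
≐⇒≈ᴿ {x} {y} x≐y = ∼⇒≈ᴿ {x} {y} (Lim.∼-reflexive x≐y)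

≐⇒≈ : ∀ {z w} → re z ≐ re w → im z ≐ im w → z ≈ w
≐⇒≈ {z} {w} r i = ≐⇒≈ᴿ {re z} {re w} r , ≐⇒≈ᴿ {im z} {im w} i

+ᴿ-cong : ∀ {x x′ y y′} → x ≈ᴿ x′ → y ≈ᴿ y′ → (x +ᴿ y) ≈ᴿ (x′ +ᴿ y′)
+ᴿ-cong {x} {x′} {y} {y′} p q = ∼⇒≈ᴿ {x +ᴿ y} {x′ +ᴿ y′}
  (Lim.∼-+ {seq x} {seq x′} {seq y} {seq y′} (≈ᴿ⇒∼ {x} {x′} p) (≈ᴿ⇒∼ {y} {y′} q))

-ᴿ-cong : ∀ {x y} → x ≈ᴿ y → (-ᴿ x) ≈ᴿ (-ᴿ y)
-ᴿ-cong {x} {y} p = ∼⇒≈ᴿ { -ᴿ x} { -ᴿ y} (Lim.∼-neg {seq x} {seq y} (≈ᴿ⇒∼ {x} {y} p))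

*ᴿ-cong : ∀ {x x′ y y′} → x ≈ᴿ x′ → y ≈ᴿ y′ → (x *ᴿ y) ≈ᴿ (x′ *ᴿ y′)
*ᴿ-cong {x} {x′} {y} {y′} p q = ∼⇒≈ᴿ {x *ᴿ y} {x′ *ᴿ y′}
  (Lim.∼-* {seq x} {seq x′} {seq y} {seq y′} (seq-bounded x′) (seq-bounded y) (≈ᴿ⇒∼ {x} {x′} p) (≈ᴿ⇒∼ {y} {y′} q))

≈ᴿ-refl : ∀ {x} → x ≈ᴿ x
≈ᴿ-refl {x} = ≐⇒≈ᴿ {x} {x} (λ _ → refl)

≈ᴿ-sym : ∀ {x y} → x ≈ᴿ y → y ≈ᴿ x
≈ᴿ-sym {x} {y} p = ∼⇒≈ᴿ {y} {x} (Lim.∼-sym {seq x} {seq y} (≈ᴿ⇒∼ {x} {y} p))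

≈ᴿ-trans : ∀ {x y z} → x ≈ᴿ y → y ≈ᴿ z → x ≈ᴿ z
≈ᴿ-trans {x} {y} {z} p q = ∼⇒≈ᴿ {x} {z} (Lim.∼-trans {seq x} {seq y} {seq z} (≈ᴿ⇒∼ {x} {y} p) (≈ᴿ⇒∼ {y} {z} q))

opaque
  ℂ-isCommutativeRing : IsCommutativeRing _≈_ _+_ _*_ -_ 0# 1#
  ℂ-isCommutativeRing = record
    { isRing = record
      { +-isAbelianGroup = record
        { isGroup = record
          { isMonoid = record
            { isSemigroup = record
              { isMagma = record
                { isEquivalence = record
                  { refl  = λ {z} → ≈ᴿ-refl {re z} , ≈ᴿ-refl {im z}
                  ; sym   = λ {z} {w} (p , q) → ≈ᴿ-sym {re z} {re w} p , ≈ᴿ-sym {im z} {im w} q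
                  ; trans = λ {z} {w} {v} (p , q) (p′ , q′) →
                      ≈ᴿ-trans {re z} {re w} {re v} p p′ , ≈ᴿ-trans {im z} {im w} {im v} q q′
                  }
                ; ∙-cong = λ {z} {z′} {w} {w′} (p , q) (p′ , q′) →
                    +ᴿ-cong {re z} {re z′} {re w} {re w′} p p′ , +ᴿ-cong {im z} {im z′} {im w} {im w′} q q′
                }
              ; assoc = λ z w v → ≐⇒≈ {z + w + v} {z + (w + v)}
                  (λ n → ℚ.+-assoc (re z ‼ n) (re w ‼ n) (re v ‼ n)) (λ n → ℚ.+-assoc (im z ‼ n) (im w ‼ n) (im v ‼ n))
              }
            ; identity = (λ z → ≐⇒≈ {0# + z} {z} (λ n → ℚ.+-identityˡ (re z ‼ n)) (λ n → ℚ.+-identityˡ (im z ‼ n)))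
                , (λ z → ≐⇒≈ {z + 0#} {z} (λ n → ℚ.+-identityʳ (re z ‼ n)) (λ n → ℚ.+-identityʳ (im z ‼ n)))
            }
          ; inverse = (λ z → ≐⇒≈ { - z + z} {0#} (λ n → ℚ.+-inverseˡ (re z ‼ n)) (λ n → ℚ.+-inverseˡ (im z ‼ n)))
              , (λ z → ≐⇒≈ {z + - z} {0#} (λ n → ℚ.+-inverseʳ (re z ‼ n)) (λ n → ℚ.+-inverseʳ (im z ‼ n)))
          ; ⁻¹-cong = λ {z} {w} (p , q) → -ᴿ-cong {re z} {re w} p , -ᴿ-cong {im z} {im w} q
          }
        ; comm = λ z w → ≐⇒≈ {z + w} {w + z}
            (λ n → ℚ.+-comm (re z ‼ n) (re w ‼ n)) (λ n → ℚ.+-comm (im z ‼ n) (im w ‼ n))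
        }
      ; *-cong = λ {z} {z′} {w} {w′} → *-cong {z} {z′} {w} {w′}
      ; *-assoc = λ z w v → ≐⇒≈ {z * w * v} {z * (w * v)}
          (λ n → solve 6 (λ a b c d e f → (a :* c :+ :- (b :* d)) :* e :+ :- ((a :* d :+ b :* c) :* f)
                                       := a :* (c :* e :+ :- (d :* f)) :+ :- (b :* (c :* f :+ d :* e)))
                   refl (re z ‼ n) (im z ‼ n) (re w ‼ n) (im w ‼ n) (re v ‼ n) (im v ‼ n))
          (λ n → solve 6 (λ a b c d e f → (a :* c :+ :- (b :* d)) :* f :+ (a :* d :+ b :* c) :* e
                                       := a :* (c :* f :+ d :* e) :+ b :* (c :* e :+ :- (d :* f)))
                   refl (re z ‼ n) (im z ‼ n) (re w ‼ n) (im w ‼ n) (re v ‼ n) (im v ‼ n))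
      ; *-identity = identityˡ , λ z → trans-≈ {z * 1#} {1# * z} {z} (*-comm z 1#) (identityˡ z)
      ; distrib = distribˡ , λ z w v → trans-≈ {(w + v) * z} {z * (w + v)} {w * z + v * z} (*-comm (w + v) z)
          (trans-≈ {z * (w + v)} {z * w + z * v} {w * z + v * z} (distribˡ z w v)
            (≐⇒≈ {z * w + z * v} {w * z + v * z}
              (λ n → solve 6 (λ a b c d e f → (a :* c :+ :- (b :* d)) :+ (a :* e :+ :- (b :* f))
                                           := (c :* a :+ :- (d :* b)) :+ (e :* a :+ :- (f :* b)))
                       refl (re z ‼ n) (im z ‼ n) (re w ‼ n) (im w ‼ n) (re v ‼ n) (im v ‼ n))
              (λ n → solve 6 (λ a b c d e f → (a :* d :+ b :* c) :+ (a :* f :+ b :* e)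
                                           := (c :* b :+ d :* a) :+ (e :* b :+ f :* a))
                       refl (re z ‼ n) (im z ‼ n) (re w ‼ n) (im w ‼ n) (re v ‼ n) (im v ‼ n))))
      }
    ; *-comm = *-comm
    }
    where
    open +-*-Solver
    _‼_ : ℝ → ℕ → ℚ
    _‼_ = seq
    *-comm : ∀ z w → z * w ≈ w * z
    *-comm z w = ≐⇒≈ {z * w} {w * z}
      (λ n → solve 4 (λ a b c d → a :* c :+ :- (b :* d) := c :* a :+ :- (d :* b))
               refl (re z ‼ n) (im z ‼ n) (re w ‼ n) (im w ‼ n))
      (λ n → solve 4 (λ a b c d → a :* d :+ b :* c := c :* b :+ d :* a)
               refl (re z ‼ n) (im z ‼ n) (re w ‼ n) (im w ‼ n))
    identityˡ : ∀ z → 1# * z ≈ z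
    identityˡ z = ≐⇒≈ {1# * z} {z}
      (λ n → solve 2 (λ a b → con 1ℚ :* a :+ :- (con 0ℚ :* b) := a) refl (re z ‼ n) (im z ‼ n))
      (λ n → solve 2 (λ a b → con 1ℚ :* b :+ con 0ℚ :* a := b) refl (re z ‼ n) (im z ‼ n))
    trans-≈ : ∀ {z w v} → z ≈ w → w ≈ v → z ≈ v
    trans-≈ {z} {w} {v} (p , q) (p′ , q′) =
      ≈ᴿ-trans {re z} {re w} {re v} p p′ , ≈ᴿ-trans {im z} {im w} {im v} q q′
    distribˡ : ∀ z w v → z * (w + v) ≈ z * w + z * v
    distribˡ z w v = ≐⇒≈ {z * (w + v)} {z * w + z * v}
      (λ n → solve 6 (λ a b c d e f → a :* (c :+ e) :+ :- (b :* (d :+ f))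
                                   := (a :* c :+ :- (b :* d)) :+ (a :* e :+ :- (b :* f)))
               refl (re z ‼ n) (im z ‼ n) (re w ‼ n) (im w ‼ n) (re v ‼ n) (im v ‼ n))
      (λ n → solve 6 (λ a b c d e f → a :* (d :+ f) :+ b :* (c :+ e)
                                   := (a :* d :+ b :* c) :+ (a :* f :+ b :* e))
               refl (re z ‼ n) (im z ‼ n) (re w ‼ n) (im w ‼ n) (re v ‼ n) (im v ‼ n))
    *-cong : ∀ {z z′ w w′} → z ≈ z′ → w ≈ w′ → z * w ≈ z′ * w′
    *-cong {z} {z′} {w} {w′} (p , q) (p′ , q′) =
        +ᴿ-cong {re z *ᴿ re w} {re z′ *ᴿ re w′} { -ᴿ (im z *ᴿ im w)} { -ᴿ (im z′ *ᴿ im w′)}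
          (*ᴿ-cong {re z} {re z′} {re w} {re w′} p p′)
          (-ᴿ-cong {im z *ᴿ im w} {im z′ *ᴿ im w′} (*ᴿ-cong {im z} {im z′} {im w} {im w′} q q′))
      , +ᴿ-cong {re z *ᴿ im w} {re z′ *ᴿ im w′} {im z *ᴿ re w} {im z′ *ᴿ re w′}
          (*ᴿ-cong {re z} {re z′} {im w} {im w′} p q′)
          (*ᴿ-cong {im z} {im z′} {re w} {re w′} q p′)

ℂ-commutativeRing : CommutativeRing 0ℓ 0ℓ
ℂ-commutativeRing = record { isCommutativeRing = ℂ-isCommutativeRing }

module ℂ-Ring = CommutativeRing ℂ-commutativeRing

-- The operations of ℂ unfold to pairs of Cauchy sequences; algebra is done with
-- opaque copies of them, which do not.
infix  4 _≈ᶜ_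
infixl 6 _+ᶜ_
infixl 7 _*ᶜ_
infix  8 -ᶜ_

opaque
  _≈ᶜ_ : ℂ → ℂ → Set
  _≈ᶜ_ = _≈_

  _+ᶜ_ _*ᶜ_ : ℂ → ℂ → ℂ
  _+ᶜ_ = _+_
  _*ᶜ_ = _*_

  -ᶜ_ : ℂ → ℂ
  -ᶜ_ = -_

  isCommutativeRingᶜ : IsCommutativeRing _≈ᶜ_ _+ᶜ_ _*ᶜ_ -ᶜ_ 0# 1#
  isCommutativeRingᶜ = ℂ-isCommutativeRing

  ℚ→ℂ-homo-+ : ∀ p q → ℚ→ℂ (p ℚ.+ q) ≈ᶜ ℚ→ℂ p +ᶜ ℚ→ℂ q
  ℚ→ℂ-homo-+ p q = ≐⇒≈ {ℚ→ℂ (p ℚ.+ q)} {ℚ→ℂ p + ℚ→ℂ q} (λ _ → refl) (λ _ → refl)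

  ℚ→ℂ-homo-* : ∀ p q → ℚ→ℂ (p ℚ.* q) ≈ᶜ ℚ→ℂ p *ᶜ ℚ→ℂ q
  ℚ→ℂ-homo-* p q = ≐⇒≈ {ℚ→ℂ (p ℚ.* q)} {ℚ→ℂ p * ℚ→ℂ q}
    (λ _ → solve 2 (λ p q → p :* q := p :* q :+ :- (con 0ℚ :* con 0ℚ)) refl p q)
    (λ _ → solve 2 (λ p q → con 0ℚ := p :* con 0ℚ :+ con 0ℚ :* q) refl p q)
    where open +-*-Solver

  ℚ→ℂ-homo-neg : ∀ p → ℚ→ℂ (ℚ.- p) ≈ᶜ -ᶜ ℚ→ℂ p
  ℚ→ℂ-homo-neg p = ≐⇒≈ {ℚ→ℂ (ℚ.- p)} { - ℚ→ℂ p} (λ _ → refl) (λ _ → refl)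

commutativeRingᶜ : CommutativeRing 0ℓ 0ℓ
commutativeRingᶜ = record { isCommutativeRing = isCommutativeRingᶜ }

module ℂᶜ = CommutativeRing commutativeRingᶜ

ℚ-rawRing : RawRing 0ℓ 0ℓ
ℚ-rawRing = CommutativeRing.rawRing ℚ.+-*-commutativeRing

-- It serves twice: as coefficient map of the ring solver, and as the map `φ` that carries rational
-- exponential series into ℂ.
ℚ→ℂ-morphism : ℚ-rawRing -Raw-AlmostCommutative⟶ fromCommutativeRing commutativeRingᶜ
ℚ→ℂ-morphism = record
  { ⟦_⟧    = ℚ→ℂ
  ; +-homo = ℚ→ℂ-homo-+
  ; *-homo = ℚ→ℂ-homo-*
  ; -‿homo = ℚ→ℂ-homo-neg
  ; 0-homo = ℂᶜ.refl
  ; 1-homo = ℂᶜ.refl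
  }

-- Generating functions over a commutative ring

module Residues (a f : ℕ) (0<a : 0 ℕ.< a) (a<f : a ℕ.< f) where
  open ℕ.≤-Reasoning
  open ℕ-Solver.+-*-Solver

  instance
    f≢0 : NonZero f
    f≢0 = ℕ.>-nonZero (ℕ.<-trans 0<a a<f)

  f<a+[1+j]f+r : ∀ j r → f ℕ.< a ℕ.+ suc j ℕ.* f ℕ.+ r
  f<a+[1+j]f+r j r = begin-strict
    f                              <⟨ ℕ.m<n+m f 0<a ⟩
    a ℕ.+ f                        ≤⟨ ℕ.+-monoʳ-≤ a (ℕ.m≤m+n f (j ℕ.* f)) ⟩
    a ℕ.+ (f ℕ.+ j ℕ.* f)          ≤⟨ ℕ.m≤m+n _ r ⟩
    a ℕ.+ (f ℕ.+ j ℕ.* f) ℕ.+ r    ∎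

  a+0+0<1+n+f : ∀ n → a ℕ.+ 0 ℕ.+ 0 ℕ.< suc n ℕ.+ f
  a+0+0<1+n+f n = begin-strict
    a ℕ.+ 0 ℕ.+ 0    ≡⟨ trans (ℕ.+-identityʳ (a ℕ.+ 0)) (ℕ.+-identityʳ a) ⟩
    a                <⟨ a<f ⟩
    f                ≤⟨ ℕ.m≤n+m f (suc n) ⟩
    suc n ℕ.+ f      ∎

  -- For j = 0 the number `suc i` lies below `a`, at a distance strictly between 0 and f. Otherwise
  -- it lies above, and the distance is a multiple of f plus `suc r`, with 0 < suc r < f.
  not-congruent : ∀ i j r → suc i ℕ.+ f ≡ a ℕ.+ j ℕ.* f ℕ.+ suc r → suc r ℕ.< f → ¬ (f ∣ ℕ.∣ suc i - a ∣)
  not-congruent i zero    r 1+i≡ 1+r<f f∣ =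
    >⇒∤ {{ℕ.>-nonZero (ℕ.m<n⇒0<n∸m 1+r<f)}} (ℕ.∸-monoʳ-< {f} (ℕ.s≤s ℕ.z≤n) (ℕ.<⇒≤ 1+r<f)) (subst (f ∣_) distance f∣)
    where
    a≡ : a ≡ suc i ℕ.+ (f ∸ suc r)
    a≡ = ℕ.+-cancelʳ-≡ (suc r) a (suc i ℕ.+ (f ∸ suc r)) (begin-equality
      a ℕ.+ suc r                        ≡⟨ cong (ℕ._+ suc r) (ℕ.+-identityʳ a) ⟨
      a ℕ.+ 0 ℕ.+ suc r                  ≡⟨ 1+i≡ ⟨
      suc i ℕ.+ f                        ≡⟨ cong (suc i ℕ.+_) (ℕ.m∸n+n≡m (ℕ.<⇒≤ 1+r<f)) ⟨
      suc i ℕ.+ (f ∸ suc r ℕ.+ suc r)    ≡⟨ ℕ.+-assoc (suc i) (f ∸ suc r) (suc r) ⟨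
      suc i ℕ.+ (f ∸ suc r) ℕ.+ suc r    ∎)
    distance : ℕ.∣ suc i - a ∣ ≡ f ∸ suc r
    distance = trans (cong ℕ.∣ suc i -_∣ a≡) (ℕ.∣m-m+n∣≡n (suc i) (f ∸ suc r))
  not-congruent i (suc j) r 1+i≡ 1+r<f f∣ =
    >⇒∤ 1+r<f (∣m+n∣m⇒∣n (subst (f ∣_) distance f∣) (divides j refl))
    where
    1+i≡′ : suc i ≡ a ℕ.+ (j ℕ.* f ℕ.+ suc r)
    1+i≡′ = ℕ.+-cancelʳ-≡ f (suc i) _ (trans 1+i≡
      (solve 4 (λ a f jf r → a :+ (f :+ jf) :+ r := a :+ (jf :+ r) :+ f) refl a f (j ℕ.* f) (suc r)))
    distance : ℕ.∣ suc i - a ∣ ≡ j ℕ.* f ℕ.+ suc r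
    distance = trans (cong (λ m → ℕ.∣ m - a ∣) 1+i≡′)
      (trans (ℕ.∣-∣-comm (a ℕ.+ (j ℕ.* f ℕ.+ suc r)) a) (ℕ.∣m-m+n∣≡n a (j ℕ.* f ℕ.+ suc r)))

  -- `count n` is the number of members of a, a + f, a + 2f, ... that are at most n. Adding f keeps
  -- the truncated subtraction exact for n < a too, where the count is 0.
  count remainder : ℕ → ℕ
  count n = (n ℕ.+ f ∸ a) / f
  remainder n = (n ℕ.+ f ∸ a) % f

  remainder<f : ∀ n → remainder n ℕ.< f
  remainder<f n = m%n<n (n ℕ.+ f ∸ a) f

  count-remainder : ∀ n → n ℕ.+ f ≡ a ℕ.+ count n ℕ.* f ℕ.+ remainder n
  count-remainder n = begin-equality
    n ℕ.+ f                                     ≡⟨ ℕ.m+[n∸m]≡n (ℕ.≤-trans (ℕ.<⇒≤ a<f) (ℕ.m≤n+m f n)) ⟨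
    a ℕ.+ (n ℕ.+ f ∸ a)                         ≡⟨ cong (a ℕ.+_) (trans (m≡m%n+[m/n]*n (n ℕ.+ f ∸ a) f) (ℕ.+-comm (remainder n) _)) ⟩
    a ℕ.+ (count n ℕ.* f ℕ.+ remainder n)       ≡⟨ ℕ.+-assoc a (count n ℕ.* f) (remainder n) ⟨
    a ℕ.+ count n ℕ.* f ℕ.+ remainder n         ∎

  count→∞ : ∀ J → ∃[ N ] (∀ n → N ℕ.≤ n → J ℕ.≤ count n)
  count→∞ J = J ℕ.* f , λ n Jf≤n → subst (ℕ._≤ count n) (m*n/n≡m J f)
    (/-monoˡ-≤ f (ℕ.≤-trans Jf≤n (subst (n ℕ.≤_) (sym (ℕ.+-∸-assoc n (ℕ.<⇒≤ a<f))) (ℕ.m≤m+n n (f ∸ a)))))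

^-*-e : ∀ x y k → (x ℚ.* y) ^ℚ k ≡ x ^ℚ k ℚ.* ι (k !) ℚ.* e y k
^-*-e x y k = begin
  (x ℚ.* y) ^ℚ k
    ≡⟨ ^-distrib-* x y k ⟩
  x ^ℚ k ℚ.* y ^ℚ k
    ≡⟨ cong (x ^ℚ k ℚ.*_) (trans (cong (y ^ℚ k ℚ.*_) (1/!*! k)) (ℚ.*-identityʳ (y ^ℚ k))) ⟨
  x ^ℚ k ℚ.* (y ^ℚ k ℚ.* (1/! k ℚ.* ι (k !)))
    ≡⟨ solve 4 (λ a b c d → a :* (b :* (c :* d)) := a :* d :* (b :* c)) refl (x ^ℚ k) (y ^ℚ k) (1/! k) (ι (k !)) ⟩
  x ^ℚ k ℚ.* ι (k !) ℚ.* e y k  ∎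
  where
  open ≡-Reasoning
  open +-*-Solver
  open Algebra.Properties.CommutativeSemiring.Exp (CommutativeRing.commutativeSemiring ℚ.+-*-commutativeRing)
    using (^-distrib-*)

-- Everything here is algebra over a ring with a map from ℚ. Analysis enters only through the
-- closure properties collected in `Submodule` and `Nullity`.
module GeneratingFunction {c ℓ} (R : CommutativeRing c ℓ)
  (morphism : ℚ-rawRing -Raw-AlmostCommutative⟶ fromCommutativeRing R) where

  private
    module R = CommutativeRing R
    module φ = _-Raw-AlmostCommutative⟶_ morphism
  open Convolution R public
  open import Algebra.Properties.Semiring.Exp R.semiring
    using (^-homo-*; ^-assocʳ; ^-congˡ) renaming (_^_ to _^ᴿ_)
  open import Relation.Binary.Reasoning.Setoid R.setoid
  open Algebra.Solver.Ring ℚ-rawRing (fromCommutativeRing R) morphism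
    (λ p q → Maybe.map (λ p≡q → R.reflexive (cong φ.⟦_⟧ p≡q)) (dec⇒maybe (p ℚ.≟ q)))

  φ : ℚ → R.Carrier
  φ = φ.⟦_⟧

  φ-cong : ∀ {p q} → p ≡ q → φ p R.≈ φ q
  φ-cong p≡q = R.reflexive (cong φ p≡q)

  φ-∑ : ∀ n F → φ (∑ℚ n F) R.≈ ∑ n (φ ∘ F)
  φ-∑ zero    F = φ.0-homo
  φ-∑ (suc n) F = R.trans (φ.+-homo (F 0) (∑ℚ n (F ∘ suc))) (R.+-congˡ (φ-∑ n (F ∘ suc)))

  φ-⋆ : ∀ F G n → φ ((F ⋆ℚ G) n) R.≈ ((φ ∘ F) ⋆ (φ ∘ G)) n
  φ-⋆ F G n = R.trans (φ-∑ (suc n) (λ k → F k ℚ.* G (n ∸ k)))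
    (∑-cong (suc n) (λ k → φ.*-homo (F k) (G (n ∸ k))))

  φ-^ : ∀ p k → φ (p ^ℚ k) R.≈ φ p ^ᴿ k
  φ-^ p zero    = φ.1-homo
  φ-^ p (suc k) = R.trans (φ.*-homo p (p ^ℚ k)) (R.*-congˡ (φ-^ p k))

  -- Just enough structure on a property of sequences to solve a triangular linear system. The
  -- instances are being null and being convergent.
  record Submodule {p} (Q : (ℕ → R.Carrier) → Set p) : Set (c Level.⊔ ℓ Level.⊔ p) where
    field
      resp : ∀ {u v} → (∀ n → u n R.≈ v n) → Q u → Q v
      add  : ∀ {u v} → Q u → Q v → Q (λ n → u n R.+ v n)
      mul  : ∀ x {u} → Q u → Q (λ n → x R.* u n)

    closed-⋆ : ∀ G (X : ℕ → ℕ → R.Carrier) k → (∀ i → i ℕ.≤ k → Q (λ N → X N i)) → Q (λ N → (G ⋆ X N) k)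
    closed-⋆ G X zero    QX = resp (λ N → R.sym (R.+-identityʳ (G 0 R.* X N 0))) (mul (G 0) (QX 0 ℕ.≤-refl))
    closed-⋆ G X (suc k) QX = add (mul (G 0) (QX (suc k) ℕ.≤-refl))
      (closed-⋆ (G ∘ suc) X k (λ i i≤k → QX i (ℕ.m≤n⇒m≤1+n i≤k)))

    -- Division by a power series with invertible constant term.
    closed-÷ : ∀ A u → u R.* A 0 R.≈ R.1# → ∀ (X : ℕ → ℕ → R.Carrier) →
      (∀ k → Q (λ N → (A ⋆ X N) k)) → ∀ k → Q (λ N → X N k)
    closed-÷ A u uA₀≈1 X QAX k = upTo k k ℕ.≤-refl
      where
      -- Strong induction: the coefficient at k + 1 is `u` times the difference of
      -- `(A ⋆ X N) (suc k)` and a convolution in which only the coefficients up to k of `X N`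
      -- occur.
      upTo : ∀ k i → i ℕ.≤ k → Q (λ N → X N i)
      upTo zero zero _ = resp
        (λ N → begin
          u R.* (A 0 R.* X N 0 R.+ R.0#)  ≈⟨ R.*-congˡ (R.+-identityʳ _) ⟩
          u R.* (A 0 R.* X N 0)           ≈⟨ R.*-assoc _ _ _ ⟨
          u R.* A 0 R.* X N 0             ≈⟨ R.*-congʳ uA₀≈1 ⟩
          R.1# R.* X N 0                  ≈⟨ R.*-identityˡ _ ⟩
          X N 0                           ∎)
        (mul u (QAX 0))
      upTo (suc k) i i≤1+k = case ℕ.m≤n⇒m<n∨m≡n i≤1+k of λ where
        (inj₁ i<1+k) → upTo k i (ℕ.≤-pred i<1+k)
        (inj₂ refl)  → resp
          (λ N → begin
            u R.* (A 0 R.* X N (suc k) R.+ ((A ∘ suc) ⋆ X N) k R.+ R.- R.1# R.* ((A ∘ suc) ⋆ X N) k)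
              -- The solver takes constants only as images of rationals.
              ≈⟨ R.*-congˡ (R.+-congˡ (R.*-congʳ (R.-‿cong φ.1-homo))) ⟨
            u R.* (A 0 R.* X N (suc k) R.+ ((A ∘ suc) ⋆ X N) k R.+ R.- φ 1ℚ R.* ((A ∘ suc) ⋆ X N) k)
              ≈⟨ solve 4 (λ u a x y → u :* (a :* x :+ y :+ :- con 1ℚ :* y) := u :* a :* x)
                   R.refl u (A 0) (X N (suc k)) (((A ∘ suc) ⋆ X N) k) ⟩
            u R.* A 0 R.* X N (suc k)
              ≈⟨ R.*-congʳ uA₀≈1 ⟩
            R.1# R.* X N (suc k)
              ≈⟨ R.*-identityˡ _ ⟩
            X N (suc k)  ∎)
          (mul u (add (QAX (suc k)) (mul (R.- R.1#) (closed-⋆ (A ∘ suc) X k (upTo k)))))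

  -- `null-const` is uniqueness of limits; it turns an asymptotic identity between constants into an
  -- equality.
  record Nullity : Set (Level.suc 0ℓ Level.⊔ c Level.⊔ ℓ) where
    field
      Null       : (ℕ → R.Carrier) → Set
      submodule  : Submodule Null
      null-const : ∀ {x} → Null (λ _ → x) → x R.≈ R.0#
      null-0     : Null (λ _ → R.0#)

    open Submodule submodule public

    Converges : (ℕ → R.Carrier) → Set c
    Converges u = ∃[ L ] Null (λ n → u n R.- L)

    convergent : Submodule Converges
    convergent = record
      { resp = λ {u} {v} u≈v (L , uL) → L , resp (λ n → R.+-congʳ (u≈v n)) uL
      ; add  = λ {u} {v} (L , uL) (M , vM) → L R.+ M , resp
          (λ n → solve 4 (λ u v l m → u :- l :+ (v :- m) := u :+ v :- (l :+ m)) R.refl (u n) (v n) L M)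
          (add uL vM)
      ; mul  = λ x {u} (L , uL) → x R.* L , resp
          (λ n → solve 3 (λ x u l → x :* (u :- l) := x :* u :- x :* l) R.refl x (u n) L)
          (mul x uL)
      }

  shift : (ℕ → R.Carrier) → ℕ → R.Carrier
  shift F zero    = R.0#
  shift F (suc k) = F k

  shift-cong : ∀ {F G} → (∀ k → F k R.≈ G k) → ∀ k → shift F k R.≈ shift G k
  shift-cong F≈G zero    = R.refl
  shift-cong F≈G (suc k) = F≈G k

  ⋆-shift : ∀ G F k → (G ⋆ shift F) k R.≈ shift (G ⋆ F) k
  ⋆-shift G F zero    = R.trans (R.+-identityʳ _) (R.zeroʳ (G 0))
  ⋆-shift G F (suc k) = begin
    (G ⋆ shift F) (suc k)                  ≈⟨ ⋆-last G (shift F) k ⟩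
    (G ⋆ F) k R.+ G (suc k) R.* R.0#       ≈⟨ R.+-congˡ (R.zeroʳ _) ⟩
    (G ⋆ F) k R.+ R.0#                     ≈⟨ R.+-identityʳ _ ⟩
    (G ⋆ F) k                              ∎

  [t+_] : R.Carrier → (ℕ → R.Carrier) → ℕ → R.Carrier
  [t+ x ] F k = shift F k R.+ x R.* F k

  [t+]-cong : ∀ x {F G} → (∀ k → F k R.≈ G k) → ∀ k → [t+ x ] F k R.≈ [t+ x ] G k
  [t+]-cong x F≈G k = R.+-cong (shift-cong F≈G k) (R.*-congˡ (F≈G k))

  ⋆-[t+] : ∀ x G F k → (G ⋆ [t+ x ] F) k R.≈ [t+ x ] (G ⋆ F) k
  ⋆-[t+] x G F k = R.trans (⋆-distribˡ-+ G (shift F) (λ j → x R.* F j) k)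
    (R.+-cong (⋆-shift G F k) (⋆-*ʳ x G F k))

  [t+]-⋆ : ∀ x T F → T 0 R.≈ x → T 1 R.≈ R.1# → (∀ k → T (suc (suc k)) R.≈ R.0#) →
    ∀ k → (T ⋆ F) k R.≈ [t+ x ] F k
  [t+]-⋆ x T F T₀ T₁ T₂ zero    = begin
    T 0 R.* F 0 R.+ R.0#     ≈⟨ R.+-comm _ _ ⟩
    R.0# R.+ T 0 R.* F 0     ≈⟨ R.+-congˡ (R.*-congʳ T₀) ⟩
    R.0# R.+ x R.* F 0       ∎
  [t+]-⋆ x T F T₀ T₁ T₂ (suc k) = begin
    T 0 R.* F (suc k) R.+ ((T ∘ suc) ⋆ F) k   ≈⟨ R.+-cong (R.*-congʳ T₀) (⋆-constantˡ (T ∘ suc) F T₂ k) ⟩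
    x R.* F (suc k) R.+ T 1 R.* F k           ≈⟨ R.+-congˡ (R.trans (R.*-congʳ T₁) (R.*-identityˡ _)) ⟩
    x R.* F (suc k) R.+ F k                   ≈⟨ R.+-comm _ _ ⟩
    F k R.+ x R.* F (suc k)                   ∎

  module Truncation (w : R.Carrier) (z : ℚ) where

    V P : ℕ → ℕ → R.Carrier
    V N k = w ^ᴿ N R.* φ (e (z ℚ.+ ι N) k)
    P zero    k = R.0#
    P (suc N) k = P N k R.+ V N k

  -- The partial sums P of Σ_j wʲ e^{t(z + j)} satisfy (w eᵗ - 1) P_N = w^N e^{t(z + N)} - e^{tz},
  -- which determines their limit as a power series.
  module PartialSums (w u : R.Carrier) (u*[1-w]≈1 : u R.* (φ 1ℚ R.- w) R.≈ R.1#) (z : ℚ) where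

    open Truncation w z

    δ : ℕ → R.Carrier
    δ zero    = R.- φ 1ℚ
    δ (suc _) = R.0#

    -- The coefficients of w eᵗ - 1, with `δ` as the constant series -1.
    A : ℕ → R.Carrier
    A k = w R.* φ (e 1ℚ k) R.+ δ k

    [-u]*A₀≈1 : R.- u R.* A 0 R.≈ R.1#
    [-u]*A₀≈1 = begin
      R.- u R.* (w R.* φ (e 1ℚ 0) R.+ R.- φ 1ℚ)
        ≈⟨ R.*-congˡ (R.+-congʳ (R.*-congˡ (φ-cong (e-0 1ℚ)))) ⟩
      R.- u R.* (w R.* φ 1ℚ R.+ R.- φ 1ℚ)
        ≈⟨ solve 2 (λ u w → :- u :* (w :* con 1ℚ :+ :- con 1ℚ) := u :* (con 1ℚ :- w)) R.refl u w ⟩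
      u R.* (φ 1ℚ R.- w)
        ≈⟨ u*[1-w]≈1 ⟩
      R.1#  ∎

    A⋆ : ∀ F k → (A ⋆ F) k R.≈ w R.* ((φ ∘ e 1ℚ) ⋆ F) k R.- F k
    A⋆ F k = begin
      (A ⋆ F) k
        ≈⟨ ⋆-distribʳ-+ (λ j → w R.* φ (e 1ℚ j)) δ F k ⟩
      ((λ j → w R.* φ (e 1ℚ j)) ⋆ F) k R.+ (δ ⋆ F) k
        ≈⟨ R.+-cong (⋆-*ˡ w (φ ∘ e 1ℚ) F k) (⋆-constantˡ δ F (λ _ → R.refl) k) ⟩
      w R.* ((φ ∘ e 1ℚ) ⋆ F) k R.+ R.- φ 1ℚ R.* F k
        ≈⟨ R.+-congˡ (solve 1 (λ x → :- con 1ℚ :* x := :- x) R.refl (F k)) ⟩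
      w R.* ((φ ∘ e 1ℚ) ⋆ F) k R.- F k  ∎

    V₀ : ∀ k → V 0 k R.≈ φ (e z k)
    V₀ k = R.trans (R.*-identityˡ _) (φ-cong (cong (λ x → e x k) (trans (cong (z ℚ.+_) ι-0) (ℚ.+-identityʳ z))))

    -- The factor eᵗ moves the base point z + N to z + N + 1, by the addition formula over ℚ carried
    -- along `φ`. Hence `A⋆P` telescopes.
    A⋆V : ∀ N k → (A ⋆ V N) k R.≈ V (suc N) k R.- V N k
    A⋆V N k = begin
      (A ⋆ V N) k
        ≈⟨ A⋆ (V N) k ⟩
      w R.* ((φ ∘ e 1ℚ) ⋆ V N) k R.- V N k
        ≈⟨ R.+-congʳ (R.*-congˡ (⋆-*ʳ (w ^ᴿ N) (φ ∘ e 1ℚ) (φ ∘ e (z ℚ.+ ι N)) k)) ⟩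
      w R.* (w ^ᴿ N R.* ((φ ∘ e 1ℚ) ⋆ (φ ∘ e (z ℚ.+ ι N))) k) R.- V N k
        ≈⟨ R.+-congʳ (R.*-assoc _ _ _) ⟨
      w ^ᴿ suc N R.* ((φ ∘ e 1ℚ) ⋆ (φ ∘ e (z ℚ.+ ι N))) k R.- V N k
        ≈⟨ R.+-congʳ (R.*-congˡ (φ-⋆ (e 1ℚ) (e (z ℚ.+ ι N)) k)) ⟨
      w ^ᴿ suc N R.* φ ((e 1ℚ ⋆ℚ e (z ℚ.+ ι N)) k) R.- V N k
        ≈⟨ R.+-congʳ (R.*-congˡ (φ-cong (trans (sym (e-+ 1ℚ (z ℚ.+ ι N) k)) (cong (λ x → e x k) 1+z+N)))) ⟩
      V (suc N) k R.- V N k  ∎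
      where
      1+z+N : 1ℚ ℚ.+ (z ℚ.+ ι N) ≡ z ℚ.+ ι (suc N)
      1+z+N = trans (sym (ℚ.+-assoc 1ℚ z (ι N))) (trans (cong (ℚ._+ ι N) (ℚ.+-comm 1ℚ z))
        (trans (ℚ.+-assoc z 1ℚ (ι N)) (cong (z ℚ.+_) (sym (ι-suc N)))))

    A⋆P : ∀ N k → (A ⋆ P N) k R.≈ V N k R.- V 0 k
    A⋆P zero    k = begin
      (A ⋆ (λ _ → R.0#)) k                ≈⟨ ⋆-congˡ A (λ _ → R.sym (R.zeroˡ R.0#)) k ⟩
      (A ⋆ (λ _ → R.0# R.* R.0#)) k       ≈⟨ ⋆-*ʳ R.0# A (λ _ → R.0#) k ⟩
      R.0# R.* (A ⋆ (λ _ → R.0#)) k       ≈⟨ R.zeroˡ _ ⟩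
      R.0#                                ≈⟨ R.-‿inverseʳ (V 0 k) ⟨
      V 0 k R.- V 0 k                     ∎
    A⋆P (suc N) k = begin
      (A ⋆ P (suc N)) k
        ≈⟨ ⋆-distribˡ-+ A (P N) (V N) k ⟩
      (A ⋆ P N) k R.+ (A ⋆ V N) k
        ≈⟨ R.+-cong (A⋆P N k) (A⋆V N k) ⟩
      V N k R.- V 0 k R.+ (V (suc N) k R.- V N k)
        ≈⟨ solve 3 (λ x y v → x :- y :+ (v :- x) := v :- y) R.refl (V N k) (V 0 k) (V (suc N) k) ⟩
      V (suc N) k R.- V 0 k  ∎

    module Limit (nullity : Nullity) (V-null : ∀ k → Nullity.Null nullity (λ N → V N k)) where
      open Nullity nullity
      private module Conv = Submodule convergent

      P-converges : ∀ k → Converges (λ N → P N k)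
      -- As `V N k` is null, `A ⋆ P N` tends to `- V 0 k` at k. The limit of `P N` itself is then
      -- produced by the recursion of the division.
      P-converges = Conv.closed-÷ A (R.- u) [-u]*A₀≈1 P λ k → R.- V 0 k , resp
        (λ N → begin
          V N k                                  ≈⟨ solve 2 (λ x y → x :- y :- (:- y) := x) R.refl (V N k) (V 0 k) ⟨
          V N k R.- V 0 k R.- (R.- V 0 k)        ≈⟨ R.+-congʳ (A⋆P N k) ⟨
          (A ⋆ P N) k R.- (R.- V 0 k)            ∎)
        (V-null k)

      opaque
        g : ℕ → R.Carrier
        g k = proj₁ (P-converges k)

        P→g : ∀ k → Null (λ N → P N k R.- g k)
        P→g k = proj₂ (P-converges k)

      [t+]-null : ∀ x (X : ℕ → ℕ → R.Carrier) → (∀ k → Null (λ N → X N k)) → ∀ k → Null (λ N → [t+ x ] (X N) k)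
      [t+]-null x X nX zero    = add null-0 (mul x (nX 0))
      [t+]-null x X nX (suc k) = add (nX k) (mul x (nX (suc k)))

      -- Multiplied by `A`, the series b + (t + x) P_N becomes (t + x) V_N, which is null, and
      -- division by `A` preserves this. Replacing P_N by `g` changes the series by a null sequence,
      -- and what remains is constant in N.
      quotient-≈ : ∀ x b → (∀ k → (A ⋆ b) k R.≈ [t+ x ] (φ ∘ e z) k) → ∀ k → b k R.+ [t+ x ] g k R.≈ R.0#
      quotient-≈ x b Ab k = null-const (resp
        (λ N → begin
          b k R.+ [t+ x ] (P N) k R.+ R.- R.1# R.* [t+ x ] (λ j → P N j R.- g j) k
            ≈⟨ R.+-congˡ (R.*-cong (R.-‿cong (R.sym φ.1-homo)) (R.+-congʳ (shift-- (P N) g k))) ⟩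
          b k R.+ [t+ x ] (P N) k R.+ R.- φ 1ℚ R.* (shift (P N) k R.- shift g k R.+ x R.* (P N k R.- g k))
            ≈⟨ solve 6 (λ b s x p s′ p′ → b :+ (s :+ x :* p) :+ :- con 1ℚ :* (s :- s′ :+ x :* (p :- p′))
                                       := b :+ (s′ :+ x :* p′)) R.refl (b k) (shift (P N) k) x (P N k) (shift g k) (g k) ⟩
          b k R.+ [t+ x ] g k  ∎)
        (add (closed-÷ A (R.- u) [-u]*A₀≈1 (λ N j → b j R.+ [t+ x ] (P N) j) remainder k)
             (mul (R.- R.1#) ([t+]-null x (λ N j → P N j R.- g j) P→g k))))
        where
        shift-- : ∀ F G k → shift (λ j → F j R.- G j) k R.≈ shift F k R.- shift G k
        shift-- F G zero    = R.sym (R.-‿inverseʳ R.0#)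
        shift-- F G (suc k) = R.refl

        remainder : ∀ k → Null (λ N → (A ⋆ (λ j → b j R.+ [t+ x ] (P N) j)) k)
        remainder k = resp
          (λ N → R.sym (begin
            (A ⋆ (λ j → b j R.+ [t+ x ] (P N) j)) k
              ≈⟨ ⋆-distribˡ-+ A b ([t+ x ] (P N)) k ⟩
            (A ⋆ b) k R.+ (A ⋆ [t+ x ] (P N)) k
              ≈⟨ R.+-cong (R.trans (Ab k) ([t+]-cong x (λ j → R.sym (V₀ j)) k))
                   (R.trans (⋆-[t+] x A (P N) k) ([t+]-cong x (A⋆P N) k)) ⟩
            [t+ x ] (V 0) k R.+ [t+ x ] (λ j → V N j R.- V 0 j) k
              ≈⟨ R.+-congˡ (R.+-congʳ (shift-- (V N) (V 0) k)) ⟩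
            [t+ x ] (V 0) k R.+ (shift (V N) k R.- shift (V 0) k R.+ x R.* (V N k R.- V 0 k))
              ≈⟨ solve 5 (λ s x v s′ v′ → (s′ :+ x :* v′) :+ (s :- s′ :+ x :* (v :- v′)) := s :+ x :* v)
                   R.refl (shift (V N) k) x (V N k) (shift (V 0) k) (V 0 k) ⟩
            [t+ x ] (V N) k  ∎))
          ([t+]-null x V V-null k)

  -- Sums over an arithmetic progression

  module Progression (q ξ : R.Carrier) (h a f : ℕ) (0<a : 0 ℕ.< a) (a<f : a ℕ.< f)
    (w : R.Carrier) (w≈ : w R.≈ ξ ^ᴿ f R.* (q ^ᴿ f) ^ᴿ h) (z : ℚ) (z*f≡a : z ℚ.* ι f ≡ ι a) where

    open Truncation w z

    -- f^k comes from a + j f = f (z + j), and the factorial undoes the 1/k! in the exponential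
    -- coefficients.
    factor : ℕ → R.Carrier
    factor k = q ^ᴿ (h ℕ.* a) R.* ξ ^ᴿ a R.* φ (ι f ^ℚ k ℚ.* ι (k !))

    summand : ℕ → ℕ → R.Carrier
    summand k m = q ^ᴿ (m ℕ.* h) R.* ξ ^ᴿ m R.* φ (ι m ^ℚ k)

    term : ℕ → ℕ → R.Carrier
    term k i = if does (f ∣? ℕ.∣ suc i - a ∣) then summand k (suc i) else R.0#

    open Residues a f 0<a a<f
    private
      module R-Exp = Algebra.Properties.CommutativeSemiring.Exp R.commutativeSemiring

    base : ∀ j → ι (a ℕ.+ j ℕ.* f) ≡ ι f ℚ.* (z ℚ.+ ι j)
    base j = trans (ι-homo-+ a (j ℕ.* f)) (trans (cong₂ ℚ._+_ (sym z*f≡a) (ι-homo-* j f))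
      (Qs.solve 3 (λ z f j → z Qs.:* f Qs.:+ j Qs.:* f Qs.:= f Qs.:* (z Qs.:+ j)) refl z (ι f) (ι j)))
      where module Qs = +-*-Solver

    summand≈ : ∀ k j → summand k (a ℕ.+ j ℕ.* f) R.≈ factor k R.* V j k
    summand≈ k j = begin
      q ^ᴿ ((a ℕ.+ j ℕ.* f) ℕ.* h) R.* ξ ^ᴿ (a ℕ.+ j ℕ.* f) R.* φ (ι (a ℕ.+ j ℕ.* f) ^ℚ k)
        ≈⟨ R.*-cong (R.*-cong q-power ξ-power) (R.trans (φ-cong (trans (cong (_^ℚ k) (base j)) (^-*-e (ι f) (z ℚ.+ ι j) k))) (φ.*-homo _ _)) ⟩
      Q R.* Qʲ R.* (Ξ R.* Ξʲ) R.* (F R.* φ (e (z ℚ.+ ι j) k))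
        ≈⟨ solve 6 (λ a b c d e f → a :* b :* (c :* d) :* (e :* f) := a :* c :* e :* (d :* b :* f)) R.refl Q Qʲ Ξ Ξʲ F (φ (e (z ℚ.+ ι j) k)) ⟩
      factor k R.* (Ξʲ R.* Qʲ R.* φ (e (z ℚ.+ ι j) k))
        ≈⟨ R.*-congˡ (R.*-congʳ (R.trans (^-congˡ j w≈) (R-Exp.^-distrib-* (ξ ^ᴿ f) ((q ^ᴿ f) ^ᴿ h) j))) ⟨
      factor k R.* V j k  ∎
      where
      Q Qʲ Ξ Ξʲ F : R.Carrier
      Q  = q ^ᴿ (h ℕ.* a)
      Qʲ = ((q ^ᴿ f) ^ᴿ h) ^ᴿ j
      Ξ  = ξ ^ᴿ a
      Ξʲ = (ξ ^ᴿ f) ^ᴿ j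
      F  = φ (ι f ^ℚ k ℚ.* ι (k !))
      q-power : q ^ᴿ ((a ℕ.+ j ℕ.* f) ℕ.* h) R.≈ Q R.* Qʲ
      q-power = begin
        q ^ᴿ ((a ℕ.+ j ℕ.* f) ℕ.* h)
          ≡⟨ cong (q ^ᴿ_) (Ns.solve 4 (λ a j f h → (a Ns.:+ j Ns.:* f) Ns.:* h Ns.:= h Ns.:* a Ns.:+ f Ns.:* h Ns.:* j) refl a j f h) ⟩
        q ^ᴿ (h ℕ.* a ℕ.+ f ℕ.* h ℕ.* j)
          ≈⟨ ^-homo-* q (h ℕ.* a) (f ℕ.* h ℕ.* j) ⟩
        Q R.* q ^ᴿ (f ℕ.* h ℕ.* j)
          ≈⟨ R.*-congˡ (R.trans (^-congˡ j (^-assocʳ q f h)) (^-assocʳ q (f ℕ.* h) j)) ⟨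
        Q R.* Qʲ  ∎
        where module Ns = ℕ-Solver.+-*-Solver
      ξ-power : ξ ^ᴿ (a ℕ.+ j ℕ.* f) R.≈ Ξ R.* Ξʲ
      ξ-power = begin
        ξ ^ᴿ (a ℕ.+ j ℕ.* f)     ≡⟨ cong (λ m → ξ ^ᴿ (a ℕ.+ m)) (ℕ.*-comm j f) ⟩
        ξ ^ᴿ (a ℕ.+ f ℕ.* j)     ≈⟨ ^-homo-* ξ a (f ℕ.* j) ⟩
        Ξ R.* ξ ^ᴿ (f ℕ.* j)     ≈⟨ R.*-congˡ (^-assocʳ ξ f j) ⟨
        Ξ R.* Ξʲ                 ∎

    term-member : ∀ k i j → suc i ≡ a ℕ.+ j ℕ.* f → term k i R.≈ factor k R.* V j k
    term-member k i j 1+i≡ = R.trans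
      (R.reflexive (cong (λ b → if b then summand k (suc i) else R.0#)
        (dec-true (f ∣? ℕ.∣ suc i - a ∣) (divides j (trans (cong (λ m → ℕ.∣ m - a ∣) 1+i≡) (trans (ℕ.∣-∣-comm (a ℕ.+ j ℕ.* f) a) (ℕ.∣m-m+n∣≡n a (j ℕ.* f))))))))
      (R.trans (R.reflexive (cong (summand k) 1+i≡)) (summand≈ k j))

    term-nonmember : ∀ k i j r → suc i ℕ.+ f ≡ a ℕ.+ j ℕ.* f ℕ.+ suc r → suc r ℕ.< f → term k i R.≈ R.0#
    term-nonmember k i j r 1+i≡ 1+r<f = R.reflexive (cong (λ b → if b then summand k (suc i) else R.0#)
      (dec-false (f ∣? ℕ.∣ suc i - a ∣) (not-congruent i j r 1+i≡ 1+r<f)))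

    -- The n-th partial sum contains the first j terms of the progression a, a + f, a + 2f, …
    -- when n + f = a + j f + r with r < f.
    partialSum≈ : ∀ k n j r → n ℕ.+ f ≡ a ℕ.+ j ℕ.* f ℕ.+ r → r ℕ.< f → ∑ n (term k) R.≈ factor k R.* P j k
    partialSum≈ k zero    zero    r n≡ r<f = R.sym (R.zeroʳ (factor k))
    partialSum≈ k zero    (suc j) r n≡ r<f = contradiction n≡ (ℕ.<⇒≢ (f<a+[1+j]f+r j r))
    -- Here n + 1 + f would equal a, which is less than f.
    partialSum≈ k (suc n) zero    zero    n≡ r<f = contradiction n≡ (ℕ.>⇒≢ (a+0+0<1+n+f n))
    -- Remainder 0 means that n + 1 is the member a + j f. Without it the count drops by one and the
    -- remainder wraps around to f - 1.
    partialSum≈ k (suc n) (suc j) zero    n≡ r<f = begin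
      ∑ (suc n) (term k)                               ≈⟨ ∑-last n (term k) ⟩
      ∑ n (term k) R.+ term k n                        ≈⟨ R.+-cong (partialSum≈ k n j (ℕ.pred f) n≡′ (ℕ.≤-reflexive (ℕ.suc-pred f))) (term-member k n j 1+n≡) ⟩
      factor k R.* P j k R.+ factor k R.* V j k        ≈⟨ R.distribˡ _ _ _ ⟨
      factor k R.* P (suc j) k                         ∎
      where
      1+n≡ : suc n ≡ a ℕ.+ j ℕ.* f
      1+n≡ = ℕ.+-cancelʳ-≡ f (suc n) (a ℕ.+ j ℕ.* f) (trans n≡
        (Ns.solve 3 (λ a f jf → a Ns.:+ (f Ns.:+ jf) Ns.:+ Ns.con 0 Ns.:= a Ns.:+ jf Ns.:+ f) refl a f (j ℕ.* f)))
        where module Ns = ℕ-Solver.+-*-Solver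
      n≡′ : n ℕ.+ f ≡ a ℕ.+ j ℕ.* f ℕ.+ ℕ.pred f
      n≡′ = trans (cong (n ℕ.+_) (sym (ℕ.suc-pred f))) (trans (ℕ.+-suc n (ℕ.pred f)) (cong (ℕ._+ ℕ.pred f) 1+n≡))
    partialSum≈ k (suc n) j       (suc r) n≡ r<f = begin
      ∑ (suc n) (term k)                               ≈⟨ ∑-last n (term k) ⟩
      ∑ n (term k) R.+ term k n                        ≈⟨ R.+-cong (partialSum≈ k n j r n≡′ (ℕ.<⇒≤ r<f)) (term-nonmember k n j r n≡ r<f) ⟩
      factor k R.* P j k R.+ R.0#                      ≈⟨ R.+-identityʳ _ ⟩
      factor k R.* P j k                               ∎
      where
      n≡′ : n ℕ.+ f ≡ a ℕ.+ j ℕ.* f ℕ.+ r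
      n≡′ = ℕ.suc-injective (trans n≡ (ℕ.+-suc (a ℕ.+ j ℕ.* f) r))

    partialSum≈P[count] : ∀ k n → ∑ n (term k) R.≈ factor k R.* P (count n) k
    partialSum≈P[count] k n = partialSum≈ k n (count n) (remainder n) (count-remainder n) (remainder<f n)

    partialSum-error : ∀ k L n → factor k R.* (P (count n) k R.- L) R.≈ ∑ n (term k) R.- factor k R.* L
    partialSum-error k L n = begin
      factor k R.* (P (count n) k R.- L)                  ≈⟨ solve 3 (λ c p l → c :* (p :- l) := c :* p :- c :* l) R.refl (factor k) (P (count n) k) L ⟩
      factor k R.* P (count n) k R.- factor k R.* L       ≈⟨ R.+-congʳ (partialSum≈P[count] k n) ⟨
      ∑ n (term k) R.- factor k R.* L                     ∎

    -- Put n = m + 1, so that I = 1/n. The vanishing coefficient at tⁿ is multiplied by q^{ha} ξ^a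
    -- f^m m!. Since n! I = m!, the Bernoulli term becomes the left side. The term of `g m` receives
    -- `factor m`, and in that of `g (suc m)` the f from f log q and n I = 1 complete f^m m! to
    -- `factor (suc m)` times I.
    value≈ : ∀ F H ℓ m (g B : ℕ → R.Carrier) I → F R.≈ φ (ι f) → φ (ι (suc m)) R.* I R.≈ R.1# →
      B (suc m) R.* φ (1/! (suc m)) R.+ [t+ H R.* (F R.* ℓ) ] g (suc m) R.≈ R.0# →
      R.- (q ^ᴿ (h ℕ.* a) R.* ξ ^ᴿ a R.* F ^ᴿ m R.* B (suc m) R.* I)
        R.≈ factor m R.* g m R.- H R.* ℓ R.* (R.- I) R.* (factor (suc m) R.* g (suc m))
    value≈ F H ℓ m g B I F≈ NI≈1 b+≈0 = begin
      R.- (K R.* Fᵐ R.* B (suc m) R.* I)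
        ≈⟨ R.-‿cong (R.*-congʳ (R.*-congˡ B≈)) ⟩
      R.- (K R.* Fᵐ R.* (N R.* M R.* b) R.* I)
        -- Writes - b as G - (b + G), where G is the coefficient of (t + h f log q) g at tⁿ; b + G
        -- vanishes by `b+≈0`.
        ≈⟨ solve 11 (λ K Fᵐ N M b I H F ℓ g g′ → :- (K :* Fᵐ :* (N :* M :* b) :* I)
             := K :* Fᵐ :* M :* (N :* I) :* (g :+ H :* (F :* ℓ) :* g′ :- (b :+ (g :+ H :* (F :* ℓ) :* g′))))
             R.refl K Fᵐ N M b I H F ℓ (g m) (g (suc m)) ⟩
      K R.* Fᵐ R.* M R.* (N R.* I) R.* (g m R.+ H R.* (F R.* ℓ) R.* g (suc m) R.- (b R.+ (g m R.+ H R.* (F R.* ℓ) R.* g (suc m))))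
        ≈⟨ R.*-congˡ (R.+-congˡ (R.-‿cong (R.trans b+≈0 (R.sym φ.0-homo)))) ⟩
      K R.* Fᵐ R.* M R.* (N R.* I) R.* (g m R.+ H R.* (F R.* ℓ) R.* g (suc m) R.- φ 0ℚ)
        ≈⟨ solve 10 (λ K Fᵐ N M I H F ℓ g g′ → K :* Fᵐ :* M :* (N :* I) :* (g :+ H :* (F :* ℓ) :* g′ :- con 0ℚ)
             := K :* (Fᵐ :* M) :* g :* (N :* I) :- H :* ℓ :* (:- I) :* (K :* (F :* Fᵐ :* (N :* M)) :* g′))
             R.refl K Fᵐ N M I H F ℓ (g m) (g (suc m)) ⟩
      K R.* (Fᵐ R.* M) R.* g m R.* (N R.* I) R.- H R.* ℓ R.* (R.- I) R.* (K R.* (F R.* Fᵐ R.* (N R.* M)) R.* g (suc m))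
        ≈⟨ R.+-cong (R.trans (R.*-congˡ NI≈1) (R.*-identityʳ _)) R.refl ⟩
      K R.* (Fᵐ R.* M) R.* g m R.- H R.* ℓ R.* (R.- I) R.* (K R.* (F R.* Fᵐ R.* (N R.* M)) R.* g (suc m))
        ≈⟨ R.+-cong (R.*-congʳ (R.*-congˡ factorₘ)) (R.-‿cong (R.*-congˡ (R.*-congʳ (R.*-congˡ factorₙ)))) ⟨
      factor m R.* g m R.- H R.* ℓ R.* (R.- I) R.* (factor (suc m) R.* g (suc m))  ∎
      where
      K Fᵐ N M b : R.Carrier
      K  = q ^ᴿ (h ℕ.* a) R.* ξ ^ᴿ a
      Fᵐ = F ^ᴿ m
      N  = φ (ι (suc m))
      M  = φ (ι (m !))
      b  = B (suc m) R.* φ (1/! (suc m))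
      F^ : ∀ k → φ (ι f ^ℚ k) R.≈ F ^ᴿ k
      F^ k = R.trans (φ-^ (ι f) k) (^-congˡ k (R.sym F≈))
      factorₘ : φ (ι f ^ℚ m ℚ.* ι (m !)) R.≈ Fᵐ R.* M
      factorₘ = R.trans (φ.*-homo _ _) (R.*-congʳ (F^ m))
      n!≈ : φ (ι (suc m !)) R.≈ N R.* M
      n!≈ = R.trans (φ-cong (ι-homo-* (suc m) (m !))) (φ.*-homo _ _)
      factorₙ : φ (ι f ^ℚ suc m ℚ.* ι (suc m !)) R.≈ F R.* Fᵐ R.* (N R.* M)
      factorₙ = R.trans (φ.*-homo _ _) (R.*-cong (F^ (suc m)) n!≈)
      B≈ : B (suc m) R.≈ N R.* M R.* b
      B≈ = begin
        B (suc m)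
          ≈⟨ R.*-identityʳ _ ⟨
        B (suc m) R.* R.1#
          ≈⟨ R.*-congˡ (R.trans (φ-cong (1/!*! (suc m))) φ.1-homo) ⟨
        B (suc m) R.* φ (1/! (suc m) ℚ.* ι (suc m !))
          ≈⟨ R.*-congˡ (R.trans (φ.*-homo _ _) (R.*-congˡ n!≈)) ⟩
        B (suc m) R.* (φ (1/! (suc m)) R.* (N R.* M))
          ≈⟨ solve 3 (λ b r nm → b :* (r :* nm) := nm :* (b :* r)) R.refl (B (suc m)) (φ (1/! (suc m))) (N R.* M) ⟩
        N R.* M R.* b  ∎

-- Complex series

Nullᶜ : (ℕ → ℂ) → Set
Nullᶜ u = Lim².Null (λ (n , m) → seq (re (u n)) m) × Lim².Null (λ (n , m) → seq (im (u n)) m)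

≈⇒Nullᶜ : ∀ {z w : ℕ → ℂ} → (∀ n → z n ≈ w n) → Nullᶜ (λ n → z n - w n)
≈⇒Nullᶜ {z} {w} z≈w =
    (λ ε 0<ε → Lim.always (λ n → ≈ᴿ⇒∼ {re (z n)} {re (w n)} (proj₁ (z≈w n)) ε 0<ε))
  , (λ ε 0<ε → Lim.always (λ n → ≈ᴿ⇒∼ {im (z n)} {im (w n)} (proj₂ (z≈w n)) ε 0<ε))

null-minus : ∀ {u v : ℕ × ℕ → ℚ} → Lim².Null u → Lim².Null (λ i → u i ℚ.- v i) → Lim².Null v
null-minus {u} {v} nu nu-v = Lim².null-cong
  (λ i → solve 2 (λ u v → v := u :+ :- (u :- v)) refl (u i) (v i)) (Lim².null-+ nu (Lim².null-neg nu-v))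
  where open +-*-Solver

Nullᶜ-resp : ∀ {u v} → (∀ n → u n ≈ v n) → Nullᶜ u → Nullᶜ v
Nullᶜ-resp {u} {v} u≈v (nr , ni) =
    null-minus {v = λ (n , m) → seq (re (v n)) m} nr (proj₁ (≈⇒Nullᶜ {u} {v} u≈v))
  , null-minus {v = λ (n , m) → seq (im (v n)) m} ni (proj₂ (≈⇒Nullᶜ {u} {v} u≈v))

Nullᶜ-mul : ∀ z {u} → Nullᶜ u → Nullᶜ (λ n → z * u n)
Nullᶜ-mul z {u} (nr , ni) =
    Lim².null-+ (times (re z) (λ n → re (u n)) nr) (Lim².null-neg (times (im z) (λ n → im (u n)) ni))
  , Lim².null-+ (times (re z) (λ n → im (u n)) ni) (times (im z) (λ n → re (u n)) nr)
  where
  times : ∀ x (v : ℕ → ℝ) → Lim².Null (λ (n , m) → seq (v n) m) → Lim².Null (λ (n , m) → seq x m ℚ.* seq (v n) m)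
  times x v nv = Lim².null-cong (λ (n , m) → ℚ.*-comm (seq x m) (seq (v n) m))
    (Lim².null-* nv (bounded-proj₂ (seq-bounded x)))

null-constant : ∀ x → Lim².Null (λ (n , m) → seq x m) → x ≈ᴿ 0ᴿ
null-constant x nx = ∼⇒≈ᴿ {x} {0ᴿ} λ ε 0<ε → proj₁ (proj₂ (nx ε 0<ε) (proj₁ (nx ε 0<ε)) ℕ.≤-refl)
  , λ m N≤m → subst (λ p → ℚ.∣ p ∣ ℚ.≤ ε) (sym (ℚ.+-identityʳ (seq x m)))
      (proj₂ (proj₂ (nx ε 0<ε) (proj₁ (nx ε 0<ε)) ℕ.≤-refl) m N≤m)

module ℂˢ = Convolution ℂ-commutativeRing
module ℂᴳ = GeneratingFunction commutativeRingᶜ ℚ→ℂ-morphism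

opaque
  unfolding _≈ᶜ_

  Nullᶜ-submodule : ℂᴳ.Submodule Nullᶜ
  Nullᶜ-submodule = record
    { resp = λ {u} {v} → Nullᶜ-resp {u} {v}
    ; add  = λ (ur , ui) (vr , vi) → Lim².null-+ ur vr , Lim².null-+ ui vi
    ; mul  = λ z {u} → Nullᶜ-mul z {u}
    }

  Nullᶜ-constant : ∀ {z} → Nullᶜ (λ _ → z) → z ≈ᶜ 0#
  Nullᶜ-constant {z} (nr , ni) = null-constant (re z) nr , null-constant (im z) ni

ℂ-nullity : ℂᴳ.Nullity
ℂ-nullity = record
  { Null       = Nullᶜ
  ; submodule  = Nullᶜ-submodule
  ; null-const = Nullᶜ-constant
  ; null-0     = Lim².null-0 , Lim².null-0
  }

null-reindex : ∀ {u : ℕ × ℕ → ℚ} (j : ℕ → ℕ) → (∀ J → ∃[ N ] (∀ n → N ℕ.≤ n → J ℕ.≤ j n)) →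
  Lim².Null u → Lim².Null (λ (n , m) → u (j n , m))
null-reindex j j→∞ nu ε 0<ε = proj₁ (j→∞ (proj₁ (nu ε 0<ε)))
  , λ n N≤n → proj₂ (nu ε 0<ε) (j n) (proj₂ (j→∞ (proj₁ (nu ε 0<ε))) n N≤n)

hasSum : ∀ {u S} → Nullᶜ (λ n → ℂˢ.∑ n u - S) → HasSum u S
hasSum {u} {S} (nr , ni) ε 0<ε = proj₁ small , λ n N≤n →
  δ , 0<* (½* 0<ε) 0<ε , proj₁ (proj₂ small n N≤n) , proj₂ (proj₂ small n N≤n)
  where
  open ℚ.≤-Reasoning
  open +-*-Solver
  -- A strict inequality of reals needs a rational gap. Coordinates of size at most ε/2 give a
  -- squared modulus of at most ε²/2, which leaves the gap ε²/2.
  δ = ℚ.½ ℚ.* ε ℚ.* ε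
  η = ℚ.½ ℚ.* ε
  D : ℕ → ℂ
  D n = ℂˢ.∑ n u - S
  square-≤ : ∀ {p} → ℚ.∣ p ∣ ℚ.≤ η → p ℚ.* p ℚ.≤ η ℚ.* η
  square-≤ {p} p≤η = subst (ℚ._≤ η ℚ.* η) (∣p∣*∣p∣≡p*p p) (*-mono-≤ (ℚ.0≤∣p∣ p) p≤η (ℚ.0≤∣p∣ p) p≤η)
  small : Lim².Eventually (λ (n , m) → seq (normSq (D n)) m ℚ.+ δ ℚ.≤ ε ℚ.* ε)
  small = Lim².map₂ (λ (n , m) r≤ i≤ → begin
      seq (normSq (D n)) m ℚ.+ δ
        ≤⟨ ℚ.+-monoˡ-≤ δ (ℚ.+-mono-≤ (square-≤ r≤) (square-≤ i≤)) ⟩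
      η ℚ.* η ℚ.+ η ℚ.* η ℚ.+ δ
        ≡⟨ solve 1 (λ e → con ℚ.½ :* e :* (con ℚ.½ :* e) :+ con ℚ.½ :* e :* (con ℚ.½ :* e) :+ con ℚ.½ :* e :* e := e :* e) refl ε ⟩
      ε ℚ.* ε  ∎)
    (nr η (½* 0<ε)) (ni η (½* 0<ε))

module ℂ-Exp = Algebra.Properties.CommutativeSemiring.Exp ℂ-Ring.commutativeSemiring

module _ (x : ℝ) (m : ℕ) where

  powerᴿ : ∀ k → seq (re (ℝ→ℂ x ^ k)) m ≡ seq x m ^ℚ k
  powerⁱ : ∀ k → seq (im (ℝ→ℂ x ^ k)) m ≡ 0ℚ
  powerᴿ zero    = refl
  powerᴿ (suc k) = begin
    seq x m ℚ.* seq (re (ℝ→ℂ x ^ k)) m ℚ.+ ℚ.- (0ℚ ℚ.* seq (im (ℝ→ℂ x ^ k)) m)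
      ≡⟨ cong₂ (λ p q → seq x m ℚ.* p ℚ.+ ℚ.- (0ℚ ℚ.* q)) (powerᴿ k) (powerⁱ k) ⟩
    seq x m ℚ.* seq x m ^ℚ k ℚ.+ ℚ.- (0ℚ ℚ.* 0ℚ)
      ≡⟨ ℚ.+-identityʳ (seq x m ^ℚ suc k) ⟩
    seq x m ^ℚ suc k  ∎
    where open ≡-Reasoning
  powerⁱ zero    = refl
  powerⁱ (suc k) = begin
    seq x m ℚ.* seq (im (ℝ→ℂ x ^ k)) m ℚ.+ 0ℚ ℚ.* seq (re (ℝ→ℂ x ^ k)) m
      ≡⟨ cong₂ (λ p q → seq x m ℚ.* p ℚ.+ q) (powerⁱ k) (ℚ.*-zeroˡ (seq (re (ℝ→ℂ x ^ k)) m)) ⟩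
    seq x m ℚ.* 0ℚ ℚ.+ 0ℚ
      ≡⟨ trans (ℚ.+-identityʳ (seq x m ℚ.* 0ℚ)) (ℚ.*-zeroʳ (seq x m)) ⟩
    0ℚ  ∎
    where open ≡-Reasoning
  expCoeffᴿ : ∀ k → seq (re (expCoeff (ℝ→ℂ x) k)) m ≡ e (seq x m) k
  expCoeffᴿ k = begin
    seq (re (ℝ→ℂ x ^ k)) m ℚ.* (1/ k !) ℚ.+ ℚ.- (seq (im (ℝ→ℂ x ^ k)) m ℚ.* 0ℚ)
      ≡⟨ cong₂ (λ p q → p ℚ.* (1/ k !) ℚ.+ ℚ.- q) (powerᴿ k) (ℚ.*-zeroʳ (seq (im (ℝ→ℂ x ^ k)) m)) ⟩
    seq x m ^ℚ k ℚ.* (1/ k !) ℚ.+ 0ℚ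
      ≡⟨ ℚ.+-identityʳ (seq x m ^ℚ k ℚ.* (1/ k !)) ⟩
    seq x m ^ℚ k ℚ.* (1/ k !)
      ≡⟨ cong (seq x m ^ℚ k ℚ.*_) (1/!-def k) ⟨
    e (seq x m) k  ∎
    where open ≡-Reasoning
  expCoeffⁱ : ∀ k → seq (im (expCoeff (ℝ→ℂ x) k)) m ≡ 0ℚ
  expCoeffⁱ k = begin
    seq (re (ℝ→ℂ x ^ k)) m ℚ.* 0ℚ ℚ.+ seq (im (ℝ→ℂ x ^ k)) m ℚ.* (1/ k !)
      ≡⟨ cong₂ ℚ._+_ (ℚ.*-zeroʳ (seq (re (ℝ→ℂ x ^ k)) m)) (cong (ℚ._* (1/ k !)) (powerⁱ k)) ⟩
    0ℚ ℚ.+ 0ℚ ℚ.* (1/ k !)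
      ≡⟨ trans (ℚ.+-identityˡ (0ℚ ℚ.* (1/ k !))) (ℚ.*-zeroˡ (1/ k !)) ⟩
    0ℚ  ∎
    where open ≡-Reasoning
∑ᴿ : ∀ n (u : ℕ → ℂ) m → seq (re (ℂˢ.∑ n u)) m ≡ ∑ℚ n (λ k → seq (re (u k)) m)
∑ᴿ zero    u m = refl
∑ᴿ (suc n) u m = cong (seq (re (u 0)) m ℚ.+_) (∑ᴿ n (u ∘ suc) m)

∑ⁱ : ∀ n (u : ℕ → ℂ) m → seq (im (ℂˢ.∑ n u)) m ≡ ∑ℚ n (λ k → seq (im (u k)) m)
∑ⁱ zero    u m = refl
∑ⁱ (suc n) u m = cong (seq (im (u 0)) m ℚ.+_) (∑ⁱ n (u ∘ suc) m)

-- For a real argument the k-th approximation of a partial sum is the rational partial sum at the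
-- k-th approximation of the argument.
isExp-real : ∀ {z} x y → z ≈ ℝ→ℂ x → (λ (n , k) → E (seq x k) n) Lim².∼ (λ _ → y) → IsExp z (ℚ→ℂ y)
isExp-real {z} x y z≈x E→y = hasSum {expCoeff z} {ℚ→ℂ y} (Nullᶜ-resp
  {λ n → ℂˢ.∑ n (expCoeff (ℝ→ℂ x)) - ℚ→ℂ y} {λ n → ℂˢ.∑ n (expCoeff z) - ℚ→ℂ y}
  (λ n → ℂ-Ring.+-cong {ℂˢ.∑ n (expCoeff (ℝ→ℂ x))} {ℂˢ.∑ n (expCoeff z)} { - ℚ→ℂ y} { - ℚ→ℂ y}
    (ℂˢ.∑-cong n {expCoeff (ℝ→ℂ x)} {expCoeff z}
      (λ k → ℂ-Ring.*-cong {ℝ→ℂ x ^ k} {z ^ k} {ℚ→ℂ (1/ k !)} {ℚ→ℂ (1/ k !)}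
        (ℂ-Ring.sym {z ^ k} {ℝ→ℂ x ^ k} (ℂ-Exp.^-congˡ k {z} {ℝ→ℂ x} z≈x)) (ℂ-Ring.refl {ℚ→ℂ (1/ k !)})))
    (ℂ-Ring.refl { - ℚ→ℂ y}))
  ( Lim².null-cong (λ (n , m) → cong (ℚ._- y) (trans (∑ᴿ n (expCoeff (ℝ→ℂ x)) m) (ℚˢ.∑-cong n (expCoeffᴿ x m)))) E→y
  , Lim².null-cong (λ (n , m) → cong (ℚ._- 0ℚ) (trans (∑ⁱ n (expCoeff (ℝ→ℂ x)) m) (∑-zero n (expCoeffⁱ x m)))) Lim².null-0))

-- At s = 1 - n the exponents are the naturals n - 1 and n, so the powers are rational, and
-- `exp-*-log` evaluates the exponential of j log m.
isPower : ∀ m .{{_ : NonZero m}} {s} j → s ≈ ℚ→ℂ (ι j) → IsPower m s (ℚ→ℂ (ι m ^ℚ j))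
isPower m {s} j s≈j = l
  , subst (λ y → IsExp (ℝ→ℂ l) (ℚ→ℂ y)) (ι≡/1 m)
      (isExp-real {ℝ→ℂ l} l (ι m) (ℂ-Ring.refl {ℝ→ℂ l}) exp-log)
  , isExp-real {s * ℝ→ℂ l} (ℚ→ℝ (ι j) *ᴿ l) (ι m ^ℚ j) s*l≈ (exp-*-log j)
  where
  open Logarithm m
  open +-*-Solver
  l : ℝ
  l = mkℝ log log-cauchy
  s*l≈ : s * ℝ→ℂ l ≈ ℝ→ℂ (ℚ→ℝ (ι j) *ᴿ l)
  s*l≈ = ℂ-Ring.trans {s * ℝ→ℂ l} {ℚ→ℂ (ι j) * ℝ→ℂ l} {ℝ→ℂ (ℚ→ℝ (ι j) *ᴿ l)}
    (ℂ-Ring.*-cong {s} {ℚ→ℂ (ι j)} {ℝ→ℂ l} {ℝ→ℂ l} s≈j (ℂ-Ring.refl {ℝ→ℂ l}))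
    (≐⇒≈ {ℚ→ℂ (ι j) * ℝ→ℂ l} {ℝ→ℂ (ℚ→ℝ (ι j) *ᴿ l)}
      (λ n → solve 2 (λ a b → a :* b :+ :- (con 0ℚ :* con 0ℚ) := a :* b) refl (ι j) (log n))
      (λ n → solve 2 (λ a b → a :* con 0ℚ :+ con 0ℚ :* b := con 0ℚ) refl (ι j) (log n)))

-- Inverses of real and complex numbers

inv : ℚ → ℚ
inv p = case 0ℚ ℚ.<? p of λ where
  (yes 0<p) → (ℚ.1/ p) {{ℚ.pos⇒nonZero p {{ℚ.positive 0<p}}}}
  -- Early approximations of a positive real may be nonpositive; this value is taken only there.
  (no _)    → 0ℚ

inv-* : ∀ {p} → 0ℚ ℚ.< p → inv p ℚ.* p ≡ 1ℚ
inv-* {p} 0<p with 0ℚ ℚ.<? p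
... | yes 0<p′ = ℚ.*-inverseˡ p {{ℚ.pos⇒nonZero p {{ℚ.positive 0<p′}}}}
... | no  0≮p  = contradiction 0<p 0≮p

realInverse : ∀ x {d} → 0ℚ ℚ.< d → Lim.Eventually (λ m → d ℚ.≤ seq x m) → ∃[ y ] (x *ᴿ y) ≈ᴿ 1ᴿ
realInverse x {d} 0<d (M , d≤x) = y , ∼⇒≈ᴿ {x *ᴿ y} {1ᴿ} xy∼1
  where
  open +-*-Solver
  a b : ℕ → ℚ
  a m = seq x m
  b m = inv (a m)
  ab≡1 : ∀ m → M ℕ.≤ m → b m ℚ.* a m ≡ 1ℚ
  ab≡1 m M≤m = inv-* (ℚ.<-≤-trans 0<d (d≤x m M≤m))
  b-cauchy : IsCauchy b
  -- The difference of two reciprocals is that of the numbers divided by their product, which is at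
  -- least d² from `M` on; hence the tolerance ε d².
  b-cauchy ε 0<ε = M ℕ.⊔ N , λ m n N≤m N≤n → near m n
    (ℕ.m⊔n≤o⇒m≤o M N N≤m) (ℕ.m⊔n≤o⇒m≤o M N N≤n)
    (proj₂ (cauchy x (ε ℚ.* (d ℚ.* d)) (0<* 0<ε (0<* 0<d 0<d))) m n (ℕ.m⊔n≤o⇒n≤o M N N≤m) (ℕ.m⊔n≤o⇒n≤o M N N≤n))
    where
    N = proj₁ (cauchy x (ε ℚ.* (d ℚ.* d)) (0<* 0<ε (0<* 0<d 0<d)))
    near : ∀ m n → M ℕ.≤ m → M ℕ.≤ n → ℚ.∣ a m ℚ.- a n ∣ ℚ.< ε ℚ.* (d ℚ.* d) → ℚ.∣ b m ℚ.- b n ∣ ℚ.< ε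
    near m n M≤m M≤n a<εd² = ℚ.*-cancelʳ-<-nonNeg (d ℚ.* d) {{ℚ.nonNegative (0≤p² d)}} (begin-strict
      ℚ.∣ b m ℚ.- b n ∣ ℚ.* (d ℚ.* d)
        ≤⟨ *-monoʳ-≤ (ℚ.0≤∣p∣ (b m ℚ.- b n)) (*-mono-≤ (ℚ.<⇒≤ 0<d) (d≤x m M≤m) (ℚ.<⇒≤ 0<d) (d≤x n M≤n)) ⟩
      ℚ.∣ b m ℚ.- b n ∣ ℚ.* (a m ℚ.* a n)
        ≡⟨ cong (ℚ.∣ b m ℚ.- b n ∣ ℚ.*_) (ℚ.0≤p⇒∣p∣≡p (0≤* (0≤a m M≤m) (0≤a n M≤n))) ⟨
      ℚ.∣ b m ℚ.- b n ∣ ℚ.* ℚ.∣ a m ℚ.* a n ∣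
        ≡⟨ ℚ.∣p*q∣≡∣p∣*∣q∣ (b m ℚ.- b n) (a m ℚ.* a n) ⟨
      ℚ.∣ (b m ℚ.- b n) ℚ.* (a m ℚ.* a n) ∣
        ≡⟨ cong ℚ.∣_∣ (solve 4 (λ a b a′ b′ → (b :- b′) :* (a :* a′) := b :* a :* a′ :- b′ :* a′ :* a) refl (a m) (b m) (a n) (b n)) ⟩
      ℚ.∣ b m ℚ.* a m ℚ.* a n ℚ.- b n ℚ.* a n ℚ.* a m ∣
        ≡⟨ cong₂ (λ p q → ℚ.∣ p ℚ.* a n ℚ.- q ℚ.* a m ∣) (ab≡1 m M≤m) (ab≡1 n M≤n) ⟩
      ℚ.∣ 1ℚ ℚ.* a n ℚ.- 1ℚ ℚ.* a m ∣
        ≡⟨ cong₂ (λ p q → ℚ.∣ p ℚ.- q ∣) (ℚ.*-identityˡ (a n)) (ℚ.*-identityˡ (a m)) ⟩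
      ℚ.∣ a n ℚ.- a m ∣
        ≡⟨ ∣p-q∣≡∣q-p∣ (a n) (a m) ⟩
      ℚ.∣ a m ℚ.- a n ∣
        <⟨ a<εd² ⟩
      ε ℚ.* (d ℚ.* d)  ∎)
      where
      open ℚ.≤-Reasoning
      0≤a : ∀ m → M ℕ.≤ m → 0ℚ ℚ.≤ a m
      0≤a m M≤m = ℚ.≤-trans (ℚ.<⇒≤ 0<d) (d≤x m M≤m)
  y : ℝ
  y = mkℝ b b-cauchy
  xy∼1 : (λ m → a m ℚ.* b m) Lim.∼ (λ _ → 1ℚ)
  xy∼1 ε 0<ε = M , λ m M≤m → subst (ℚ._≤ ε)
    (sym (cong (λ p → ℚ.∣ p ℚ.- 1ℚ ∣) (trans (ℚ.*-comm (a m) (b m)) (ab≡1 m M≤m)))) (ℚ.<⇒≤ 0<ε)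

complexInverse : ∀ z y → (normSq z *ᴿ y) ≈ᴿ 1ᴿ → ∃[ u ] u * z ≈ 1#
complexInverse z y normSq*y≈1 = u
  , ≈ᴿ-trans {re (u * z)} {normSq z *ᴿ y} {1ᴿ}
      (≐⇒≈ᴿ {re (u * z)} {normSq z *ᴿ y} (λ m →
        solve 3 (λ a b y → a :* y :* a :+ :- (:- b :* y :* b) := (a :* a :+ b :* b) :* y) refl
          (seq (re z) m) (seq (im z) m) (seq y m)))
      normSq*y≈1
  , ≐⇒≈ᴿ {im (u * z)} {0ᴿ} (λ m →
      solve 3 (λ a b y → a :* y :* b :+ :- b :* y :* a := con 0ℚ) refl
        (seq (re z) m) (seq (im z) m) (seq y m))
  where
  open +-*-Solver
  -- The conjugate of z divided by the squared modulus.
  u : ℂ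
  u = (re z *ᴿ y) +i ((-ᴿ im z) *ᴿ y)

module _ {w : ℂ} {ρ : ℚ} (ρ<1 : ρ ℚ.< 1ℚ) (w≤ρ : Lim.Eventually (λ m → seq (normSq w) m ℚ.≤ ρ)) where

  private
    -- 1 - d = (1 + ρ)/2 is a rational upper bound for the square root of ρ, because its square is ρ
    -- + d². So the real part of w is at most 1 - d, and ∣1 - w∣ is at least d. Such a rational
    -- lower bound is what the inversion of a real number requires.
    d = ℚ.½ ℚ.* (1ℚ ℚ.- ρ)
    0<d : 0ℚ ℚ.< d
    0<d = ½* (subst (ℚ._< 1ℚ ℚ.- ρ) (ℚ.+-inverseʳ ρ) (ℚ.+-monoˡ-< (ℚ.- ρ) ρ<1))

    0≤ρ : 0ℚ ℚ.≤ ρ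
    0≤ρ = ℚ.≤-trans (0≤+ (0≤p² (seq (re w) _)) (0≤p² (seq (im w) _))) (proj₂ w≤ρ (proj₁ w≤ρ) ℕ.≤-refl)

    normSq-1-w : Lim.Eventually (λ m → d ℚ.* d ℚ.≤ seq (normSq (1# - w)) m)
    normSq-1-w = Lim.map₁ (λ m N≤ρ →
      let x = seq (re w) m ; y = seq (im w) m
          x≤σ : x ℚ.≤ 1ℚ ℚ.- d
          x≤σ = ℚ.≤-trans (p≤∣p∣ x) (p²≤q²⇒∣p∣≤q 0<σ (ℚ.≤-trans
            (≤-offset (y ℚ.* y) (0≤p² y) refl) (ℚ.≤-trans N≤ρ
              (≤-offset (d ℚ.* d) (0≤p² d)
                (solve 1 (λ r → r :+ con ℚ.½ :* (con 1ℚ :- r) :* (con ℚ.½ :* (con 1ℚ :- r))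
                     := (con 1ℚ :- con ℚ.½ :* (con 1ℚ :- r)) :* (con 1ℚ :- con ℚ.½ :* (con 1ℚ :- r))) refl ρ)))))
          d≤1-x : d ℚ.≤ 1ℚ ℚ.- x
          d≤1-x = ≤-offset _ (p≤q⇒0≤q-p x≤σ) (solve 2 (λ d x → d :+ (con 1ℚ :- d :- x) := con 1ℚ :- x) refl d x)
      in ℚ.≤-trans (*-mono-≤ (ℚ.<⇒≤ 0<d) d≤1-x (ℚ.<⇒≤ 0<d) d≤1-x)
           (≤-offset _ (0≤p² (0ℚ ℚ.- y)) refl))
      w≤ρ
      where
      open +-*-Solver
      0<σ : 0ℚ ℚ.< 1ℚ ℚ.- d
      0<σ = subst (0ℚ ℚ.<_) (solve 1 (λ r → con ℚ.½ :+ con ℚ.½ :* r := con 1ℚ :- con ℚ.½ :* (con 1ℚ :- r)) refl ρ)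
        (ℚ.+-mono-<-≤ (ℚ.positive⁻¹ ℚ.½) (0≤* (ℚ.<⇒≤ (ℚ.positive⁻¹ ℚ.½)) 0≤ρ))

    normSq-inverse : ∃[ y ] (normSq (1# - w) *ᴿ y) ≈ᴿ 1ᴿ
    normSq-inverse = realInverse (normSq (1# - w)) (0<* 0<d 0<d) normSq-1-w

  opaque
    [1-w]⁻¹ : ℂ
    [1-w]⁻¹ = proj₁ (complexInverse (1# - w) (proj₁ normSq-inverse) (proj₂ normSq-inverse))

    [1-w]-inverse : [1-w]⁻¹ * (1# - w) ≈ 1#
    [1-w]-inverse = proj₂ (complexInverse (1# - w) (proj₁ normSq-inverse) (proj₂ normSq-inverse))

-- The modulus of ξ^f q^{fh} and the decay of its powers

normSq-* : ∀ z w m → seq (normSq (z * w)) m ≡ seq (normSq z) m ℚ.* seq (normSq w) m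
normSq-* z w m = solve 4 (λ a b c d →
    (a :* c :+ :- (b :* d)) :* (a :* c :+ :- (b :* d)) :+ (a :* d :+ b :* c) :* (a :* d :+ b :* c)
      := (a :* a :+ b :* b) :* (c :* c :+ d :* d))
  refl (seq (re z) m) (seq (im z) m) (seq (re w) m) (seq (im w) m)
  where open +-*-Solver

normSq-^ : ∀ z k m → seq (normSq (z ^ k)) m ≡ seq (normSq z) m ^ℚ k
normSq-^ z zero    m = refl
normSq-^ z (suc k) m = trans (normSq-* z (z ^ k) m) (cong (seq (normSq z) m ℚ.*_) (normSq-^ z k m))

0≤normSq : ∀ z m → 0ℚ ℚ.≤ seq (normSq z) m
0≤normSq z m = 0≤+ (0≤p² (seq (re z) m)) (0≤p² (seq (im z) m))

normSq-cong : ∀ {z w} → z ≈ w → seq (normSq z) Lim.∼ seq (normSq w)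
normSq-cong {z} {w} (p , q) = ≈ᴿ⇒∼ {normSq z} {normSq w}
  (+ᴿ-cong {re z *ᴿ re z} {re w *ᴿ re w} {im z *ᴿ im z} {im w *ᴿ im w}
    (*ᴿ-cong {re z} {re w} {re z} {re w} p p) (*ᴿ-cong {im z} {im w} {im z} {im w} q q))

-- Taking powers moves a nonnegative number away from 1, on the side where it is. So a root of unity
-- is seen to have modulus 1 without extracting roots.
∣p-1∣≤∣p^k-1∣ : ∀ {p} k → 0ℚ ℚ.≤ p → ℚ.∣ p ℚ.- 1ℚ ∣ ℚ.≤ ℚ.∣ p ^ℚ suc k ℚ.- 1ℚ ∣
∣p-1∣≤∣p^k-1∣ {p} k 0≤p = case ℚ.≤-total p 1ℚ of λ where
  (inj₁ p≤1) → subst₂ ℚ._≤_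
    (trans (sym (ℚ.0≤p⇒∣p∣≡p (p≤q⇒0≤q-p p≤1))) (∣p-q∣≡∣q-p∣ 1ℚ p))
    (trans (sym (ℚ.0≤p⇒∣p∣≡p (p≤q⇒0≤q-p (ℚ.≤-trans (^suc-≤ k 0≤p p≤1) p≤1)))) (∣p-q∣≡∣q-p∣ 1ℚ (p ^ℚ suc k)))
    (ℚ.+-monoʳ-≤ 1ℚ (ℚ.neg-antimono-≤ (^suc-≤ k 0≤p p≤1)))
  (inj₂ 1≤p) → subst₂ ℚ._≤_
    (sym (ℚ.0≤p⇒∣p∣≡p (p≤q⇒0≤q-p 1≤p)))
    (sym (ℚ.0≤p⇒∣p∣≡p (p≤q⇒0≤q-p (1≤^ (suc k) 1≤p))))
    (ℚ.+-monoˡ-≤ (ℚ.- 1ℚ) (subst (ℚ._≤ p ^ℚ suc k) (ℚ.*-identityʳ p) (*-monoʳ-≤ 0≤p (1≤^ k 1≤p))))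

normSq-rootOfUnity : ∀ ξ → IsRootOfUnity ξ → seq (normSq ξ) Lim.∼ (λ _ → 1ℚ)
normSq-rootOfUnity ξ (suc k , _ , ξᵏ≈1) = Lim.null-dominated
  {v = λ m → seq (normSq (ξ ^ suc k)) m ℚ.- 1ℚ}
  (λ m → subst (λ p → ℚ.∣ seq (normSq ξ) m ℚ.- 1ℚ ∣ ℚ.≤ ℚ.∣ p ℚ.- 1ℚ ∣) (sym (normSq-^ ξ (suc k) m))
    (∣p-1∣≤∣p^k-1∣ k (0≤normSq ξ m)))
  (normSq-cong {ξ ^ suc k} {1#} ξᵏ≈1)

∼-^ : ∀ {u : ℕ → ℚ} k → u Lim.∼ (λ _ → 1ℚ) → (λ m → u m ^ℚ k) Lim.∼ (λ _ → 1ℚ)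
∼-^ zero    u∼1 = Lim.∼-refl {λ _ → 1ℚ}
∼-^ {u} (suc k) u∼1 = Lim.∼-* {u} {λ _ → 1ℚ} {λ m → u m ^ℚ k} {λ _ → 1ℚ}
  (Lim.bounded-const 1ℚ) (Lim.∼-bounded {v = λ _ → 1ℚ} (∼-^ k u∼1) (Lim.bounded-const 1ℚ)) u∼1 (∼-^ k u∼1)

normSq<1 : ∀ q r → IsModulus q r → 0ᴿ <ᴿ r → r <ᴿ 1ᴿ →
  ∃[ ρ ] (0ℚ ℚ.≤ ρ × ρ ℚ.< 1ℚ × Lim.Eventually (λ m → seq (normSq q) m ℚ.≤ ρ))
normSq<1 q r (_ , r²≈) (δ , 0<δ , 0<r) (ε , 0<ε , r<1) = ρ , 0≤ρ
  , subst₂ ℚ._<_ (ℚ.+-identityʳ ρ) (solve 1 (λ e → con 1ℚ :- con ℚ.½ :* e :+ con ℚ.½ :* e := con 1ℚ) refl ε)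
      (ℚ.+-monoʳ-< ρ (½* 0<ε))
  , eventually
  where
  open +-*-Solver
  -- Eventually r ≤ 1 - ε, and therefore r² ≤ 1 - ε. The remaining ε/2 absorbs the difference
  -- between the approximations of r² and of the squared modulus.
  ρ = 1ℚ ℚ.- ℚ.½ ℚ.* ε
  near : Lim.Eventually (λ m → ℚ.∣ seq r m ℚ.* seq r m ℚ.- seq (normSq q) m ∣ ℚ.≤ ℚ.½ ℚ.* ε)
  near = ≈ᴿ⇒∼ {r *ᴿ r} {normSq q} r²≈ (ℚ.½ ℚ.* ε) (½* 0<ε)
  eventually : Lim.Eventually (λ m → seq (normSq q) m ℚ.≤ ρ)
  eventually = Lim.map₂ (λ m (0≤ , ≤1) near → begin
      seq (normSq q) m
        ≡⟨ solve 2 (λ n s → n := s :+ (n :- s)) refl (seq (normSq q) m) (seq r m ℚ.* seq r m) ⟩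
      seq r m ℚ.* seq r m ℚ.+ (seq (normSq q) m ℚ.- seq r m ℚ.* seq r m)
        ≤⟨ ℚ.+-mono-≤ (*-mono-≤ (0≤r 0≤) (r≤1-ε ≤1) (0≤r 0≤) (ℚ.≤-trans (r≤1-ε ≤1) 1-ε≤1))
             (ℚ.≤-trans (p≤∣p∣ _) (subst (ℚ._≤ ℚ.½ ℚ.* ε) (∣p-q∣≡∣q-p∣ (seq r m ℚ.* seq r m) (seq (normSq q) m)) near)) ⟩
      (1ℚ ℚ.- ε) ℚ.* 1ℚ ℚ.+ ℚ.½ ℚ.* ε
        ≡⟨ solve 1 (λ e → (con 1ℚ :- e) :* con 1ℚ :+ con ℚ.½ :* e := con 1ℚ :- con ℚ.½ :* e) refl ε ⟩
      ρ  ∎)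
    (Lim.map₂ (λ m p q → p , q) 0<r r<1) near
    where
    open ℚ.≤-Reasoning
    0≤r : ∀ {m} → 0ℚ ℚ.+ δ ℚ.≤ seq r m → 0ℚ ℚ.≤ seq r m
    0≤r = ℚ.≤-trans (0≤+ ℚ.≤-refl (ℚ.<⇒≤ 0<δ))
    r≤1-ε : ∀ {m} → seq r m ℚ.+ ε ℚ.≤ 1ℚ → seq r m ℚ.≤ 1ℚ ℚ.- ε
    r≤1-ε {m} r+ε≤1 = ≤-offset _ (p≤q⇒0≤q-p r+ε≤1)
      (solve 2 (λ r e → r :+ (con 1ℚ :- (r :+ e)) := con 1ℚ :- e) refl (seq r m) ε)
    1-ε≤1 : 1ℚ ℚ.- ε ℚ.≤ 1ℚ
    1-ε≤1 = ≤-offset ε (ℚ.<⇒≤ 0<ε) (solve 1 (λ e → con 1ℚ :- e :+ e := con 1ℚ) refl ε)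
  0≤ρ : 0ℚ ℚ.≤ ρ
  0≤ρ = ℚ.≤-trans (0≤normSq q (proj₁ eventually)) (proj₂ eventually (proj₁ eventually) ℕ.≤-refl)

normSq-ξᶠqᶠʰ<1 : ∀ q r → IsModulus q r → 0ᴿ <ᴿ r → r <ᴿ 1ᴿ → ∀ ξ → IsRootOfUnity ξ →
  ∀ f h .{{_ : NonZero f}} .{{_ : NonZero h}} →
  ∃[ ρ ] (0ℚ ℚ.≤ ρ × ρ ℚ.< 1ℚ × Lim.Eventually (λ m → seq (normSq (ξ ^ f * (q ^ f) ^ h)) m ℚ.≤ ρ))
normSq-ξᶠqᶠʰ<1 q r mod 0<r r<1 ξ root f@(suc f-1) h@(suc h-1) = σ , 0≤σ , σ<1
  , Lim.map₂ (λ m q≤ρ ξ≤1+η → begin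
      seq (normSq (ξ ^ f * (q ^ f) ^ h)) m
        ≡⟨ normSq-* (ξ ^ f) ((q ^ f) ^ h) m ⟩
      seq (normSq (ξ ^ f)) m ℚ.* seq (normSq ((q ^ f) ^ h)) m
        ≡⟨ cong₂ ℚ._*_ (normSq-^ ξ f m) (trans (normSq-^ (q ^ f) h m) (cong (_^ℚ h) (normSq-^ q f m))) ⟩
      seq (normSq ξ) m ^ℚ f ℚ.* (seq (normSq q) m ^ℚ f) ^ℚ h
        ≤⟨ *-mono-≤ (^-nonNeg f (0≤normSq ξ m)) (ℚ.≤-trans (≤-offset _ (p≤q⇒0≤q-p (ℚ.≤-trans (p≤∣p∣ _) ξ≤1+η))
               (solve 2 (λ x η → x :+ (η :- (x :- con 1ℚ)) := con 1ℚ :+ η) refl (seq (normSq ξ) m ^ℚ f) η)) ℚ.≤-refl)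
             (^-nonNeg h (^-nonNeg f (0≤normSq q m))) (power≤ m q≤ρ) ⟩
      (1ℚ ℚ.+ η) ℚ.* ρ
        ≤⟨ ≤-offset (η ℚ.* (1ℚ ℚ.- ρ)) (0≤* (ℚ.<⇒≤ 0<η) (p≤q⇒0≤q-p (ℚ.<⇒≤ ρ<1)))
             (solve 2 (λ r η → (con 1ℚ :+ η) :* r :+ η :* (con 1ℚ :- r) := r :+ η) refl ρ η) ⟩
      σ  ∎)
    (proj₂ (proj₂ (proj₂ bound))) (∼-^ {seq (normSq ξ)} f (normSq-rootOfUnity ξ root) η 0<η)
  where
  open ℚ.≤-Reasoning
  open +-*-Solver
  bound = normSq<1 q r mod 0<r r<1
  ρ = proj₁ bound
  0≤ρ = proj₁ (proj₂ bound)
  ρ<1 = proj₁ (proj₂ (proj₂ bound))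
  -- The approximations of ∣ξ^f∣² are eventually at most 1 + η, but need not be at most 1. For this
  -- η one has (1 + η) ρ ≤ ρ + η = (1 + ρ)/2 < 1.
  η = ℚ.½ ℚ.* (1ℚ ℚ.- ρ)
  0<1-ρ : 0ℚ ℚ.< 1ℚ ℚ.- ρ
  0<1-ρ = subst (ℚ._< 1ℚ ℚ.- ρ) (ℚ.+-inverseʳ ρ) (ℚ.+-monoˡ-< (ℚ.- ρ) ρ<1)
  0<η : 0ℚ ℚ.< η
  0<η = ½* 0<1-ρ
  σ = ρ ℚ.+ η
  0≤σ : 0ℚ ℚ.≤ σ
  0≤σ = 0≤+ 0≤ρ (ℚ.<⇒≤ 0<η)
  σ<1 : σ ℚ.< 1ℚ
  σ<1 = subst (σ ℚ.<_) (solve 1 (λ r → r :+ (con 1ℚ :- r) := con 1ℚ) refl ρ) (ℚ.+-monoʳ-< ρ (½*-< 0<1-ρ))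
  power≤ : ∀ m → seq (normSq q) m ℚ.≤ ρ → (seq (normSq q) m ^ℚ f) ^ℚ h ℚ.≤ ρ
  power≤ m q≤ρ = ℚ.≤-trans
    (^suc-≤ h-1 (^-nonNeg f (0≤normSq q m)) (^-≤1 f (0≤normSq q m) (ℚ.≤-trans q≤ρ (ℚ.<⇒≤ ρ<1))))
    (ℚ.≤-trans (^suc-≤ f-1 (0≤normSq q m) (ℚ.≤-trans q≤ρ (ℚ.<⇒≤ ρ<1))) q≤ρ)

-- ∣wᴺ e_k(z + N)∣² ≤ ρᴺ (N + 1)^{2k} / k!²
powers-null : ∀ {w ρ z} → 0ℚ ℚ.≤ ρ → ρ ℚ.< 1ℚ → Lim.Eventually (λ m → seq (normSq w) m ℚ.≤ ρ) →
  0ℚ ℚ.≤ z → z ℚ.≤ 1ℚ → ∀ k → Nullᶜ (λ N → w ^ N * ℚ→ℂ (e (z ℚ.+ ι N) k))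
powers-null {w} {ρ} {z} 0≤ρ ρ<1 (M , w≤ρ) 0≤z z≤1 k =
    (λ ε 0<ε → proj₁ (small ε 0<ε) , λ n N≤n → M , λ m M≤m →
      p²≤q²⇒∣p∣≤q 0<ε (ℚ.≤-trans (≤-offset _ (0≤p² (seq (im (V n)) m)) refl) (proj₂ (small ε 0<ε) n N≤n m M≤m)))
  , (λ ε 0<ε → proj₁ (small ε 0<ε) , λ n N≤n → M , λ m M≤m →
      p²≤q²⇒∣p∣≤q 0<ε (ℚ.≤-trans (≤-offset _ (0≤p² (seq (re (V n)) m)) (ℚ.+-comm (seq (im (V n)) m ℚ.* seq (im (V n)) m) _))
        (proj₂ (small ε 0<ε) n N≤n m M≤m)))
  where
  V : ℕ → ℂ
  V n = w ^ n * ℚ→ℂ (e (z ℚ.+ ι n) k)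
  r = 1/! k
  -- One power of n + 1 more than the estimate contains: boundedness with exponent 2k + 1 makes the
  -- quantity with exponent 2k at most a constant over n + 1.
  decay = geometric-beats-power 0≤ρ ρ<1 (suc (k ℕ.+ k))
  C = proj₁ decay
  N₁ = proj₁ (proj₂ decay)
  small : ∀ ε → 0ℚ ℚ.< ε → ∃[ N ] (∀ n → N ℕ.≤ n → ∀ m → M ℕ.≤ m → seq (normSq (V n)) m ℚ.≤ ε ℚ.* ε)
  small ε 0<ε = N₁ ℕ.⊔ N₂ , λ n N≤n m M≤m → *-cancelʳ-≤ (0<ι (suc n)) (begin
    seq (normSq (V n)) m ℚ.* ι (suc n)
      ≡⟨ cong (ℚ._* ι (suc n)) (trans (normSq-* (w ^ n) (ℚ→ℂ (c n)) m) (cong (ℚ._* (c n ℚ.* c n ℚ.+ 0ℚ ℚ.* 0ℚ)) (normSq-^ w n m))) ⟩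
    seq (normSq w) m ^ℚ n ℚ.* (c n ℚ.* c n ℚ.+ 0ℚ ℚ.* 0ℚ) ℚ.* ι (suc n)
      ≤⟨ *-monoˡ-≤ (0≤ι (suc n)) (*-mono-≤ (^-nonNeg n (0≤normSq w m)) (^-mono-≤ n (0≤normSq w m) (w≤ρ m M≤m))
           (0≤+ (0≤p² (c n)) ℚ.≤-refl) (ℚ.+-mono-≤ (*-mono-≤ (0≤c n) (c≤ n) (0≤c n) (c≤ n)) ℚ.≤-refl)) ⟩
    ρ ^ℚ n ℚ.* (L n ℚ.* r ℚ.* (L n ℚ.* r) ℚ.+ 0ℚ ℚ.* 0ℚ) ℚ.* ι (suc n)
      ≡⟨ solve 4 (λ p l r i → p :* (l :* r :* (l :* r) :+ con 0ℚ :* con 0ℚ) :* i := p :* (i :* (l :* l)) :* (r :* r))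
           refl (ρ ^ℚ n) (L n) r (ι (suc n)) ⟩
    ρ ^ℚ n ℚ.* (ι (suc n) ℚ.* (L n ℚ.* L n)) ℚ.* (r ℚ.* r)
      ≡⟨ cong (λ p → ρ ^ℚ n ℚ.* (ι (suc n) ℚ.* p) ℚ.* (r ℚ.* r)) (^-homo-* (ι (suc n)) k k) ⟨
    ρ ^ℚ n ℚ.* ι (suc n) ^ℚ suc (k ℕ.+ k) ℚ.* (r ℚ.* r)
      ≤⟨ *-monoˡ-≤ (0≤p² r) (proj₂ (proj₂ decay) n (ℕ.m⊔n≤o⇒m≤o N₁ N₂ N≤n)) ⟩
    C ℚ.* (r ℚ.* r)
      ≤⟨ proj₂ (archimedean-* (C ℚ.* (r ℚ.* r)) (0<* 0<ε 0<ε)) (suc n) (ℕ.m≤n⇒m≤1+n (ℕ.m⊔n≤o⇒n≤o N₁ N₂ N≤n)) ⟩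
    ε ℚ.* ε ℚ.* ι (suc n)  ∎)
    where
    open ℚ.≤-Reasoning
    open +-*-Solver
    open Algebra.Properties.CommutativeSemiring.Exp (CommutativeRing.commutativeSemiring ℚ.+-*-commutativeRing)
      using (^-homo-*)
    N₂ = proj₁ (archimedean-* (C ℚ.* (r ℚ.* r)) (0<* 0<ε 0<ε))
    c L : ℕ → ℚ
    c n = e (z ℚ.+ ι n) k
    L n = ι (suc n) ^ℚ k
    0≤c : ∀ n → 0ℚ ℚ.≤ c n
    0≤c n = e-nonNeg (0≤+ 0≤z (0≤ι n)) k
    c≤ : ∀ n → c n ℚ.≤ L n ℚ.* r
    c≤ n = e-mono-≤ (0≤+ 0≤z (0≤ι n)) (subst (z ℚ.+ ι n ℚ.≤_) (sym (ι-suc n)) (ℚ.+-monoˡ-≤ (ι n) z≤1)) k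

-- Transfer between the definitions and the opaque ring

open import Algebra.Properties.Semiring.Exp ℂᶜ.semiring using () renaming (_^_ to _^ᶜ_)

-- The parts of the statement as functions of variables, since deciding whether compound
-- complex numbers such as ξ ^ f are equal by definition unfolds their Cauchy sequences.

twistedSummand : (h : ℕ) (ξ q : ℂ) (p : ℕ → ℂ) → ℕ → ℂ
twistedSummand h ξ q p i = q ^ (suc i ℕ.* h) * ξ ^ suc i * p i

twistedTerm : (h : ℕ) (ξ q : ℂ) (a f : ℕ) (p : ℕ → ℂ) → ℕ → ℂ
twistedTerm h ξ q a f p i = if does (f ∣? ℕ.∣ suc i - a ∣)
                            then q ^ (suc i ℕ.* h) * ξ ^ suc i * p i
                            else 0#

prodPow : ℂ → ℂ → ℕ → ℂ
prodPow x y n = x * y ^ n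

IsProdPow : ℂ → ℂ → ℕ → ℂ → Set
IsProdPow x y n w = w ≡ x * y ^ n

denominator : ℂ → PowerSeries
denominator w = const w ⊛ exp[t 1# ] ⊕ const (- 1#)

numerator : (h : ℕ) (ℓ z : ℂ) → PowerSeries
numerator h ℓ z = (t ⊕ const (ℕ→ℂ h * ℓ)) ⊛ exp[t z ]

bernoulli-relation : ∀ {h x y ℓ z B w} → IsProdPow x y h w → AreTwistedBernoulli h x y ℓ z B →
  denominator w ⊛ egf B ≋ numerator h ℓ z
bernoulli-relation refl bern = bern

IsPowerOfq : (q : ℂ) (h i : ℕ) → ℂ → Set
IsPowerOfq q h i x = x ≡ q ^ (suc i ℕ.* h)

IsPowerOfξ : (ξ : ℂ) (i : ℕ) → ℂ → Set
IsPowerOfξ ξ i x = x ≡ ξ ^ suc i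

IsProduct : (q ξ : ℂ) (h i : ℕ) → ℂ → Set
IsProduct q ξ h i x = x ≡ q ^ (suc i ℕ.* h) * ξ ^ suc i

opaque
  unfolding _≈ᶜ_

  ≈⇒≈ᶜ : ∀ {z w} → z ≈ w → z ≈ᶜ w
  ≈⇒≈ᶜ z≈w = z≈w

  ≈ᶜ⇒≈ : ∀ {z w} → z ≈ᶜ w → z ≈ w
  ≈ᶜ⇒≈ z≈w = z≈w

  -ᶜ-≡ : ∀ z → -ᶜ z ≡ - z
  -ᶜ-≡ z = refl

  ^ᶜ-≡ : ∀ z n → z ^ᶜ n ≡ z ^ n
  ^ᶜ-≡ z n = refl

  ^*-≡ : ∀ x n y {x′} → x′ ≡ x ^ n → x′ *ᶜ y ≡ x ^ n * y
  ^*-≡ x n y refl = refl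

  powers : ∀ {q ξ h i x y} → IsPowerOfq q h i x → IsPowerOfξ ξ i y → IsProduct q ξ h i (x *ᶜ y)
  powers refl refl = refl

  twistedSummand-≡ : ∀ {h ξ q i x} p → IsProduct q ξ h i x → x *ᶜ p i ≡ twistedSummand h ξ q p i
  twistedSummand-≡ p refl = refl

  expCoeffᶜ : ∀ z k → expCoeff z k ≈ᶜ z ^ᶜ k *ᶜ ℚ→ℂ (1/ k !)
  expCoeffᶜ z k = ℂ-Ring.refl {expCoeff z k}

  ℕ→ℂ-*≈ : ∀ f ℓ L → L ≡ ℕ→ℂ f * ℓ → L ≈ᶜ ℕ→ℂ f *ᶜ ℓ
  ℕ→ℂ-*≈ f ℓ _ refl = ℂ-Ring.refl {ℕ→ℂ f * ℓ}

  prodPow≈ : ∀ x y n {x′ y′} → x′ ≡ x → y′ ≡ y → prodPow x y n ≈ᶜ x′ *ᶜ y′ ^ᶜ n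
  prodPow≈ x y n refl refl = ℂ-Ring.refl {prodPow x y n}

  denominator≈ : ∀ w k → denominator w k ≈ᶜ (const w ℂᴳ.⋆ exp[t 1# ]) k +ᶜ const (- 1#) k
  denominator≈ w k = ℂ-Ring.refl {denominator w k}

  numerator≈ : ∀ h ℓ z k → numerator h ℓ z k ≈ᶜ ((t ⊕ const (ℕ→ℂ h * ℓ)) ℂᴳ.⋆ exp[t z ]) k
  numerator≈ h ℓ z k = ℂ-Ring.refl {numerator h ℓ z k}

  t⊕const-0 : ∀ n ℓ → (t ⊕ const (ℕ→ℂ n * ℓ)) 0 ≈ᶜ ℕ→ℂ n *ᶜ ℓ
  t⊕const-0 n ℓ = ℂ-Ring.+-identityˡ (ℕ→ℂ n * ℓ)

  t⊕const-1 : ∀ c → (t ⊕ const c) 1 ≈ᶜ 1#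
  t⊕const-1 c = ℂ-Ring.+-identityʳ 1#

  t⊕const-2+ : ∀ c k → (t ⊕ const c) (suc (suc k)) ≈ᶜ 0#
  t⊕const-2+ c k = ℂ-Ring.+-identityˡ 0#

  egf≈ : ∀ B k → egf B k ≈ᶜ B k *ᶜ ℚ→ℂ (1/ k !)
  egf≈ B k = ℂ-Ring.refl {egf B k}

  product-≈ : ∀ qᶜ q′ ξᶜ ξ′ Fᶜ F′ b I → qᶜ ≡ q′ → ξᶜ ≡ ξ′ → Fᶜ ≡ F′ →
    - (q′ * ξ′ * F′ * b * I) ≈ -ᶜ (qᶜ *ᶜ ξᶜ *ᶜ Fᶜ *ᶜ b *ᶜ I)
  product-≈ q′ .q′ ξ′ .ξ′ F′ .F′ b I refl refl refl = ℂ-Ring.refl { - (q′ * ξ′ * F′ * b * I)}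

  value-≈ : ∀ S H ℓ I T → (S ℂᶜ.- H *ᶜ ℓ *ᶜ (-ᶜ I) *ᶜ T) ≈ S - (H * ℓ) * (- I) * T
  value-≈ S H ℓ I T = ℂ-Ring.refl {S - (H * ℓ) * (- I) * T}

  inverseᶜ : ∀ u w → u * (1# - w) ≈ 1# → u *ᶜ (1# ℂᶜ.- w) ≈ᶜ 1#
  inverseᶜ u w p = p

  hasSumᶜ : ∀ {u S} → Nullᶜ (λ n → ℂᴳ.∑ n u ℂᶜ.- S) → HasSum u S
  hasSumᶜ {u} {S} = hasSum {u} {S}

  ⋆≈⊛ : ∀ F G n → (F ℂᴳ.⋆ G) n ≈ᶜ (F ⊛ G) n
  ⋆≈⊛ F G n = ℂ-Ring.refl {(F ⊛ G) n}

∑-cong-≡ : ∀ (u v : ℕ → ℂ) → (∀ i → u i ≡ v i) → ∀ n → sum {n} (λ i → u (toℕ i)) ≡ sum {n} (λ i → v (toℕ i))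
∑-cong-≡ u v u≡v zero    = refl
∑-cong-≡ u v u≡v (suc n) = cong₂-+ (u 0) (v 0) _ _ (u≡v 0) (∑-cong-≡ (u ∘ suc) (v ∘ suc) (u≡v ∘ suc) n)
  where
  cong₂-+ : ∀ x x′ y y′ → x ≡ x′ → y ≡ y′ → x + y ≡ x′ + y′
  cong₂-+ x .x y .y refl refl = refl

hasSum-≡ : ∀ (u v : ℕ → ℂ) S → (∀ i → u i ≡ v i) → HasSum u S → HasSum v S
hasSum-≡ u v S u≡v hs ε 0<ε = proj₁ (hs ε 0<ε) , λ n N≤n →
  transfer (sum {n} (λ i → u (toℕ i))) (sum {n} (λ i → v (toℕ i))) (∑-cong-≡ u v u≡v n) (proj₂ (hs ε 0<ε) n N≤n)
  where
  transfer : ∀ x y → x ≡ y → normSq (x - S) <ᴿ ℚ→ℝ (ε ℚ.* ε) → normSq (y - S) <ᴿ ℚ→ℝ (ε ℚ.* ε)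
  transfer x .x refl p = p

Nullᶜ-≡ : ∀ (u v : ℕ → ℂ) → (∀ n → u n ≡ v n) → Nullᶜ u → Nullᶜ v
Nullᶜ-≡ u v u≡v (nr , ni) =
    Lim².null-cong (λ (n , m) → cong (λ z → seq (re z) m) (sym (u≡v n))) nr
  , Lim².null-cong (λ (n , m) → cong (λ z → seq (im z) m) (sym (u≡v n))) ni

expCoeff-ℚ : ∀ p k → expCoeff (ℚ→ℂ p) k ≈ᶜ ℚ→ℂ (e p k)
expCoeff-ℚ p k = ℂᶜ.trans
  (expCoeffᶜ (ℚ→ℂ p) k)
  (ℂᶜ.trans (ℂᶜ.*-cong (ℂᶜ.sym (ℂᴳ.φ-^ p k)) (ℂᶜ.reflexive (cong ℚ→ℂ (sym (1/!-def k)))))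
    (ℂᶜ.sym (ℚ→ℂ-homo-* (p ^ℚ k) (1/! k))))

-- Twisted sums and Bernoulli numbers in ℂ

module TwistedSums (q ξ w : ℂ) (h a f : ℕ) (0<a : 0 ℕ.< a) (a<f : a ℕ.< f) (w≈ : w ≈ᶜ ξ ^ᶜ f *ᶜ (q ^ᶜ f) ^ᶜ h)
  (z : ℚ) (z*f≡a : z ℚ.* ι f ≡ ι a)
  {ρ : ℚ} (0≤ρ : 0ℚ ℚ.≤ ρ) (ρ<1 : ρ ℚ.< 1ℚ) (w≤ρ : Lim.Eventually (λ m → seq (normSq w) m ℚ.≤ ρ)) where

  open ℂᴳ.Progression q ξ h a f 0<a a<f w w≈ z z*f≡a
  open Residues a f 0<a a<f using (count; count→∞)
  open ℂᴳ.Truncation w z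

  private
    0<ιf : 0ℚ ℚ.< ι f
    0<ιf = 0<ι f {{ℕ.>-nonZero (ℕ.<-trans 0<a a<f)}}

    0≤z : 0ℚ ℚ.≤ z
    0≤z = *-cancelʳ-≤ 0<ιf (subst₂ ℚ._≤_ (sym (ℚ.*-zeroˡ (ι f))) (sym z*f≡a) (0≤ι a))

    z≤1 : z ℚ.≤ 1ℚ
    z≤1 = *-cancelʳ-≤ 0<ιf (subst₂ ℚ._≤_ (sym z*f≡a) (sym (ℚ.*-identityˡ (ι f))) (ι-mono-≤ (ℕ.<⇒≤ a<f)))

    u : ℂ
    u = [1-w]⁻¹ {w} ρ<1 w≤ρ

    u*[1-w]≈1 : u *ᶜ (1# ℂᶜ.- w) ≈ᶜ 1#
    u*[1-w]≈1 = inverseᶜ u w ([1-w]-inverse {w} ρ<1 w≤ρ)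

    V-null : ∀ k → Nullᶜ (λ N → V N k)
    V-null k = Nullᶜ-≡ (λ N → w ^ N * ℚ→ℂ (e (z ℚ.+ ι N) k)) (λ N → V N k)
      (λ N → sym (^*-≡ w N (ℚ→ℂ (e (z ℚ.+ ι N) k)) (^ᶜ-≡ w N)))
      (powers-null {w} 0≤ρ ρ<1 w≤ρ 0≤z z≤1 k)

  open ℂᴳ.PartialSums w u u*[1-w]≈1 z
  open Limit ℂ-nullity V-null public

  -- The n-th partial sum is `factor k` times `P (count n) k`. Since `count` tends to infinity, it
  -- has the same limit as `factor k` times `P n k`.
  twistedSum : ∀ {s} k → - s ≈ ℚ→ℂ (ι k) → IsTwistedSum h ξ q a f s (factor k *ᶜ g k)
  twistedSum {s} k -s≈k = p , (λ i → isPower (suc i) { - s} k -s≈k)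
    , hasSum-≡ (term k) (twistedTerm h ξ q a f p) (factor k *ᶜ g k)
        (λ i → cong (if does (f ∣? ℕ.∣ suc i - a ∣) then_else 0#)
          (twistedSummand-≡ {h} {ξ} {q} {i} p (powers {q} {ξ} {h} {i} (^ᶜ-≡ q (suc i ℕ.* h)) (^ᶜ-≡ ξ (suc i)))))
        (hasSumᶜ {term k} {factor k *ᶜ g k} error-null)
    where
    p : ℕ → ℂ
    p i = ℚ→ℂ (ι (suc i) ^ℚ k)
    open ℂᴳ.Submodule Nullᶜ-submodule
    reindexed : Nullᶜ (λ n → P (count n) k ℂᶜ.- g k)
    reindexed = null-reindex {λ (n , m) → seq (re (P n k ℂᶜ.- g k)) m} count count→∞ (proj₁ (P→g k))
              , null-reindex {λ (n , m) → seq (im (P n k ℂᶜ.- g k)) m} count count→∞ (proj₂ (P→g k))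
    error-null : Nullᶜ (λ n → ℂᴳ.∑ n (term k) ℂᶜ.- factor k *ᶜ g k)
    error-null = resp (partialSum-error k (g k)) (mul (factor k) reindexed)

  module _ (x y L : ℂ) (w-def : IsProdPow x y h w) (B : ℕ → ℂ) (bern : AreTwistedBernoulli h x y L (ℚ→ℂ z) B) where

    private
      cᶜ : ℂ
      cᶜ = ℕ→ℂ h *ᶜ L

      b : ℕ → ℂ
      b k = B k *ᶜ ℚ→ℂ (1/! k)

      T : PowerSeries
      T = t ⊕ const (ℕ→ℂ h * L)

      b≈egf : ∀ k → b k ≈ᶜ egf B k
      b≈egf k = ℂᶜ.trans (ℂᶜ.reflexive (cong (λ r → B k *ᶜ ℚ→ℂ r) (1/!-def k))) (ℂᶜ.sym (egf≈ B k))

      δ≈ : ∀ k → δ k ≈ᶜ const (- 1#) k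
      δ≈ zero    = ℂᶜ.reflexive (-ᶜ-≡ 1#)
      δ≈ (suc k) = ℂᶜ.refl

      A≈denominator : ∀ k → A k ≈ᶜ denominator w k
      A≈denominator k = begin
        w *ᶜ ℚ→ℂ (e 1ℚ k) +ᶜ δ k
          ≈⟨ ℂᶜ.+-cong (ℂᶜ.*-congˡ (ℂᶜ.sym (expCoeff-ℚ 1ℚ k))) (δ≈ k) ⟩
        w *ᶜ exp[t 1# ] k +ᶜ const (- 1#) k
          ≈⟨ ℂᶜ.+-congʳ (ℂᴳ.⋆-constantˡ (const w) exp[t 1# ] (λ _ → ℂᶜ.refl) k) ⟨
        (const w ℂᴳ.⋆ exp[t 1# ]) k +ᶜ const (- 1#) k
          ≈⟨ denominator≈ w k ⟨
        denominator w k  ∎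
        where open Relation.Binary.Reasoning.Setoid ℂᶜ.setoid

      A⋆b≈ : ∀ k → (A ℂᴳ.⋆ b) k ≈ᶜ ℂᴳ.[t+ cᶜ ] (ℚ→ℂ ∘ e z) k
      A⋆b≈ k = begin
        (A ℂᴳ.⋆ b) k
          ≈⟨ ℂᴳ.⋆-cong A≈denominator b≈egf k ⟩
        (denominator w ℂᴳ.⋆ egf B) k
          ≈⟨ ⋆≈⊛ (denominator w) (egf B) k ⟩
        (denominator w ⊛ egf B) k
          ≈⟨ ≈⇒≈ᶜ {(denominator w ⊛ egf B) k} {numerator h L (ℚ→ℂ z) k}
               (bernoulli-relation {h} {x} {y} {L} {ℚ→ℂ z} {B} {w} w-def bern k) ⟩
        numerator h L (ℚ→ℂ z) k
          ≈⟨ numerator≈ h L (ℚ→ℂ z) k ⟩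
        (T ℂᴳ.⋆ exp[t ℚ→ℂ z ]) k
          ≈⟨ ℂᴳ.[t+]-⋆ cᶜ T exp[t ℚ→ℂ z ] (t⊕const-0 h L) (t⊕const-1 (ℕ→ℂ h * L)) (t⊕const-2+ (ℕ→ℂ h * L)) k ⟩
        ℂᴳ.[t+ cᶜ ] exp[t ℚ→ℂ z ] k
          ≈⟨ ℂᴳ.[t+]-cong cᶜ (expCoeff-ℚ z) k ⟩
        ℂᴳ.[t+ cᶜ ] (ℚ→ℂ ∘ e z) k  ∎
        where open Relation.Binary.Reasoning.Setoid ℂᶜ.setoid

    bernoulli-≈ : ∀ k → B k *ᶜ ℚ→ℂ (1/! k) +ᶜ ℂᴳ.[t+ ℕ→ℂ h *ᶜ L ] g k ≈ᶜ 0#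
    bernoulli-≈ = quotient-≈ cᶜ b A⋆b≈

module ZetaFormula (q ξ w : ℂ) (h a f : ℕ) (0<a : 0 ℕ.< a) (a<f : a ℕ.< f) (w≈ : w ≈ᶜ ξ ^ᶜ f *ᶜ (q ^ᶜ f) ^ᶜ h)
  (z : ℚ) (z*f≡a : z ℚ.* ι f ≡ ι a) where
  open ℂᴳ.Progression q ξ h a f 0<a a<f w w≈ z z*f≡a

  value : ∀ ℓ L m g B p → p ℚ.* ι (suc m) ≡ 1ℚ → L ≈ᶜ ℕ→ℂ f *ᶜ ℓ → (B (suc m) *ᶜ ℚ→ℂ (1/! (suc m)) +ᶜ ℂᴳ.[t+ ℕ→ℂ h *ᶜ L ] g (suc m) ≈ᶜ 0#) →
    - (q ^ (h ℕ.* a) * ξ ^ a * ℕ→ℂ f ^ m * B (suc m) * ℚ→ℂ p)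
      ≈ factor m *ᶜ g m - (ℕ→ℂ h * ℓ) * (- ℚ→ℂ p) * (factor (suc m) *ᶜ g (suc m))
  value ℓ L m g B p p*n≡1 L≈ b≈0 = ℂ-Ring.trans {left} {leftᶜ} {right} left≈ (ℂ-Ring.trans {leftᶜ} {rightᶜ} {right} middle right≈)
    where
    I S T F left leftᶜ right rightᶜ : ℂ
    I = ℚ→ℂ p
    S = factor m *ᶜ g m
    T = factor (suc m) *ᶜ g (suc m)
    F = ℕ→ℂ f
    left   = - (q ^ (h ℕ.* a) * ξ ^ a * F ^ m * B (suc m) * I)
    leftᶜ  = -ᶜ (q ^ᶜ (h ℕ.* a) *ᶜ ξ ^ᶜ a *ᶜ F ^ᶜ m *ᶜ B (suc m) *ᶜ I)
    right  = S - (ℕ→ℂ h * ℓ) * (- I) * T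
    rightᶜ = S ℂᶜ.- ℕ→ℂ h *ᶜ ℓ *ᶜ (-ᶜ I) *ᶜ T
    left≈ : left ≈ leftᶜ
    left≈ = product-≈ (q ^ᶜ (h ℕ.* a)) (q ^ (h ℕ.* a)) (ξ ^ᶜ a) (ξ ^ a) (F ^ᶜ m) (F ^ m) (B (suc m)) I
      (^ᶜ-≡ q (h ℕ.* a)) (^ᶜ-≡ ξ a) (^ᶜ-≡ F m)
    right≈ : rightᶜ ≈ right
    right≈ = value-≈ S (ℕ→ℂ h) ℓ I T
    middle : leftᶜ ≈ rightᶜ
    middle = ≈ᶜ⇒≈ {leftᶜ} {rightᶜ} (value≈ F (ℕ→ℂ h) ℓ m g B I
      (ℂᶜ.reflexive (cong ℚ→ℂ (sym (ι≡/1 f))))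
      (ℂᶜ.trans (ℂᶜ.sym (ℚ→ℂ-homo-* (ι (suc m)) p))
        (ℂᶜ.reflexive (cong ℚ→ℂ (trans (ℚ.*-comm (ι (suc m)) p) p*n≡1))))
      (ℂᶜ.trans (ℂᶜ.+-congˡ (ℂᶜ.+-congˡ (ℂᶜ.*-congʳ (ℂᶜ.*-congˡ (ℂᶜ.sym L≈))))) b≈0))

-- The zeta function at s = 1 - n

module _ (m : ℕ) where
  private
    open +-*-Solver

    n≡ : (+ suc m) ℚ./ 1 ≡ 1ℚ ℚ.+ ι m
    n≡ = trans (sym (ι≡/1 (suc m))) (ι-suc m)

  -[1-n]≈ : - (1# - ℕ→ℂ (suc m)) ≈ ℚ→ℂ (ι m)
  -[1-n]≈ = ≐⇒≈ { - (1# - ℕ→ℂ (suc m))} {ℚ→ℂ (ι m)}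
    (λ _ → trans (cong (λ n → ℚ.- (1ℚ ℚ.- n)) n≡)
      (solve 1 (λ k → :- (con 1ℚ :- (con 1ℚ :+ k)) := k) refl (ι m)))
    (λ _ → refl)

  -[1-n-1]≈ : - (1# - ℕ→ℂ (suc m) - 1#) ≈ ℚ→ℂ (ι (suc m))
  -[1-n-1]≈ = ≐⇒≈ { - (1# - ℕ→ℂ (suc m) - 1#)} {ℚ→ℂ (ι (suc m))}
    (λ _ → trans (cong (λ n → ℚ.- (1ℚ ℚ.- n ℚ.- 1ℚ)) (sym (ι≡/1 (suc m))))
      (solve 1 (λ k → :- (con 1ℚ :- k :- con 1ℚ) := k) refl (ι (suc m))))
    (λ _ → refl)

  reciprocal : ∀ p → p ℚ.* ι (suc m) ≡ 1ℚ → (1# - ℕ→ℂ (suc m) - 1#) * (- ℚ→ℂ p) ≈ 1#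
  reciprocal p p*n≡1 = ≐⇒≈ {(1# - ℕ→ℂ (suc m) - 1#) * (- ℚ→ℂ p)} {1#}
    (λ _ → trans (cong (λ n → (1ℚ ℚ.- n ℚ.- 1ℚ) ℚ.* (ℚ.- p) ℚ.+ ℚ.- ((0ℚ ℚ.- 0ℚ ℚ.- 0ℚ) ℚ.* (ℚ.- 0ℚ))) (sym (ι≡/1 (suc m))))
      (trans (solve 2 (λ n p → (con 1ℚ :- n :- con 1ℚ) :* (:- p) :+ :- (con 0ℚ :* con 0ℚ) := p :* n) refl (ι (suc m)) p)
        p*n≡1))
    (λ _ → solve 2 (λ n p → (con 1ℚ :- n :- con 1ℚ) :* con 0ℚ :+ con 0ℚ :* (:- p) := con 0ℚ) refl ((+ suc m) ℚ./ 1) p)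

prodPow-bound : ∀ q r → IsModulus q r → 0ᴿ <ᴿ r → r <ᴿ 1ᴿ → ∀ ξ → IsRootOfUnity ξ →
  ∀ f h .{{_ : NonZero f}} .{{_ : NonZero h}} → ∀ x y → x ≡ ξ ^ f → y ≡ q ^ f →
  ∃[ ρ ] (0ℚ ℚ.≤ ρ × ρ ℚ.< 1ℚ × Lim.Eventually (λ m → seq (normSq (prodPow x y h)) m ℚ.≤ ρ))
prodPow-bound q r mod 0<r r<1 ξ root f h _ _ refl refl = normSq-ξᶠqᶠʰ<1 q r mod 0<r r<1 ξ root f h

-- Hands the compound numbers over as variables with equations, so that the argument proper only
-- ever compares variables.
generaliseBernoulli : ∀ {h ξ q a f ℓ B} .{{_ : NonZero f}} →
  AreTwistedBernoulli h (ξ ^ f) (q ^ f) (ℕ→ℂ f * ℓ) (ℚ→ℂ ((+ a) ℚ./ f)) B →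
  ∃[ x ] ∃[ y ] ∃[ L ] ∃[ z ] (x ≡ ξ ^ f × y ≡ q ^ f × L ≡ ℕ→ℂ f * ℓ × z ≡ (+ a) ℚ./ f ×
    AreTwistedBernoulli h x y L (ℚ→ℂ z) B)
generaliseBernoulli bern = _ , _ , _ , _ , refl , refl , refl , refl , bern

generaliseZeta : ∀ h ξ q ℓ a f n .{{_ : NonZero n}} (B : ℕ → ℂ) →
  (∀ s v p → s ≡ 1# - ℕ→ℂ n → p ≡ (+ 1) ℚ./ n →
    v ≡ - (q ^ (h ℕ.* a) * ξ ^ a * ℕ→ℂ f ^ (n ∸ 1) * B n * ℚ→ℂ p) →
    IsPartialZeta h ξ q ℓ a f s v) →
  IsPartialZeta h ξ q ℓ a f (1# - ℕ→ℂ n)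
    (- (q ^ (h ℕ.* a) * ξ ^ a * ℕ→ℂ f ^ (n ∸ 1) * B n * ℚ→ℂ ((+ 1) ℚ./ n)))
generaliseZeta h ξ q ℓ a f n B zeta = zeta _ _ _ refl refl refl

module PartialZeta (q ℓ ξ : ℂ) (h a f : ℕ) .{{_ : NonZero f}} (0<a : 0 ℕ.< a) (a<f : a ℕ.< f)
  (z : ℚ) (z*f≡a : z ℚ.* ι f ≡ ι a) (x y L : ℂ) (x≡ : x ≡ ξ ^ f) (y≡ : y ≡ q ^ f) (L≡ : L ≡ ℕ→ℂ f * ℓ)
  {ρ : ℚ} (0≤ρ : 0ℚ ℚ.≤ ρ) (ρ<1 : ρ ℚ.< 1ℚ) (w≤ρ : Lim.Eventually (λ m → seq (normSq (prodPow x y h)) m ℚ.≤ ρ))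
  (B : ℕ → ℂ) (bern : AreTwistedBernoulli h x y L (ℚ→ℂ z) B) where

  private
    w : ℂ
    w = prodPow x y h

    w≈ : w ≈ᶜ ξ ^ᶜ f *ᶜ (q ^ᶜ f) ^ᶜ h
    w≈ = prodPow≈ x y h (trans (^ᶜ-≡ ξ f) (sym x≡)) (trans (^ᶜ-≡ q f) (sym y≡))

    open TwistedSums q ξ w h a f 0<a a<f w≈ z z*f≡a 0≤ρ ρ<1 w≤ρ
    open ZetaFormula q ξ w h a f 0<a a<f w≈ z z*f≡a
    open ℂᴳ.Progression q ξ h a f 0<a a<f w w≈ z z*f≡a

    S : ℕ → ℂ
    S m = factor m *ᶜ g m

    -s≈ : ∀ n .{{_ : NonZero n}} s → s ≡ 1# - ℕ→ℂ n → - s ≈ ℚ→ℂ (ι (n ∸ 1))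
    -s≈ (suc m) _ refl = -[1-n]≈ m

    -[s-1]≈ : ∀ n .{{_ : NonZero n}} s → s ≡ 1# - ℕ→ℂ n → - (s - 1#) ≈ ℚ→ℂ (ι n)
    -[s-1]≈ (suc m) _ refl = -[1-n-1]≈ m

    [s-1]*r≈1 : ∀ n .{{_ : NonZero n}} p s r → p ℚ.* ι n ≡ 1ℚ → s ≡ 1# - ℕ→ℂ n → r ≡ - ℚ→ℂ p → (s - 1#) * r ≈ 1#
    [s-1]*r≈1 (suc m) p _ _ p*n≡1 refl refl = reciprocal m p p*n≡1

    v≈ : ∀ n .{{_ : NonZero n}} p v r → p ℚ.* ι n ≡ 1ℚ → r ≡ - ℚ→ℂ p →
      v ≡ - (q ^ (h ℕ.* a) * ξ ^ a * ℕ→ℂ f ^ (n ∸ 1) * B n * ℚ→ℂ p) →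
      v ≈ S (n ∸ 1) - (ℕ→ℂ h * ℓ) * r * S n
    v≈ (suc m) p _ _ p*n≡1 refl refl = value ℓ L m g B p p*n≡1 (ℕ→ℂ-*≈ f ℓ L L≡) (bernoulli-≈ x y L refl B bern (suc m))

    fromSums : ∀ s v S T r → IsTwistedSum h ξ q a f s S → IsTwistedSum h ξ q a f (s - 1#) T →
      (s - 1#) * r ≈ 1# → v ≈ S - (ℕ→ℂ h * ℓ) * r * T → IsPartialZeta h ξ q ℓ a f s v
    fromSums s v S T r sumS sumT s-1*r≈1 v≈ = S , T , r , sumS , sumT , s-1*r≈1 , v≈

    partialZeta′ : ∀ n .{{_ : NonZero n}} p s v → p ℚ.* ι n ≡ 1ℚ → s ≡ 1# - ℕ→ℂ n →
      v ≡ - (q ^ (h ℕ.* a) * ξ ^ a * ℕ→ℂ f ^ (n ∸ 1) * B n * ℚ→ℂ p) →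
      ∀ r → r ≡ - ℚ→ℂ p → IsPartialZeta h ξ q ℓ a f s v
    -- With s = 1 - n, the two sums have exponents - s = n - 1 and - (s - 1) = n, and r = - 1/n
    -- inverts s - 1.
    partialZeta′ n p s v p*n≡1 s≡ v≡ r r≡ = fromSums s v (S (n ∸ 1)) (S n) r
      (twistedSum {s} (n ∸ 1) (-s≈ n s s≡))
      (twistedSum {s - 1#} n (-[s-1]≈ n s s≡))
      ([s-1]*r≈1 n p s r p*n≡1 s≡ r≡)
      (v≈ n p v r p*n≡1 r≡ v≡)

  partialZeta : ∀ n .{{_ : NonZero n}} p s v → p ℚ.* ι n ≡ 1ℚ → s ≡ 1# - ℕ→ℂ n →
    v ≡ - (q ^ (h ℕ.* a) * ξ ^ a * ℕ→ℂ f ^ (n ∸ 1) * B n * ℚ→ℂ p) →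
    IsPartialZeta h ξ q ℓ a f s v
  partialZeta n p s v p*n≡1 s≡ v≡ = partialZeta′ n p s v p*n≡1 s≡ v≡ (- ℚ→ℂ p) refl

zetaValue : ∀ (q log-q : ℂ) (∣q∣ : ℝ) → IsModulus q ∣q∣ → 0ᴿ <ᴿ ∣q∣ → ∣q∣ <ᴿ 1ᴿ →
    ∀ (h : ℕ) .{{_ : NonZero h}} (ξ : ℂ) → IsRootOfUnity ξ →
    ∀ (a f : ℕ) .{{_ : NonZero f}} → 0 ℕ.< a → a ℕ.< f →
    ∀ (n : ℕ) .{{_ : NonZero n}} (B : ℕ → ℂ) →
    (∃[ x ] ∃[ y ] ∃[ L ] ∃[ z ] (x ≡ ξ ^ f × y ≡ q ^ f × L ≡ ℕ→ℂ f * log-q × z ≡ (+ a) ℚ./ f ×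
      AreTwistedBernoulli h x y L (ℚ→ℂ z) B)) →
    ∀ s v p → s ≡ 1# - ℕ→ℂ n → p ≡ (+ 1) ℚ./ n →
    v ≡ - (q ^ (h ℕ.* a) * ξ ^ a * ℕ→ℂ f ^ (n ∸ 1) * B n * ℚ→ℂ p) →
    IsPartialZeta h ξ q log-q a f s v
zetaValue q log-q ∣q∣ mod 0<∣q∣ ∣q∣<1 h ξ root a f 0<a a<f n B (x , y , L , z , x≡ , y≡ , L≡ , z≡ , bern) s v p s≡ p≡ =
  partialZeta n p s v (trans (cong (ℚ._* ι n) p≡) (/-*-cancel (+ 1) n)) s≡
  where
  bound : ∃[ ρ ] (0ℚ ℚ.≤ ρ × ρ ℚ.< 1ℚ × Lim.Eventually (λ m → seq (normSq (prodPow x y h)) m ℚ.≤ ρ))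
  bound = prodPow-bound q ∣q∣ mod 0<∣q∣ ∣q∣<1 ξ root f h x y x≡ y≡
  z*f≡a : z ℚ.* ι f ≡ ι a
  z*f≡a = trans (cong (ℚ._* ι f) z≡) (trans (/-*-cancel (+ a) f) (sym (ι≡/1 a)))
  open PartialZeta q log-q ξ h a f 0<a a<f z z*f≡a x y L x≡ y≡ L≡
    (proj₁ (proj₂ bound)) (proj₁ (proj₂ (proj₂ bound))) (proj₂ (proj₂ (proj₂ bound))) B bern

corollary1 : ∀ (q log-q : ℂ) → IsExp log-q q →
    ∀ (∣q∣ : ℝ) → IsModulus q ∣q∣ → 0ᴿ <ᴿ ∣q∣ → ∣q∣ <ᴿ 1ᴿ →
    ∀ (h : ℕ) .{{_ : NonZero h}} →
    ∀ (ξ : ℂ) → IsRootOfUnity ξ →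
    ∀ (a f : ℕ) .{{_ : NonZero f}} → 0 ℕ.< a → a ℕ.< f →
    ∀ (n : ℕ) .{{_ : NonZero n}} →
    ∀ (B : ℕ → ℂ) →
    AreTwistedBernoulli h (ξ ^ f) (q ^ f) (ℕ→ℂ f * log-q) (ℚ→ℂ ((+ a) ℚ./ f)) B →
    IsPartialZeta h ξ q log-q a f (1# - ℕ→ℂ n)
    (- (q ^ (h ℕ.* a) * ξ ^ a * ℕ→ℂ f ^ (n ∸ 1) * B n * ℚ→ℂ ((+ 1) ℚ./ n)))
corollary1 q log-q _ ∣q∣ mod 0<∣q∣ ∣q∣<1 h ξ root a f {{f≢0}} 0<a a<f n {{n≢0}} B bern =
  generaliseZeta h ξ q log-q a f n {{n≢0}} B
    (zetaValue q log-q ∣q∣ mod 0<∣q∣ ∣q∣<1 h ξ root a f {{f≢0}} 0<a a<f n {{n≢0}} B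
      (generaliseBernoulli {h} {ξ} {q} {a} {f} {log-q} {B} {{f≢0}} bern))
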